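{- Let $k$ and $n$ be positive integers with $k\leq n^2$. Let $m$ be the smallest positive integer such that $G(m)\geq k$, where $$ G(m) = \begin{cases}\left\lfloor\frac{m^2}{12}\right\rfloor+1 & \text{if } m\equiv 3,6,9\pmod{12}, \text{ or if } m=10,\\[2mm] \left\lfloor\frac{m^2}{12}\right\rfloor & \text{otherwise}. \end{cases} $$ Then, among all placements of $k$ queens on distinct squares of an $n\times n$ chessboard, the minimum possible number of squares attacked by these queens is $mn+O(k)$, where the implied constant in $O(k)$ is absolute (independent of $k$, $n$ and $m$).
   Context: A queen on a square attacks every square lying on the same row, the same column, or either of the two diagonals (lines of slope $+1$ and $-1$) through its square; blocking by other pieces is ignored, so the set of squares attacked by a collection of queens is the union of the rows, columns and diagonals passing through the queens' squares. -}

module Defs where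

open import Data.Nat using (ℕ; zero; suc; _+_; _*_; _≡ᵇ_; _/_; _%_)
open import Data.Bool using (Bool; true; false; _∨_; if_then_else_)
open import Data.Fin using (Fin; toℕ)
open import Data.Product using (_×_; _,_)
open import Data.List using (List; []; _∷_; cartesianProduct; allFin)
open import Data.Bool.ListAction using (any)

bonus : ℕ → Bool
bonus m = (m % 12 ≡ᵇ 3) ∨ (m % 12 ≡ᵇ 6) ∨ (m % 12 ≡ᵇ 9) ∨ (m ≡ᵇ 10)

G : ℕ → ℕ
G m = (m * m) / 12 + (if bonus m then 1 else 0)

Square : ℕ → Set
Square n = Fin n × Fin n

-- A queen on q attacks s iff they share a row, a column, or a diagonal of
-- slope +1 or -1 (blocking ignored; the queen's own square is on its lines).
attacks : ∀ {n} → Square n → Square n → Bool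
attacks (r , c) (r' , c') =
  (toℕ r ≡ᵇ toℕ r') ∨ (toℕ c ≡ᵇ toℕ c')
  ∨ (toℕ r + toℕ c ≡ᵇ toℕ r' + toℕ c')
  ∨ (toℕ r + toℕ c' ≡ᵇ toℕ r' + toℕ c)

allSquares : ∀ n → List (Square n)
allSquares n = cartesianProduct (allFin n) (allFin n)

count : ∀ {A : Set} → (A → Bool) → List A → ℕ
count p [] = 0
count p (x ∷ xs) = if p x then suc (count p xs) else count p xs

attackedCount : ∀ {n} → List (Square n) → ℕ
attackedCount {n} qs = count (λ s → any (λ q → attacks q s) qs) (allSquares n)

{-# OPTIONS --safe #-}
-- Lower bound. A row or a column has n squares, and through every square the diagonal and the antidiagonal
-- together have more than n. For each threshold 0 ≤ δ < n, the used diagonals of length at least n − δ and the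
-- used antidiagonals of length at least δ + 1 therefore contain all queens; let c(δ) be their number, so that
-- ∑ c(δ) is the total length of the used diagonals and antidiagonals. If the queens occupy a rows and b columns,
-- then k ≤ G(a + b + c(δ)), hence a + b + c(δ) ≥ m for each δ, and summing over δ the lines have total length at
-- least mn. Keeping only the m longest lines of each direction, they overlap in O(m²) = O(k) squares.
--
-- For k ≤ G(p + c) with p = a + b and c diagonals: a diagonal meets the boundary of a box at most twice, so
-- removing the two extreme rows and the two extreme columns costs at most 2c queens. Iterating until about c rows
-- and columns are left gives 12 k ≤ (p + c)² − (3c − (p + c))² up to a rounding term. The rounding is harmful only
-- if p ≡ c + 2 modulo 4 and all layers are tight; two consecutive tight layers around a full grid are so rigid
-- that c + 2 is divisible by 4, and then G has its bonus or there is slack left.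
--
-- Upper bound. A hexagon of G(m) squares near a corner of the board lies on a rows, b columns and c diagonals with
-- a + b + c = m, and all its antidiagonals are short. For m ≡ 6 modulo 12 four such hexagons, one in each corner,
-- share their diagonals; for m = 10 nine queens sit at the corners, edge midpoints and centre of the board.
module Submission where

open import Defs
open import Data.Nat using (ℕ; _+_; _*_; _≤_; _<_; _≥_)
open import Data.Product using (Σ; _×_)
open import Data.List using (List; length)
open import Data.List.Relation.Unary.Unique.Propositional using (Unique)
open import Relation.Binary.PropositionalEquality using (_≡_)
open import Data.Nat using (zero; suc; _∸_; z≤n; s≤s; _≟_; _≤?_; _<?_; ∣_-_∣; _≡ᵇ_)
open import Data.List using ([]; _∷_; _++_; map; filter; cartesianProduct; take; upTo; allFin)
open import Data.List.Relation.Unary.All as All using (All; []; _∷_)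
open import Data.List.Relation.Unary.Any as Any using (Any; here; there)
open import Data.List.Relation.Unary.AllPairs as AllPairs using ([]; _∷_; AllPairs)
open import Data.List.Membership.Propositional using (_∈_; find; lose)
open import Data.List.Membership.Propositional.Properties using (∈-filter⁺; ∈-filter⁻; ∈-cartesianProduct⁺; ∈-cartesianProduct⁻; ∈-map⁺; ∈-map⁻; ∈-allFin; ∈-upTo⁺; ∈-upTo⁻; ∈-++⁻)
open import Data.Product using (_,_; proj₁; proj₂; ∃)
open import Data.Sum using (_⊎_; inj₁; inj₂)
open import Data.Empty using (⊥; ⊥-elim)
open import Function using (_∘_; Equivalence; id)
open import Relation.Unary using (Decidable)
open import Relation.Nullary using (¬_; Dec; yes; no; contradiction; ¬?; _×-dec_; _⊎-dec_)
open import Relation.Binary.PropositionalEquality using (_≢_; refl; sym; trans; cong; cong₂; subst; module ≡-Reasoning; subst₂; setoid)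
open import Data.Nat.Tactic.RingSolver using () renaming (solve-∀ to ℕ-solve-∀)
open import Data.Product.Properties using (≡-dec)
open import Data.Nat.DivMod using (_/_; _%_; m%n<n; m≡m%n+[m/n]*n; [m+kn]%n≡m%n; /-monoˡ-≤; m*n/n≡m; result; _divMod_; m<n*o⇒m/o<n)
open import Data.Bool using (true; false; if_then_else_; _∨_; Bool; T; T?)
open import Data.Bool.Properties using (T-∨)
open import Data.Fin using (Fin; zero; suc; toℕ; fromℕ<)
open import Data.List.Relation.Unary.Sorted.TotalOrder.Properties using (Sorted⇒AllPairs)
open import Data.List.Relation.Binary.Permutation.Propositional using (↭-sym; ↭⇒↭ₛ)
open import Data.List.Relation.Binary.Permutation.Propositional.Properties using (↭-length; filter-↭; ∈-resp-↭)
open import Data.Fin.Properties using (toℕ<n; toℕ-injective; toℕ-fromℕ<)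
open import Data.List.Properties using (length-map; length-++; length-upTo; filter-all; length-take; length-filter; length-tabulate)
open import Data.List.Relation.Unary.Any.Properties using (any⁺; any⁻; ++⁺ˡ; ++⁺ʳ) renaming (map⁺ to Any-map⁺)
open import Data.Bool.ListAction using (any)
open import Data.Unit using (⊤; tt)
import Data.Nat.Properties as ℕ
import Data.List.Relation.Unary.All.Properties as All
import Data.List.Relation.Unary.Unique.Propositional.Properties as Unique
import Data.List.Relation.Unary.AllPairs.Properties as AllPairs
import Data.List.Sort as Sort
import Data.List.Relation.Binary.Permutation.Setoid.Properties as Permutation
import Relation.Binary.Construct.On as On

-- The obstacle is that diagonals, unlike rows, have unequal lengths, so few lines need not mean few
-- squares. Thresholds separate the two issues: a diagonal counts at as many thresholds as it has
-- squares, while at a fixed threshold the lines are merely counted. The value m²/12 is an optimum.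
-- Removing j layers gives 4k ≤ 8cj + (p - 4j)²; with p - 4j = c this reads 4k ≤ 2cp - c², and under
-- p + c = m the right side is largest at c = m/3. Since a layer removes four lines at a time, p -
-- 4j meets c only approximately, and for residue 2 the plain bound may exceed G by one queen. The
-- exceptional m = 10 belongs to c = 4, p = 6: a full 3 by 3 grid has no second layer around it that
-- could be exploited. The constant is 592 = 16 · 37: at most 4m chosen lines overlap in at most
-- 16m² squares, and m² ≤ 37k by minimality of m. The same m² ≤ 37k pays for the short lines of the
-- constructions.

module LinearArithmetic where

  open import Data.Nat using (ℕ; zero; suc; _+_; _*_; _≤_; _<_; z≤n)
  import Data.Nat.Properties as ℕ
  open import Data.Integer as ℤ using (ℤ; +_; -[1+_]; 0ℤ; 1ℤ)
  import Data.Integer.Properties as ℤ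
  open import Data.Integer.Tactic.RingSolver using (solve-∀)
  open import Data.Bool using (Bool; true; false; T; _∧_)
  open import Data.Bool.Properties using (T-∧)
  open import Data.List using (List; []; _∷_; _++_; map; concatMap; length)
  open import Data.List.Relation.Unary.All as All using (All; []; _∷_)
  import Data.List.Relation.Unary.All.Properties as All
  open import Data.Product using (_×_; _,_)
  open import Data.Empty using (⊥)
  open import Function using (Equivalence)
  open import Relation.Nullary using (¬_)
  open import Relation.Binary.PropositionalEquality using (_≡_; refl; sym; trans; cong₂; subst; module ≡-Reasoning)

  infixl 6 _⊕_
  infixr 7 _⊙_
  infix 5 _≼_ _≺_ _≐_
  infixr 4 _⇒_
  infix 4 ⊢_

  data Exp : Set where
    var : ℕ → Exp
    nat : ℕ → Exp
    _⊕_ : Exp → Exp → Exp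
    _⊙_ : ℕ → Exp → Exp

  data Atom : Set where
    _≼_ _≺_ _≐_ : Exp → Exp → Atom

  data Sequent : Set where
    _⇒_ : Atom → Sequent → Sequent
    ⊢_ : Atom → Sequent
    ⊢⊥ : Sequent

  -- The default 0 out of range agrees with `dot`, which truncates in the same way; `dot-unit` then
  -- holds for all indices.
  nth : List ℕ → ℕ → ℕ
  nth [] _ = 0
  nth (x ∷ _) zero = x
  nth (_ ∷ ρ) (suc i) = nth ρ i

  ⟦_⟧ : Exp → List ℕ → ℕ
  ⟦ var i ⟧ ρ = nth ρ i
  ⟦ nat k ⟧ ρ = k
  ⟦ d ⊕ e ⟧ ρ = ⟦ d ⟧ ρ + ⟦ e ⟧ ρ
  ⟦ k ⊙ e ⟧ ρ = k * ⟦ e ⟧ ρ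

  ⟦_⟧ᵃ : Atom → List ℕ → Set
  ⟦ d ≼ e ⟧ᵃ ρ = ⟦ d ⟧ ρ ≤ ⟦ e ⟧ ρ
  ⟦ d ≺ e ⟧ᵃ ρ = ⟦ d ⟧ ρ < ⟦ e ⟧ ρ
  ⟦ d ≐ e ⟧ᵃ ρ = ⟦ d ⟧ ρ ≡ ⟦ e ⟧ ρ

  ⟦_⟧ˢ : Sequent → List ℕ → Set
  ⟦ a ⇒ s ⟧ˢ ρ = ⟦ a ⟧ᵃ ρ → ⟦ s ⟧ˢ ρ
  ⟦ ⊢ a ⟧ˢ ρ = ⟦ a ⟧ᵃ ρ
  ⟦ ⊢⊥ ⟧ˢ ρ = ⊥

  -- A form k , as stands for the affine function k + Σ aᵢ xᵢ, read as the constraint 0 ≤ k + Σ aᵢ xᵢ.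
  Form : Set
  Form = ℤ × List ℤ

  dot : List ℤ → List ℕ → ℤ
  dot [] _ = 0ℤ
  dot (_ ∷ _) [] = 0ℤ
  dot (a ∷ as) (x ∷ ρ) = a ℤ.* + x ℤ.+ dot as ρ

  value : Form → List ℕ → ℤ
  value (k , as) ρ = k ℤ.+ dot as ρ

  Holds : List ℕ → Form → Set
  Holds ρ f = 0ℤ ℤ.≤ value f ρ

  plus : List ℤ → List ℤ → List ℤ
  plus [] bs = bs
  plus as@(_ ∷ _) [] = as
  plus (a ∷ as) (b ∷ bs) = a ℤ.+ b ∷ plus as bs

  scale : ℤ → List ℤ → List ℤ
  scale c = map (c ℤ.*_)

  unit : ℕ → List ℤ
  unit zero = 1ℤ ∷ []
  unit (suc i) = 0ℤ ∷ unit i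

  combine : ℤ → Form → ℤ → Form → Form
  combine c (k , as) d (l , bs) = c ℤ.* k ℤ.+ d ℤ.* l , plus (scale c as) (scale d bs)

  dot-[] : ∀ as → dot as [] ≡ 0ℤ
  dot-[] [] = refl
  dot-[] (_ ∷ _) = refl

  dot-plus : ∀ as bs ρ → dot (plus as bs) ρ ≡ dot as ρ ℤ.+ dot bs ρ
  dot-plus [] bs ρ = sym (ℤ.+-identityˡ _)
  dot-plus (a ∷ as) [] ρ = sym (ℤ.+-identityʳ _)
  dot-plus (a ∷ as) (b ∷ bs) [] = refl
  dot-plus (a ∷ as) (b ∷ bs) (x ∷ ρ) rewrite dot-plus as bs ρ = lemma a b (+ x) (dot as ρ) (dot bs ρ)
    where
    lemma : ∀ a b x s t → (a ℤ.+ b) ℤ.* x ℤ.+ (s ℤ.+ t) ≡ a ℤ.* x ℤ.+ s ℤ.+ (b ℤ.* x ℤ.+ t)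
    lemma = solve-∀

  dot-scale : ∀ c as ρ → dot (scale c as) ρ ≡ c ℤ.* dot as ρ
  dot-scale c [] ρ = sym (ℤ.*-zeroʳ c)
  dot-scale c (a ∷ as) [] = sym (ℤ.*-zeroʳ c)
  dot-scale c (a ∷ as) (x ∷ ρ) rewrite dot-scale c as ρ = lemma c a (+ x) (dot as ρ)
    where
    lemma : ∀ c a x s → c ℤ.* a ℤ.* x ℤ.+ c ℤ.* s ≡ c ℤ.* (a ℤ.* x ℤ.+ s)
    lemma = solve-∀

  dot-unit : ∀ i ρ → dot (unit i) ρ ≡ + nth ρ i
  dot-unit zero [] = refl
  dot-unit (suc i) [] = refl
  dot-unit zero (x ∷ ρ) = trans (ℤ.+-identityʳ _) (ℤ.*-identityˡ (+ x))
  dot-unit (suc i) (x ∷ ρ) = trans (ℤ.+-identityˡ _) (dot-unit i ρ)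

  value-combine : ∀ c f d g ρ → value (combine c f d g) ρ ≡ c ℤ.* value f ρ ℤ.+ d ℤ.* value g ρ
  value-combine c (k , as) d (l , bs) ρ
    rewrite dot-plus (scale c as) (scale d bs) ρ | dot-scale c as ρ | dot-scale d bs ρ
    = lemma c d k l (dot as ρ) (dot bs ρ)
    where
    lemma : ∀ c d k l s t →
      c ℤ.* k ℤ.+ d ℤ.* l ℤ.+ (c ℤ.* s ℤ.+ d ℤ.* t) ≡ c ℤ.* (k ℤ.+ s) ℤ.+ d ℤ.* (l ℤ.+ t)
    lemma = solve-∀

  holds-combine : ∀ {ρ f g} a b → Holds ρ f → Holds ρ g → Holds ρ (combine (+ a) f (+ b) g)
  holds-combine {ρ} {f} {g} a b p q rewrite value-combine (+ a) f (+ b) g ρ =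
    ℤ.+-mono-≤ (nonneg a p) (nonneg b q)
    where
    nonneg : ∀ a {v} → 0ℤ ℤ.≤ v → 0ℤ ℤ.≤ + a ℤ.* v
    nonneg a {v} p = subst (ℤ._≤ + a ℤ.* v) (ℤ.*-zeroʳ (+ a)) (ℤ.*-monoˡ-≤-nonNeg (+ a) p)

  linear : Exp → Form
  linear (var i) = 0ℤ , unit i
  linear (nat k) = + k , []
  linear (d ⊕ e) = combine 1ℤ (linear d) 1ℤ (linear e)
  linear (k ⊙ e) = combine (+ k) (linear e) 0ℤ (0ℤ , [])

  value-linear : ∀ e ρ → value (linear e) ρ ≡ + ⟦ e ⟧ ρ
  value-linear (var i) ρ = trans (ℤ.+-identityˡ _) (dot-unit i ρ)
  value-linear (nat k) ρ = ℤ.+-identityʳ (+ k)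
  value-linear (d ⊕ e) ρ
    rewrite value-combine 1ℤ (linear d) 1ℤ (linear e) ρ | value-linear d ρ | value-linear e ρ
    = cong₂ ℤ._+_ (ℤ.*-identityˡ (+ ⟦ d ⟧ ρ)) (ℤ.*-identityˡ (+ ⟦ e ⟧ ρ))
  value-linear (k ⊙ e) ρ
    rewrite value-combine (+ k) (linear e) 0ℤ (0ℤ , []) ρ | value-linear e ρ
    = trans (ℤ.+-identityʳ _) (sym (ℤ.pos-* k (⟦ e ⟧ ρ)))

  le : Exp → Exp → Form
  le d e = combine 1ℤ (linear e) -[1+ 0 ] (linear d)

  holds-le : ∀ d e {ρ} → ⟦ d ⟧ ρ ≤ ⟦ e ⟧ ρ → Holds ρ (le d e)
  holds-le d e {ρ} p
    rewrite value-combine 1ℤ (linear e) -[1+ 0 ] (linear d) ρ | value-linear d ρ | value-linear e ρ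
    = subst (0ℤ ℤ.≤_) (lemma (+ ⟦ d ⟧ ρ) (+ ⟦ e ⟧ ρ)) (ℤ.i≤j⇒0≤j-i (ℤ.+≤+ p))
    where
    lemma : ∀ x y → y ℤ.- x ≡ 1ℤ ℤ.* y ℤ.+ -[1+ 0 ] ℤ.* x
    lemma = solve-∀

  data Split : Set where
    positive negative : ℕ → Form → Split
    absent : Form → Split

  -- The head coefficient is stripped; positive a and negative a stand for the coefficients suc a and - suc a.
  pivot : Form → Split
  pivot (k , []) = absent (k , [])
  pivot (k , + zero ∷ as) = absent (k , as)
  pivot (k , + suc a ∷ as) = positive a (k , as)
  pivot (k , -[1+ a ] ∷ as) = negative a (k , as)

  HoldsS : ℕ → List ℕ → Split → Set
  HoldsS x ρ (positive a (k , as)) = Holds (x ∷ ρ) (k , + suc a ∷ as)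
  HoldsS x ρ (negative a (k , as)) = Holds (x ∷ ρ) (k , -[1+ a ] ∷ as)
  HoldsS x ρ (absent f) = Holds ρ f

  holds-pivot : ∀ {x ρ} f → Holds (x ∷ ρ) f → HoldsS x ρ (pivot f)
  holds-pivot (k , []) p = p
  holds-pivot {x} {ρ} (k , + zero ∷ as) p = subst (λ v → 0ℤ ℤ.≤ k ℤ.+ v) (ℤ.+-identityˡ (dot as ρ)) p
  holds-pivot (k , + suc a ∷ as) p = p
  holds-pivot (k , -[1+ a ] ∷ as) p = p

  -- The positive multipliers cancel the head variable and preserve validity. Only the order
  -- positive, negative yields a form: `eliminate` runs through all ordered pairs, so each opposite
  -- pair is used once.
  eliminate₁ : Split → Split → List Form
  eliminate₁ (positive a f) (negative b g) = combine (+ suc b) f (+ suc a) g ∷ []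
  eliminate₁ _ _ = []

  absents : Split → List Form
  absents (absent f) = f ∷ []
  absents _ = []

  eliminate : List Split → List Form
  eliminate ss = concatMap absents ss ++ concatMap (λ s → concatMap (eliminate₁ s) ss) ss

  holds-eliminate₁ : ∀ {x ρ} s t → HoldsS x ρ s → HoldsS x ρ t → All (Holds ρ) (eliminate₁ s t)
  holds-eliminate₁ {x} {ρ} (positive a f@(k , as)) (negative b g@(l , bs)) p q =
    subst (0ℤ ℤ.≤_) eq (holds-combine {x ∷ ρ} {k , + suc a ∷ as} {l , -[1+ b ] ∷ bs} (suc b) (suc a) p q) ∷ []
    where
    open ≡-Reasoning
    lemma : ∀ A B X k l s t →
      B ℤ.* (k ℤ.+ (A ℤ.* X ℤ.+ s)) ℤ.+ A ℤ.* (l ℤ.+ ((ℤ.- B) ℤ.* X ℤ.+ t))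
      ≡ B ℤ.* (k ℤ.+ s) ℤ.+ A ℤ.* (l ℤ.+ t)
    lemma = solve-∀
    eq : value (combine (+ suc b) (k , + suc a ∷ as) (+ suc a) (l , -[1+ b ] ∷ bs)) (x ∷ ρ)
       ≡ value (combine (+ suc b) f (+ suc a) g) ρ
    eq = begin
      value (combine (+ suc b) (k , + suc a ∷ as) (+ suc a) (l , -[1+ b ] ∷ bs)) (x ∷ ρ)
        ≡⟨ value-combine (+ suc b) (k , + suc a ∷ as) (+ suc a) (l , -[1+ b ] ∷ bs) (x ∷ ρ) ⟩
      _ ≡⟨ lemma (+ suc a) (+ suc b) (+ x) k l (dot as ρ) (dot bs ρ) ⟩
      _ ≡⟨ sym (value-combine (+ suc b) f (+ suc a) g ρ) ⟩
      value (combine (+ suc b) f (+ suc a) g) ρ ∎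
  holds-eliminate₁ (positive _ _) (positive _ _) p q = []
  holds-eliminate₁ (positive _ _) (absent _) p q = []
  holds-eliminate₁ (negative _ _) t p q = []
  holds-eliminate₁ (absent _) t p q = []

  holds-absents : ∀ {x ρ} s → HoldsS x ρ s → All (Holds ρ) (absents s)
  holds-absents (positive _ _) p = []
  holds-absents (negative _ _) p = []
  holds-absents (absent _) p = p ∷ []

  all-concatMap : ∀ {A B : Set} {P : A → Set} {R : B → Set} {f : A → List B} →
    (∀ a → P a → All R (f a)) → ∀ {as} → All P as → All R (concatMap f as)
  all-concatMap h [] = []
  all-concatMap h (p ∷ ps) = All.++⁺ (h _ p) (all-concatMap h ps)

  holds-eliminate : ∀ {x ρ ss} → All (HoldsS x ρ) ss → All (Holds ρ) (eliminate ss)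
  holds-eliminate ps = All.++⁺ (all-concatMap holds-absents ps)
    (all-concatMap (λ s p → all-concatMap (λ t q → holds-eliminate₁ s t p q) ps) ps)

  refuted : ℕ → List Form → Bool
  refuted zero [] = false
  refuted zero ((+ _ , _) ∷ fs) = refuted zero fs
  refuted zero ((-[1+ _ ] , _) ∷ fs) = true
  refuted (suc n) fs = refuted n (eliminate (map pivot fs))

  refuted-sound : ∀ n ρ fs → length ρ ≡ n → All (Holds ρ) fs → T (refuted n fs) → ⊥
  refuted-sound zero [] ((+ _ , _) ∷ fs) eq (_ ∷ ps) t = refuted-sound zero [] fs eq ps t
  refuted-sound zero [] ((-[1+ k ] , as) ∷ fs) eq (p ∷ ps) t rewrite dot-[] as = case p
    where
    case : ¬ (0ℤ ℤ.≤ -[1+ k ])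
    case ()
  refuted-sound (suc n) (x ∷ ρ) fs eq ps t =
    refuted-sound n ρ _ (ℕ.suc-injective eq) (holds-eliminate (All.map⁺ (All.map (λ {f} → holds-pivot f) ps))) t

  nonnegs : ℕ → List Form
  nonnegs zero = []
  nonnegs (suc i) = (0ℤ , unit i) ∷ nonnegs i

  holds-nonnegs : ∀ n ρ → All (Holds ρ) (nonnegs n)
  holds-nonnegs zero ρ = []
  holds-nonnegs (suc i) ρ =
    subst (0ℤ ℤ.≤_) (sym (trans (ℤ.+-identityˡ _) (dot-unit i ρ))) (ℤ.+≤+ z≤n) ∷ holds-nonnegs i ρ

  forms : Atom → List Form
  forms (d ≼ e) = le d e ∷ []
  -- Strictness becomes `1 + d ≤ e`; integrality is used here and in the negation of goals, and
  -- nowhere else.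
  forms (d ≺ e) = le (nat 1 ⊕ d) e ∷ []
  forms (d ≐ e) = le d e ∷ le e d ∷ []

  holds-forms : ∀ a {ρ} → ⟦ a ⟧ᵃ ρ → All (Holds ρ) (forms a)
  holds-forms (d ≼ e) p = holds-le d e p ∷ []
  holds-forms (d ≺ e) p = holds-le (nat 1 ⊕ d) e p ∷ []
  holds-forms (d ≐ e) p = holds-le d e (ℕ.≤-reflexive p) ∷ holds-le e d (ℕ.≤-reflexive (sym p)) ∷ []

  valid : ℕ → List Form → Sequent → Bool
  valid n fs (a ⇒ s) = valid n (forms a ++ fs) s
  valid n fs (⊢ d ≼ e) = refuted n (le (nat 1 ⊕ e) d ∷ fs)
  valid n fs (⊢ d ≺ e) = refuted n (le e d ∷ fs)
  valid n fs (⊢ d ≐ e) = refuted n (le (nat 1 ⊕ e) d ∷ fs) ∧ refuted n (le (nat 1 ⊕ d) e ∷ fs)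
  valid n fs ⊢⊥ = refuted n fs

  valid-sound : ∀ n fs s {ρ} → length ρ ≡ n → All (Holds ρ) fs → T (valid n fs s) → ⟦ s ⟧ˢ ρ
  valid-sound n fs (a ⇒ s) eq ps t p = valid-sound n (forms a ++ fs) s eq (All.++⁺ (holds-forms a p) ps) t
  valid-sound n fs (⊢ d ≼ e) eq ps t = ℕ.≮⇒≥ λ q →
    refuted-sound n _ _ eq (holds-le (nat 1 ⊕ e) d q ∷ ps) t
  valid-sound n fs (⊢ d ≺ e) eq ps t = ℕ.≰⇒> λ q →
    refuted-sound n _ _ eq (holds-le e d q ∷ ps) t
  valid-sound n fs (⊢ d ≐ e) eq ps t with Equivalence.to T-∧ t
  ... | t₁ , t₂ = ℕ.≤-antisym
    (ℕ.≮⇒≥ λ q → refuted-sound n _ _ eq (holds-le (nat 1 ⊕ e) d q ∷ ps) t₁)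
    (ℕ.≮⇒≥ λ q → refuted-sound n _ _ eq (holds-le (nat 1 ⊕ d) e q ∷ ps) t₂)
  valid-sound n fs ⊢⊥ eq ps t = refuted-sound n _ _ eq ps t

  Family : ℕ → Set
  Family zero = Sequent
  Family (suc n) = Exp → Family n

  -- The first argument gets the largest index because `Closure` pushes every later value in front
  -- of it.
  instantiate : ∀ n → Family n → Sequent
  instantiate zero s = s
  instantiate (suc n) f = instantiate n (f (var n))

  Closure : (n : ℕ) → List ℕ → Sequent → Set
  Closure zero ρ s = ⟦ s ⟧ˢ ρ
  Closure (suc n) ρ s = (x : ℕ) → Closure n (x ∷ ρ) s

  closure : ∀ n ρ s → (∀ σ → length σ ≡ n + length ρ → ⟦ s ⟧ˢ σ) → Closure n ρ s
  closure zero ρ s h = h ρ refl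
  closure (suc n) ρ s h = λ x → closure n (x ∷ ρ) s λ σ eq → h σ (trans eq (ℕ.+-suc n _))

  abstract
    -- Fourier–Motzkin elimination: linarith n f proves the sequent f over n natural numbers
    -- whenever it is refutable over the non-negative rationals.
    linarith : ∀ n (f : Family n) {_ : T (valid n (nonnegs n) (instantiate n f))} → Closure n [] (instantiate n f)
    linarith n f {t} = closure n [] (instantiate n f) λ σ eq →
      valid-sound n (nonnegs n) (instantiate n f) (trans eq (ℕ.+-identityʳ n)) (holds-nonnegs n σ) t

open LinearArithmetic using (Exp; nat; _⊕_; _⊙_; _≼_; _≺_; _≐_; _⇒_; ⊢_; ⊢⊥; linarith)

-- Counting in lists

private variable
  𝔸 𝔹 𝕂 : Set

without : {P : 𝕂 → Set} {ks : List 𝕂} → Any P ks → List 𝕂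
without {ks = _ ∷ ks} (here _) = ks
without {ks = k ∷ _} (there p) = k ∷ without p

length-without : {P : 𝕂 → Set} {ks : List 𝕂} (p : Any P ks) → length ks ≡ suc (length (without p))
length-without (here _) = refl
length-without (there p) = cong suc (length-without p)

any-without : {P R : 𝕂 → Set} {ks : List 𝕂} (p : Any P ks) → Any R ks → (∃ λ k → P k × R k) ⊎ Any R (without p)
any-without (here p) (here r) = inj₁ (_ , p , r)
any-without (here _) (there r) = inj₂ r
any-without (there _) (here r) = inj₂ (here r)
any-without (there p) (there r) with any-without p r
... | inj₁ w = inj₁ w
... | inj₂ r′ = inj₂ (there r′)

-- A relation instead of a function: an element may hit several keys as long as no key is shared.
-- Deleting a key hit by the head therefore leaves all hits of the tail intact.
pigeonhole : (R : 𝔸 → 𝕂 → Set) {xs : List 𝔸} {ks : List 𝕂} → Unique xs →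
  (∀ {x} → x ∈ xs → Any (R x) ks) →
  (∀ {x x′ k} → x ∈ xs → x′ ∈ xs → R x k → R x′ k → x ≡ x′) →
  length xs ≤ length ks
pigeonhole R [] hit inj = z≤n
pigeonhole R {x ∷ xs} (x∉ ∷ u) hit inj rewrite length-without (hit (here refl)) =
  s≤s (pigeonhole R u hit′ (λ p q → inj (there p) (there q)))
  where
  hit′ : ∀ {x′} → x′ ∈ xs → Any (R x′) (without (hit (here refl)))
  hit′ x′∈ with any-without (hit (here refl)) (hit (there x′∈))
  ... | inj₁ (k , r , r′) = contradiction (inj (here refl) (there x′∈) r r′) (All.lookup x∉ x′∈)
  ... | inj₂ r = r

pigeonhole-< : (R : 𝔸 → 𝕂 → Set) {xs : List 𝔸} {ks : List 𝕂} → Unique xs →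
  (∀ {x} → x ∈ xs → Any (R x) ks) →
  (∀ {x x′ k} → x ∈ xs → x′ ∈ xs → R x k → R x′ k → x ≡ x′) →
  Any (λ k → ∀ {x} → x ∈ xs → ¬ R x k) ks → length xs < length ks
pigeonhole-< R {xs} u hit inj free rewrite length-without free = s≤s (pigeonhole R u hit′ inj)
  where
  hit′ : ∀ {x} → x ∈ xs → Any (R x) (without free)
  hit′ x∈ with any-without free (hit x∈)
  ... | inj₁ (k , f , r) = contradiction r (f x∈)
  ... | inj₂ r = r

pigeonhole-onto : (R : 𝔸 → 𝕂 → Set) → (∀ k → Decidable (λ x → R x k)) → {xs : List 𝔸} {ks : List 𝕂} → Unique xs →
  (∀ {x} → x ∈ xs → Any (R x) ks) →
  (∀ {x x′ k} → x ∈ xs → x′ ∈ xs → R x k → R x′ k → x ≡ x′) →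
  length ks ≤ length xs → ∀ {k} → k ∈ ks → ∃ λ x → x ∈ xs × R x k
pigeonhole-onto R R? {xs} u hit inj le {k} k∈ with Any.any? (R? k) xs
... | yes p = find p
... | no ¬p = contradiction le (ℕ.<⇒≱ (pigeonhole-< R u hit inj
      (lose k∈ λ x∈ r → ¬p (lose x∈ r))))

unique-⊆ : {xs ys : List 𝔸} → Unique xs → (∀ {x} → x ∈ xs → x ∈ ys) → length xs ≤ length ys
unique-⊆ u sub = pigeonhole _≡_ u sub λ { _ _ refl refl → refl }

unique-⊇ : ((x y : 𝔸) → Dec (x ≡ y)) → {xs ys : List 𝔸} → Unique xs → (∀ {x} → x ∈ xs → x ∈ ys) →
  length ys ≤ length xs → ∀ {y} → y ∈ ys → y ∈ xs
unique-⊇ _≟_ u sub le y∈ with pigeonhole-onto _≡_ (λ k x → x ≟ k) u sub (λ { _ _ refl refl → refl }) le y∈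
... | _ , x∈ , refl = x∈

𝟙 : {P : Set} → Dec P → ℕ
𝟙 (yes _) = 1
𝟙 (no _) = 0

𝟙-≤ : {P : Set} {n : ℕ} (d : Dec P) → (P → 1 ≤ n) → 𝟙 d ≤ n
𝟙-≤ (yes p) h = h p
𝟙-≤ (no _) h = z≤n

𝟙-≥ : {P : Set} (d : Dec P) → P → 1 ≤ 𝟙 d
𝟙-≥ (yes _) p = s≤s z≤n
𝟙-≥ (no ¬p) p = contradiction p ¬p

∑ : List 𝔸 → (𝔸 → ℕ) → ℕ
∑ [] f = 0
∑ (x ∷ xs) f = f x + ∑ xs f

# : {P : 𝔸 → Set} → Decidable P → List 𝔸 → ℕ
# P? xs = length (filter P? xs)

∑-≤ : ∀ (xs : List 𝔸) {f g} → (∀ {x} → x ∈ xs → f x ≤ g x) → ∑ xs f ≤ ∑ xs g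
∑-≤ [] h = z≤n
∑-≤ (x ∷ xs) h = ℕ.+-mono-≤ (h (here refl)) (∑-≤ xs (h ∘ there))

∑-< : ∀ {xs : List 𝔸} {f g x} → (∀ {x} → x ∈ xs → f x ≤ g x) → x ∈ xs → f x < g x → ∑ xs f < ∑ xs g
∑-< {xs = _ ∷ xs} h (here refl) lt = ℕ.+-mono-<-≤ lt (∑-≤ xs (h ∘ there))
∑-< h (there x∈) lt = ℕ.+-mono-≤-< (h (here refl)) (∑-< (h ∘ there) x∈ lt)

∑-cong : ∀ (xs : List 𝔸) {f g} → (∀ {x} → x ∈ xs → f x ≡ g x) → ∑ xs f ≡ ∑ xs g
∑-cong [] h = refl
∑-cong (x ∷ xs) h = cong₂ _+_ (h (here refl)) (∑-cong xs (h ∘ there))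

∑-+ : ∀ (xs : List 𝔸) f g → ∑ xs (λ x → f x + g x) ≡ ∑ xs f + ∑ xs g
∑-+ [] f g = refl
∑-+ (x ∷ xs) f g rewrite ∑-+ xs f g = interchange (f x) (g x) (∑ xs f) (∑ xs g)
  where open import Algebra.Properties.CommutativeSemigroup ℕ.+-commutativeSemigroup using (interchange)

∑-const : ∀ (xs : List 𝔸) c → ∑ xs (λ _ → c) ≡ length xs * c
∑-const [] c = refl
∑-const (x ∷ xs) c = cong (c +_) (∑-const xs c)

∑-comm : ∀ (xs : List 𝔸) (ys : List 𝔹) (f : 𝔸 → 𝔹 → ℕ) →
  ∑ xs (λ x → ∑ ys (f x)) ≡ ∑ ys (λ y → ∑ xs (λ x → f x y))
∑-comm [] ys f = sym (trans (∑-const ys 0) (ℕ.*-zeroʳ (length ys)))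
∑-comm (x ∷ xs) ys f rewrite ∑-comm xs ys f = sym (∑-+ ys (f x) (λ y → ∑ xs (λ x → f x y)))

#-∑ : ∀ {P : 𝔸 → Set} (P? : Decidable P) xs → # P? xs ≡ ∑ xs (λ x → 𝟙 (P? x))
#-∑ P? [] = refl
#-∑ P? (x ∷ xs) with P? x
... | yes _ = cong suc (#-∑ P? xs)
... | no _ = #-∑ P? xs

#-cong : ∀ {P R : 𝔸 → Set} (P? : Decidable P) (R? : Decidable R) xs →
  (∀ {x} → x ∈ xs → P x → R x) → (∀ {x} → x ∈ xs → R x → P x) → # P? xs ≡ # R? xs
#-cong P? R? xs f g rewrite #-∑ P? xs | #-∑ R? xs = ∑-cong xs λ {x} x∈ → ℕ.≤-antisym
  (𝟙-≤ (P? x) (𝟙-≥ (R? x) ∘ f x∈)) (𝟙-≤ (R? x) (𝟙-≥ (P? x) ∘ g x∈))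

#-complement : ∀ {P R : 𝔸 → Set} (P? : Decidable P) (R? : Decidable R) xs →
  (∀ {x} → x ∈ xs → P x → ¬ R x) → (∀ {x} → x ∈ xs → ¬ P x → R x) → # P? xs + # R? xs ≡ length xs
#-complement P? R? [] f g = refl
#-complement P? R? (x ∷ xs) f g with P? x | R? x
... | yes p | yes r = contradiction r (f (here refl) p)
... | yes p | no _ = cong suc (#-complement P? R? xs (f ∘ there) (g ∘ there))
... | no _ | yes _ = trans (ℕ.+-suc _ _) (cong suc (#-complement P? R? xs (f ∘ there) (g ∘ there)))
... | no ¬p | no ¬r = contradiction (g (here refl) ¬p) ¬r

-- Boundary layers of boxes

Point : Set
Point = ℕ × ℕ

_≟ᴾ_ : (p q : Point) → Dec (p ≡ q)
_≟ᴾ_ = ≡-dec _≟_ _≟_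

-- Subtraction-free forms of x - y = x′ - y′ and x + y = x′ + y′.
SameD SameE : Point → Point → Set
SameD (x , y) (x′ , y′) = x + y′ ≡ x′ + y
SameE (x , y) (x′ , y′) = x + y ≡ x′ + y′

sameD-trans : ∀ p q r → SameD p r → SameD q r → SameD p q
sameD-trans (x , y) (x′ , y′) (u , v) = linarith 6 (λ x y x′ y′ u v →
  x ⊕ v ≐ u ⊕ y ⇒ x′ ⊕ v ≐ u ⊕ y′ ⇒ ⊢ x ⊕ y′ ≐ x′ ⊕ y) x y x′ y′ u v

sameE-trans : ∀ p q r → SameE p r → SameE q r → SameE p q
sameE-trans p q r e f = trans e (sym f)

-- Along a diagonal both coordinates grow together, so distinct points of it are never ordered
-- oppositely in the two coordinates.
comparable-D : ∀ {x y x′ y′} → x ≤ x′ → y′ ≤ y → x + y′ ≡ x′ + y → (x , y) ≡ (x′ , y′)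
comparable-D {x} {y} {x′} {y′} p q e = cong₂ _,_
  (linarith 4 (λ x y x′ y′ → x ≼ x′ ⇒ y′ ≼ y ⇒ x ⊕ y′ ≐ x′ ⊕ y ⇒ ⊢ x ≐ x′) x y x′ y′ p q e)
  (linarith 4 (λ x y x′ y′ → x ≼ x′ ⇒ y′ ≼ y ⇒ x ⊕ y′ ≐ x′ ⊕ y ⇒ ⊢ y ≐ y′) x y x′ y′ p q e)

comparable-E : ∀ {x y x′ y′} → x ≤ x′ → y ≤ y′ → x + y ≡ x′ + y′ → (x , y) ≡ (x′ , y′)
comparable-E {x} {y} {x′} {y′} p q e = cong₂ _,_
  (linarith 4 (λ x y x′ y′ → x ≼ x′ ⇒ y ≼ y′ ⇒ x ⊕ y ≐ x′ ⊕ y′ ⇒ ⊢ x ≐ x′) x y x′ y′ p q e)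
  (linarith 4 (λ x y x′ y′ → x ≼ x′ ⇒ y ≼ y′ ⇒ x ⊕ y ≐ x′ ⊕ y′ ⇒ ⊢ y ≐ y′) x y x′ y′ p q e)

record Box : Set where
  field
    x₀ x₁ y₀ y₁ : ℕ

  _∋_ : Point → Set
  _∋_ (x , y) = (x₀ ≤ x × x ≤ x₁) × (y₀ ≤ y × y ≤ y₁)

  Top Bottom Left Right : Point → Set
  Top (x , y) = x ≡ x₀
  Bottom (x , y) = x ≡ x₁
  Left (x , y) = y ≡ y₀
  Right (x , y) = y ≡ y₁

  TopLeft BottomRight TopRight BottomLeft Boundary : Point → Set
  TopLeft p = Top p ⊎ Left p
  BottomRight p = Bottom p ⊎ Right p
  TopRight p = Top p ⊎ Right p
  BottomLeft p = Bottom p ⊎ Left p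
  Boundary p = TopLeft p ⊎ BottomRight p

  topLeft? : Decidable TopLeft
  topLeft? (x , y) = x ≟ x₀ ⊎-dec y ≟ y₀
  bottomRight? : Decidable BottomRight
  bottomRight? (x , y) = x ≟ x₁ ⊎-dec y ≟ y₁
  topRight? : Decidable TopRight
  topRight? (x , y) = x ≟ x₀ ⊎-dec y ≟ y₁
  bottomLeft? : Decidable BottomLeft
  bottomLeft? (x , y) = x ≟ x₁ ⊎-dec y ≟ y₀
  boundary? : Decidable Boundary
  boundary? p = topLeft? p ⊎-dec bottomRight? p

  topRight⊎bottomLeft : ∀ p → Boundary p → TopRight p ⊎ BottomLeft p
  topRight⊎bottomLeft p (inj₁ (inj₁ t)) = inj₁ (inj₁ t)
  topRight⊎bottomLeft p (inj₁ (inj₂ l)) = inj₂ (inj₂ l)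
  topRight⊎bottomLeft p (inj₂ (inj₁ b)) = inj₂ (inj₁ b)
  topRight⊎bottomLeft p (inj₂ (inj₂ r)) = inj₁ (inj₂ r)

  -- Going up the left side and then along the top side to the right, x - y strictly decreases, so a
  -- diagonal meets this path once. The four lemmas of this kind give every line at most two ends on
  -- the boundary.
  topLeft-inj : ∀ p q → _∋_ p → _∋_ q → TopLeft p → TopLeft q → SameD p q → p ≡ q
  topLeft-inj (x , y) _ _ _ (inj₁ refl) (inj₁ refl) e = cong (x ,_) (sym (ℕ.+-cancelˡ-≡ x _ _ e))
  topLeft-inj _ _ (_ , b , _) ((c , _) , _) (inj₁ refl) (inj₂ refl) e = comparable-D c b e
  topLeft-inj _ _ ((a , _) , _) (_ , d , _) (inj₂ refl) (inj₁ refl) e = sym (comparable-D a d (sym e))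
  topLeft-inj (x , y) _ _ _ (inj₂ refl) (inj₂ refl) e = cong (_, y) (ℕ.+-cancelʳ-≡ y _ _ e)

  bottomRight-inj : ∀ p q → _∋_ p → _∋_ q → BottomRight p → BottomRight q → SameD p q → p ≡ q
  bottomRight-inj (x , y) _ _ _ (inj₁ refl) (inj₁ refl) e = cong (x ,_) (sym (ℕ.+-cancelˡ-≡ x _ _ e))
  bottomRight-inj _ _ (_ , _ , b) ((_ , c) , _) (inj₁ refl) (inj₂ refl) e = sym (comparable-D c b (sym e))
  bottomRight-inj _ _ ((_ , a) , _) (_ , _ , d) (inj₂ refl) (inj₁ refl) e = comparable-D a d e
  bottomRight-inj (x , y) _ _ _ (inj₂ refl) (inj₂ refl) e = cong (_, y) (ℕ.+-cancelʳ-≡ y _ _ e)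

  topRight-inj : ∀ p q → _∋_ p → _∋_ q → TopRight p → TopRight q → SameE p q → p ≡ q
  topRight-inj (x , y) _ _ _ (inj₁ refl) (inj₁ refl) e = cong (x ,_) (ℕ.+-cancelˡ-≡ x _ _ e)
  topRight-inj _ _ (_ , _ , b) ((c , _) , _) (inj₁ refl) (inj₂ refl) e = comparable-E c b e
  topRight-inj _ _ ((a , _) , _) (_ , _ , d) (inj₂ refl) (inj₁ refl) e = sym (comparable-E a d (sym e))
  topRight-inj (x , y) _ _ _ (inj₂ refl) (inj₂ refl) e = cong (_, y) (ℕ.+-cancelʳ-≡ y _ _ e)

  bottomLeft-inj : ∀ p q → _∋_ p → _∋_ q → BottomLeft p → BottomLeft q → SameE p q → p ≡ q
  bottomLeft-inj (x , y) _ _ _ (inj₁ refl) (inj₁ refl) e = cong (x ,_) (ℕ.+-cancelˡ-≡ x _ _ e)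
  bottomLeft-inj _ _ (_ , b , _) ((_ , c) , _) (inj₁ refl) (inj₂ refl) e = sym (comparable-E c b (sym e))
  bottomLeft-inj _ _ ((_ , a) , _) (_ , d , _) (inj₂ refl) (inj₁ refl) e = comparable-E a d e
  bottomLeft-inj (x , y) _ _ _ (inj₂ refl) (inj₂ refl) e = cong (_, y) (ℕ.+-cancelʳ-≡ y _ _ e)

record Extremes (A : List ℕ) : Set where
  field
    lo hi : ℕ
    inner : List ℕ
    lo∈ : lo ∈ A
    hi∈ : hi ∈ A
    lo<hi : lo < hi
    bounds : ∀ {a} → a ∈ A → lo ≤ a × a ≤ hi
    inner⁺ : ∀ {a} → a ∈ A → a ≢ lo → a ≢ hi → a ∈ inner
    inner⁻ : ∀ {a} → a ∈ inner → a ∈ A × lo < a × a < hi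
    inner-unique : Unique inner
    size : length A ≡ 2 + length inner

minimum : ∀ a A → ∃ λ m → m ∈ a ∷ A × (∀ {b} → b ∈ a ∷ A → m ≤ b)
minimum a [] = a , here refl , λ { (here refl) → ℕ.≤-refl }
minimum a (b ∷ A) with minimum b A
... | m , m∈ , m≤ with ℕ.≤-total a m
... | inj₁ a≤m = a , here refl , λ { (here refl) → ℕ.≤-refl ; (there p) → ℕ.≤-trans a≤m (m≤ p) }
... | inj₂ m≤a = m , there m∈ , λ { (here refl) → m≤a ; (there p) → m≤ p }

maximum : ∀ a A → ∃ λ m → m ∈ a ∷ A × (∀ {b} → b ∈ a ∷ A → b ≤ m)
maximum a [] = a , here refl , λ { (here refl) → ℕ.≤-refl }
maximum a (b ∷ A) with maximum b A
... | m , m∈ , m≥ with ℕ.≤-total a m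
... | inj₂ m≤a = a , here refl , λ { (here refl) → ℕ.≤-refl ; (there p) → ℕ.≤-trans (m≥ p) m≤a }
... | inj₁ a≤m = m , there m∈ , λ { (here refl) → a≤m ; (there p) → m≥ p }

extremes : ∀ {A} → Unique A → 2 ≤ length A → Extremes A
extremes {_ ∷ []} _ (s≤s ())
extremes {a ∷ A@(a′ ∷ _)} u@((a≢a′ ∷ _) ∷ _) _ with minimum a A | maximum a A
... | lo , lo∈ , lo≤ | hi , hi∈ , ≤hi = record
  { lo = lo ; hi = hi ; inner = inner ; lo∈ = lo∈ ; hi∈ = hi∈
  ; lo<hi = lo<hi
  ; bounds = λ p → lo≤ p , ≤hi p
  ; inner⁺ = λ p l h → ∈-filter⁺ strict? p (ℕ.≤∧≢⇒< (lo≤ p) (l ∘ sym) , ℕ.≤∧≢⇒< (≤hi p) h)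
  ; inner⁻ = ∈-filter⁻ strict?
  ; inner-unique = Unique.filter⁺ strict? u
  ; size = ℕ.≤-antisym (unique-⊆ u ⊆₁) (unique-⊆ u₂ ⊆₂)
  }
  where
  strict? : Decidable (λ b → lo < b × b < hi)
  strict? b = lo <? b ×-dec b <? hi
  inner = filter strict? (a ∷ A)
  lo<hi : lo < hi
  lo<hi = ℕ.≤∧≢⇒< (lo≤ hi∈) λ { refl → a≢a′ (ℕ.≤-antisym
    (ℕ.≤-trans (≤hi (here refl)) (lo≤ (there (here refl))))
    (ℕ.≤-trans (≤hi (there (here refl))) (lo≤ (here refl)))) }
  u₂ : Unique (lo ∷ hi ∷ inner)
  u₂ = (ℕ.<⇒≢ lo<hi ∷ All.map (ℕ.<⇒≢ ∘ proj₁) (All.all-filter strict? (a ∷ A)))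
     ∷ All.map (λ p → ℕ.<⇒≢ (proj₂ p) ∘ sym) (All.all-filter strict? (a ∷ A))
     ∷ Unique.filter⁺ strict? u
  ⊆₁ : ∀ {b} → b ∈ a ∷ A → b ∈ lo ∷ hi ∷ inner
  ⊆₁ {b} b∈ with b ≟ lo | b ≟ hi
  ... | yes p | _ = here p
  ... | no _ | yes p = there (here p)
  ... | no l | no h = there (there (∈-filter⁺ strict? b∈ (ℕ.≤∧≢⇒< (lo≤ b∈) (l ∘ sym) , ℕ.≤∧≢⇒< (≤hi b∈) h)))
  ⊆₂ : ∀ {b} → b ∈ lo ∷ hi ∷ inner → b ∈ a ∷ A
  ⊆₂ (here refl) = lo∈
  ⊆₂ (there (here refl)) = hi∈
  ⊆₂ (there (there p)) = proj₁ (∈-filter⁻ strict? p)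

length-× : ∀ (A B : List ℕ) → length (cartesianProduct A B) ≡ length A * length B
length-× [] B = refl
length-× (a ∷ A) B = trans (length-++ (map (a ,_) B)) (cong₂ _+_ (length-map (a ,_) B) (length-× A B))

4ab≤ : ∀ a b → 4 * (a * b) ≤ (a + b) * (a + b)
4ab≤ a b with ℕ.≤-total a b
... | inj₁ a≤b with ℕ.m≤n⇒∃[o]m+o≡n a≤b
... | d , refl = subst (4 * (a * (a + d)) ≤_) (lemma a d) (ℕ.m≤m+n _ (d * d))
  where
  lemma : ∀ a d → 4 * (a * (a + d)) + d * d ≡ (a + (a + d)) * (a + (a + d))
  lemma = ℕ-solve-∀
4ab≤ a b | inj₂ b≤a with ℕ.m≤n⇒∃[o]m+o≡n b≤a
... | d , refl = subst (4 * ((b + d) * b) ≤_) (lemma b d) (ℕ.m≤m+n _ (d * d))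
  where
  lemma : ∀ b d → 4 * ((b + d) * b) + d * d ≡ ((b + d) + b) * ((b + d) + b)
  lemma = ℕ-solve-∀

-- Queens on given rows, columns and diagonals, and the removal of boundary layers

record Placement : Set where
  field
    A B : List ℕ
    Q : List Point
    A-unique : Unique A
    B-unique : Unique B
    Q-unique : Unique Q
    on : ∀ {p} → p ∈ Q → proj₁ p ∈ A × proj₂ p ∈ B

  size : ℕ
  size = length Q

  lines : ℕ
  lines = length A + length B

  ⊆grid : ∀ {p} → p ∈ Q → p ∈ cartesianProduct A B
  ⊆grid p∈ = ∈-cartesianProduct⁺ (proj₁ (on p∈)) (proj₂ (on p∈))

  size≤ : size ≤ length A * length B
  size≤ = subst (size ≤_) (length-× A B) (unique-⊆ Q-unique ⊆grid)

  4size≤ : 4 * size ≤ lines * lines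
  4size≤ = ℕ.≤-trans (ℕ.*-monoʳ-≤ 4 size≤) (4ab≤ (length A) (length B))

enclose : ∀ {A B} → Extremes A → Extremes B → Box
enclose X Y = record { x₀ = lo X ; x₁ = hi X ; y₀ = lo Y ; y₁ = hi Y }
  where open Extremes

-- `Dg` and `Eg` tell which queens are charged to a diagonal and which to an antidiagonal; a queen
-- may satisfy both. The points of `LD` and `LE` are mere names of lines: after peeling they may lie
-- outside the remaining placement.
module Diagonals (Dg Eg : Point → Set) (Dg? : Decidable Dg) (Eg? : Decidable Eg) (LD LE : List Point) where

  c : ℕ
  c = length LD + length LE

  record Covered (Q : List Point) : Set where
    field
      good : ∀ {p} → p ∈ Q → Dg p ⊎ Eg p
      onD : ∀ {p} → p ∈ Q → Dg p → Any (SameD p) LD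
      onE : ∀ {p} → p ∈ Q → Eg p → Any (SameE p) LE

  -- What equality in the perimeter bound forces: every boundary queen is one end of one listed line
  -- only, and every listed line has both of its ends occupied.
  record Tight (b : Box) (Q : List Point) : Set where
    open Box b
    field
      single : ∀ {p} → p ∈ Q → Boundary p → Dg p → ¬ Eg p
      D-corner : ∀ {p} → p ∈ Q → Dg p → TopLeft p → ¬ BottomRight p
      E-corner : ∀ {p} → p ∈ Q → Eg p → TopRight p → ¬ BottomLeft p
      D-topLeft : ∀ {r} → r ∈ LD → ∃ λ p → p ∈ Q × Dg p × TopLeft p × SameD p r
      D-bottomRight : ∀ {r} → r ∈ LD → ∃ λ p → p ∈ Q × Dg p × BottomRight p × SameD p r
      E-topRight : ∀ {r} → r ∈ LE → ∃ λ p → p ∈ Q × Eg p × TopRight p × SameE p r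
      E-bottomLeft : ∀ {r} → r ∈ LE → ∃ λ p → p ∈ Q × Eg p × BottomLeft p × SameE p r
      D-balance : # (λ p → Dg? p ×-dec topLeft? p) Q ≡ # (λ p → Dg? p ×-dec bottomRight? p) Q
      E-balance : # (λ p → Eg? p ×-dec topRight? p) Q ≡ # (λ p → Eg? p ×-dec bottomLeft? p) Q

  module Perimeter (b : Box) {Q : List Point} (Q-unique : Unique Q) (inside : ∀ {p} → p ∈ Q → Box._∋_ b p)
    (cov : Covered Q) where
    open Box b
    open Covered cov

    d₁? : Decidable (λ p → Dg p × TopLeft p)
    d₁? p = Dg? p ×-dec topLeft? p
    d₂? : Decidable (λ p → Dg p × BottomRight p)
    d₂? p = Dg? p ×-dec bottomRight? p
    e₁? : Decidable (λ p → Eg p × TopRight p)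
    e₁? p = Eg? p ×-dec topRight? p
    e₂? : Decidable (λ p → Eg p × BottomLeft p)
    e₂? p = Eg? p ×-dec bottomLeft? p

    module Ends {P : Point → Set} (P? : Decidable P) (Same : Point → Point → Set)
      (Same? : ∀ r → Decidable (λ p → Same p r))
      (Same-trans : ∀ p q r → Same p r → Same q r → Same p q) (L : List Point)
      (hit : ∀ {p} → p ∈ Q → P p → Any (Same p) L)
      (inj : ∀ p q → _∋_ p → _∋_ q → P p → P q → Same p q → p ≡ q) where

      inj′ : ∀ {p q r} → p ∈ filter P? Q → q ∈ filter P? Q → Same p r → Same q r → p ≡ q
      inj′ {p} {q} {r} p∈ q∈ s t with ∈-filter⁻ P? p∈ | ∈-filter⁻ P? q∈
      ... | p∈ , Pp | q∈ , Pq = inj p q (inside p∈) (inside q∈) Pp Pq (Same-trans p q r s t)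

      hit′ : ∀ {p} → p ∈ filter P? Q → Any (Same p) L
      hit′ p∈ with ∈-filter⁻ P? p∈
      ... | p∈ , Pp = hit p∈ Pp

      ends≤ : # P? Q ≤ length L
      ends≤ = pigeonhole Same (Unique.filter⁺ P? Q-unique) hit′ inj′

      onto : length L ≤ # P? Q → ∀ {r} → r ∈ L → ∃ λ p → p ∈ Q × P p × Same p r
      onto le r∈ with pigeonhole-onto Same Same? (Unique.filter⁺ P? Q-unique) hit′ inj′ le r∈
      ... | p , p∈ , s with ∈-filter⁻ P? p∈
      ... | p∈ , Pp = p , p∈ , Pp , s

    sameD? : ∀ r → Decidable (λ p → SameD p r)
    sameD? (u , v) (x , y) = x + v ≟ u + y
    sameE? : ∀ r → Decidable (λ p → SameE p r)
    sameE? (u , v) (x , y) = x + y ≟ u + v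

    module D₁ = Ends d₁? SameD sameD? sameD-trans LD (λ p∈ → onD p∈ ∘ proj₁)
      (λ p q i j P Q → topLeft-inj p q i j (proj₂ P) (proj₂ Q))
    module D₂ = Ends d₂? SameD sameD? sameD-trans LD (λ p∈ → onD p∈ ∘ proj₁)
      (λ p q i j P Q → bottomRight-inj p q i j (proj₂ P) (proj₂ Q))
    module E₁ = Ends e₁? SameE sameE? sameE-trans LE (λ p∈ → onE p∈ ∘ proj₁)
      (λ p q i j P Q → topRight-inj p q i j (proj₂ P) (proj₂ Q))
    module E₂ = Ends e₂? SameE sameE? sameE-trans LE (λ p∈ → onE p∈ ∘ proj₁)
      (λ p q i j P Q → bottomLeft-inj p q i j (proj₂ P) (proj₂ Q))

    -- The double count behind `perimeter`: a boundary queen is an end of at least one listed line,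
    -- whereas a listed line supplies at most one end of each of its two kinds.
    weight : Point → ℕ
    weight p = (𝟙 (d₁? p) + 𝟙 (d₂? p)) + (𝟙 (e₁? p) + 𝟙 (e₂? p))

    ∑-weight : ∑ Q weight ≡ (# d₁? Q + # d₂? Q) + (# e₁? Q + # e₂? Q)
    ∑-weight rewrite #-∑ d₁? Q | #-∑ d₂? Q | #-∑ e₁? Q | #-∑ e₂? Q
      | ∑-+ Q (λ p → 𝟙 (d₁? p) + 𝟙 (d₂? p)) (λ p → 𝟙 (e₁? p) + 𝟙 (e₂? p))
      | ∑-+ Q (𝟙 ∘ d₁?) (𝟙 ∘ d₂?) | ∑-+ Q (𝟙 ∘ e₁?) (𝟙 ∘ e₂?) = refl

    ∑-weight≤ : ∑ Q weight ≤ 2 * c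
    ∑-weight≤ = linarith 7 (λ s d₁ d₂ e₁ e₂ D E →
      s ≐ (d₁ ⊕ d₂) ⊕ (e₁ ⊕ e₂) ⇒ d₁ ≼ D ⇒ d₂ ≼ D ⇒ e₁ ≼ E ⇒ e₂ ≼ E ⇒ ⊢ s ≼ 2 ⊙ (D ⊕ E))
      (∑ Q weight) (# d₁? Q) (# d₂? Q) (# e₁? Q) (# e₂? Q) (length LD) (length LE)
      ∑-weight D₁.ends≤ D₂.ends≤ E₁.ends≤ E₂.ends≤

    d-weight : ∀ {p} → Dg p → Boundary p → 1 ≤ 𝟙 (d₁? p) + 𝟙 (d₂? p)
    d-weight {p} d (inj₁ t) = ℕ.≤-trans (𝟙-≥ (d₁? p) (d , t)) (ℕ.m≤m+n _ _)
    d-weight {p} d (inj₂ t) = ℕ.≤-trans (𝟙-≥ (d₂? p) (d , t)) (ℕ.m≤n+m _ _)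

    e-weight : ∀ {p} → Eg p → Boundary p → 1 ≤ 𝟙 (e₁? p) + 𝟙 (e₂? p)
    e-weight {p} e b with topRight⊎bottomLeft p b
    ... | inj₁ t = ℕ.≤-trans (𝟙-≥ (e₁? p) (e , t)) (ℕ.m≤m+n _ _)
    ... | inj₂ t = ℕ.≤-trans (𝟙-≥ (e₂? p) (e , t)) (ℕ.m≤n+m _ _)

    1≤weight : ∀ {p} → p ∈ Q → Boundary p → 1 ≤ weight p
    1≤weight {p} p∈ b with good p∈
    ... | inj₁ d = ℕ.≤-trans (d-weight d b) (ℕ.m≤m+n _ _)
    ... | inj₂ e = ℕ.≤-trans (e-weight e b) (ℕ.m≤n+m _ (𝟙 (d₁? p) + 𝟙 (d₂? p)))

    𝟙≤weight : ∀ {p} → p ∈ Q → 𝟙 (boundary? p) ≤ weight p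
    𝟙≤weight {p} p∈ = 𝟙-≤ (boundary? p) (1≤weight p∈)

    perimeter : # boundary? Q ≤ 2 * c
    perimeter rewrite #-∑ boundary? Q = ℕ.≤-trans (∑-≤ Q 𝟙≤weight) ∑-weight≤

    module _ (full : 2 * c ≤ # boundary? Q) where

      weight≤1 : ∀ {p} → p ∈ Q → ¬ 2 ≤ weight p
      weight≤1 {p} p∈ w = ℕ.<⇒≱
        (ℕ.≤-trans (∑-< 𝟙≤weight p∈ (ℕ.<-≤-trans (s≤s (𝟙≤1 (boundary? p))) w)) ∑-weight≤)
        (subst (2 * c ≤_) (#-∑ boundary? Q) full)
        where
        𝟙≤1 : ∀ {P : Set} (d : Dec P) → 𝟙 d ≤ 1
        𝟙≤1 d = 𝟙-≤ d λ _ → ℕ.≤-refl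

      total : 2 * c ≤ (# d₁? Q + # d₂? Q) + (# e₁? Q + # e₂? Q)
      total = subst (2 * c ≤_) ∑-weight (ℕ.≤-trans (subst (2 * c ≤_) (#-∑ boundary? Q) full) (∑-≤ Q 𝟙≤weight))

      d₁≥ : length LD ≤ # d₁? Q
      d₁≥ = linarith 6 (λ d₁ d₂ e₁ e₂ D E → 2 ⊙ (D ⊕ E) ≼ (d₁ ⊕ d₂) ⊕ (e₁ ⊕ e₂) ⇒
        d₂ ≼ D ⇒ e₁ ≼ E ⇒ e₂ ≼ E ⇒ ⊢ D ≼ d₁) (# d₁? Q) (# d₂? Q) (# e₁? Q) (# e₂? Q) (length LD) (length LE)
        total D₂.ends≤ E₁.ends≤ E₂.ends≤
      d₂≥ : length LD ≤ # d₂? Q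
      d₂≥ = linarith 6 (λ d₁ d₂ e₁ e₂ D E → 2 ⊙ (D ⊕ E) ≼ (d₁ ⊕ d₂) ⊕ (e₁ ⊕ e₂) ⇒
        d₁ ≼ D ⇒ e₁ ≼ E ⇒ e₂ ≼ E ⇒ ⊢ D ≼ d₂) (# d₁? Q) (# d₂? Q) (# e₁? Q) (# e₂? Q) (length LD) (length LE)
        total D₁.ends≤ E₁.ends≤ E₂.ends≤
      e₁≥ : length LE ≤ # e₁? Q
      e₁≥ = linarith 6 (λ d₁ d₂ e₁ e₂ D E → 2 ⊙ (D ⊕ E) ≼ (d₁ ⊕ d₂) ⊕ (e₁ ⊕ e₂) ⇒
        d₁ ≼ D ⇒ d₂ ≼ D ⇒ e₂ ≼ E ⇒ ⊢ E ≼ e₁) (# d₁? Q) (# d₂? Q) (# e₁? Q) (# e₂? Q) (length LD) (length LE)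
        total D₁.ends≤ D₂.ends≤ E₂.ends≤
      e₂≥ : length LE ≤ # e₂? Q
      e₂≥ = linarith 6 (λ d₁ d₂ e₁ e₂ D E → 2 ⊙ (D ⊕ E) ≼ (d₁ ⊕ d₂) ⊕ (e₁ ⊕ e₂) ⇒
        d₁ ≼ D ⇒ d₂ ≼ D ⇒ e₁ ≼ E ⇒ ⊢ E ≼ e₂) (# d₁? Q) (# d₂? Q) (# e₁? Q) (# e₂? Q) (length LD) (length LE)
        total D₁.ends≤ D₂.ends≤ E₁.ends≤

      tight : Tight b Q
      tight = record
        { single = λ p∈ b d e → weight≤1 p∈ (ℕ.+-mono-≤ (d-weight d b) (e-weight e b))
        ; D-corner = λ {p} p∈ d t s → weight≤1 p∈ (ℕ.≤-trans
            (ℕ.+-mono-≤ (𝟙-≥ (d₁? p) (d , t)) (𝟙-≥ (d₂? p) (d , s))) (ℕ.m≤m+n _ _))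
        ; E-corner = λ {p} p∈ e t s → weight≤1 p∈ (ℕ.≤-trans
            (ℕ.+-mono-≤ (𝟙-≥ (e₁? p) (e , t)) (𝟙-≥ (e₂? p) (e , s))) (ℕ.m≤n+m _ (𝟙 (d₁? p) + 𝟙 (d₂? p))))
        ; D-topLeft = λ r∈ → flat (D₁.onto d₁≥ r∈)
        ; D-bottomRight = λ r∈ → flat (D₂.onto d₂≥ r∈)
        ; E-topRight = λ r∈ → flat (E₁.onto e₁≥ r∈)
        ; E-bottomLeft = λ r∈ → flat (E₂.onto e₂≥ r∈)
        ; D-balance = trans (ℕ.≤-antisym D₁.ends≤ d₁≥) (ℕ.≤-antisym d₂≥ D₂.ends≤)
        ; E-balance = trans (ℕ.≤-antisym E₁.ends≤ e₁≥) (ℕ.≤-antisym e₂≥ E₂.ends≤)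
        }
        where
        flat : ∀ {P R S : Point → Set} → (∃ λ p → p ∈ Q × (P p × R p) × S p) → ∃ λ p → p ∈ Q × P p × R p × S p
        flat (p , p∈ , (u , v) , s) = p , p∈ , u , v , s

  covered-filter : ∀ {Q} {P : Point → Set} (P? : Decidable P) → Covered Q → Covered (filter P? Q)
  covered-filter P? cov = record
    { good = good ∘ proj₁ ∘ ∈-filter⁻ P?
    ; onD = onD ∘ proj₁ ∘ ∈-filter⁻ P?
    ; onE = onE ∘ proj₁ ∘ ∈-filter⁻ P? }
    where open Covered cov

  record Peeling (S : Placement) : Set where
    open Placement S
    field
      X : Extremes A
      Y : Extremes B
    box : Box
    box = enclose X Y
    open Box box using (_∋_; boundary?)
    field
      inside : ∀ {p} → p ∈ Q → _∋_ p
      peeled : Placement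
      A-peeled : Placement.A peeled ≡ Extremes.inner X
      B-peeled : Placement.B peeled ≡ Extremes.inner Y
      Q-peeled : ∀ {p} → p ∈ Placement.Q peeled → p ∈ Q
      peeled-covered : Covered (Placement.Q peeled)
      perimeter≤ : # boundary? Q ≤ 2 * c
      perimeter-tight : 2 * c ≤ # boundary? Q → Tight box Q
      size-split : # boundary? Q + Placement.size peeled ≡ size

    size-peeled : size ≤ 2 * c + Placement.size peeled
    size-peeled = subst (_≤ 2 * c + Placement.size peeled) size-split (ℕ.+-monoˡ-≤ _ perimeter≤)

    lines-peeled : lines ≡ 4 + Placement.lines peeled
    lines-peeled rewrite A-peeled | B-peeled =
      trans (cong₂ _+_ (Extremes.size X) (Extremes.size Y)) (lemma (length (Extremes.inner X)) (length (Extremes.inner Y)))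
      where
      lemma : ∀ a b → (2 + a) + (2 + b) ≡ 4 + (a + b)
      lemma = ℕ-solve-∀

  peel : (S : Placement) → Covered (Placement.Q S) →
    2 ≤ length (Placement.A S) → 2 ≤ length (Placement.B S) → Peeling S
  peel S cov 2≤A 2≤B = record
    { X = X ; Y = Y ; inside = inside
    ; peeled = record
      { A = Extremes.inner X ; B = Extremes.inner Y ; Q = filter interior? Q
      ; A-unique = Extremes.inner-unique X ; B-unique = Extremes.inner-unique Y
      ; Q-unique = Unique.filter⁺ interior? Q-unique
      ; on = on′ }
    ; A-peeled = refl
    ; B-peeled = refl
    ; Q-peeled = proj₁ ∘ ∈-filter⁻ interior?
    ; peeled-covered = covered-filter interior? cov
    ; perimeter≤ = Perimeter.perimeter box Q-unique inside cov
    ; perimeter-tight = Perimeter.tight box Q-unique inside cov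
    ; size-split = #-complement boundary? interior? Q (λ _ b ¬b → ¬b b) (λ _ ¬b → ¬b)
    }
    where
    open Placement S
    X = extremes A-unique 2≤A
    Y = extremes B-unique 2≤B
    box = enclose X Y
    open Box box

    inside : ∀ {p} → p ∈ Q → _∋_ p
    inside p∈ with on p∈
    ... | a , b = Extremes.bounds X a , Extremes.bounds Y b

    interior? : Decidable (¬_ ∘ Boundary)
    interior? p = ¬? (boundary? p)

    on′ : ∀ {p} → p ∈ filter interior? Q → proj₁ p ∈ Extremes.inner X × proj₂ p ∈ Extremes.inner Y
    on′ p∈ with ∈-filter⁻ interior? p∈
    ... | p∈ , ¬b with on p∈
    ... | a , b = Extremes.inner⁺ X a (¬b ∘ inj₁ ∘ inj₁) (¬b ∘ inj₂ ∘ inj₁)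
                , Extremes.inner⁺ Y b (¬b ∘ inj₁ ∘ inj₂) (¬b ∘ inj₂ ∘ inj₂)

  module Thin (S : Placement) (cov : Covered (Placement.Q S)) where
    open Placement S
    open Covered cov

    sameRow : ∀ {A′} → A ≡ A′ → length A′ ≤ 1 → ∀ {p q} → p ∈ Q → q ∈ Q → proj₁ p ≡ proj₁ q
    sameRow {[]} refl _ p∈ q∈ with on p∈
    ... | () , _
    sameRow {a ∷ []} refl _ p∈ q∈ with on p∈ | on q∈
    ... | here e , _ | here f , _ = trans e (sym f)
    sameRow {_ ∷ _ ∷ _} _ (s≤s ())

    sameCol : ∀ {B′} → B ≡ B′ → length B′ ≤ 1 → ∀ {p q} → p ∈ Q → q ∈ Q → proj₂ p ≡ proj₂ q
    sameCol {[]} refl _ p∈ q∈ with on p∈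
    ... | _ , ()
    sameCol {a ∷ []} refl _ p∈ q∈ with on p∈ | on q∈
    ... | _ , here e | _ , here f = trans e (sym f)
    sameCol {_ ∷ _ ∷ _} _ (s≤s ())

    -- Meant for a single row or column, where no two queens share a diagonal or an antidiagonal;
    -- then each queen needs a line of its own.
    thin : (∀ {p q} → p ∈ Q → q ∈ Q → SameD p q → p ≡ q) → (∀ {p q} → p ∈ Q → q ∈ Q → SameE p q → p ≡ q) → size ≤ c
    thin injD injE = ℕ.≤-trans size≤′ (ℕ.+-mono-≤
      (pigeonhole SameD (Unique.filter⁺ Dg? Q-unique) (λ p∈ → let p∈ , d = ∈-filter⁻ Dg? p∈ in onD p∈ d)
        λ {p} {q} {r} p∈ q∈ s t → injD (proj₁ (∈-filter⁻ Dg? p∈)) (proj₁ (∈-filter⁻ Dg? q∈)) (sameD-trans p q r s t))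
      (pigeonhole SameE (Unique.filter⁺ Eg? Q-unique) (λ p∈ → let p∈ , d = ∈-filter⁻ Eg? p∈ in onE p∈ d)
        λ {p} {q} {r} p∈ q∈ s t → injE (proj₁ (∈-filter⁻ Eg? p∈)) (proj₁ (∈-filter⁻ Eg? q∈)) (sameE-trans p q r s t)))
      where
      cover : ∀ {p} → p ∈ Q → 1 ≤ 𝟙 (Dg? p) + 𝟙 (Eg? p)
      cover {p} p∈ with good p∈
      ... | inj₁ d = ℕ.≤-trans (𝟙-≥ (Dg? p) d) (ℕ.m≤m+n _ _)
      ... | inj₂ e = ℕ.≤-trans (𝟙-≥ (Eg? p) e) (ℕ.m≤n+m _ _)
      size≤′ : size ≤ # Dg? Q + # Eg? Q
      size≤′ rewrite #-∑ Dg? Q | #-∑ Eg? Q | sym (∑-+ Q (𝟙 ∘ Dg?) (𝟙 ∘ Eg?)) =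
        subst (_≤ ∑ Q (λ p → 𝟙 (Dg? p) + 𝟙 (Eg? p))) (trans (∑-const Q 1) (ℕ.*-identityʳ _)) (∑-≤ Q cover)

    thin-rows : length A ≤ 1 → size ≤ c
    thin-rows A≤1 = thin
      (λ {p} p∈ q∈ → row p (sameRow refl A≤1 p∈ q∈))
      (λ {p} p∈ q∈ → row′ p (sameRow refl A≤1 p∈ q∈))
      where
      row : ∀ p {q} → proj₁ p ≡ proj₁ q → SameD p q → p ≡ q
      row (x , y) refl e = cong (x ,_) (sym (ℕ.+-cancelˡ-≡ x _ _ e))
      row′ : ∀ p {q} → proj₁ p ≡ proj₁ q → SameE p q → p ≡ q
      row′ (x , y) refl e = cong (x ,_) (ℕ.+-cancelˡ-≡ x _ _ e)

    thin-cols : length B ≤ 1 → size ≤ c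
    thin-cols B≤1 = thin
      (λ {p} p∈ q∈ → col p (sameCol refl B≤1 p∈ q∈))
      (λ {p} p∈ q∈ → col′ p (sameCol refl B≤1 p∈ q∈))
      where
      col : ∀ p {q} → proj₂ p ≡ proj₂ q → SameD p q → p ≡ q
      col (x , y) refl e = cong (_, y) (ℕ.+-cancelʳ-≡ y _ _ e)
      col′ : ∀ p {q} → proj₂ p ≡ proj₂ q → SameE p q → p ≡ q
      col′ (x , y) refl e = cong (_, y) (ℕ.+-cancelʳ-≡ y _ _ e)

  peel-step : (S : Placement) → Covered (Placement.Q S) →
    Placement.size S ≤ c ⊎ (2 ≤ length (Placement.A S) × 2 ≤ length (Placement.B S))
  peel-step S cov with 2 ≤? length (Placement.A S) | 2 ≤? length (Placement.B S)
  ... | yes p | yes q = inj₂ (p , q)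
  ... | no p | _ = inj₁ (Thin.thin-rows S cov (ℕ.≤-pred (ℕ.≰⇒> p)))
  ... | yes _ | no q = inj₁ (Thin.thin-cols S cov (ℕ.≤-pred (ℕ.≰⇒> q)))

  -- Each of j layers costs at most 2c queens and exactly four lines, and the rest obeys 4ab ≤ (a +
  -- b)². If the placement is too thin to peel, its at most c queens already fit into the allowance
  -- of the next layer. The remainder p is left open because the bound is best when p is near c.
  bound : ∀ j p (S : Placement) → Covered (Placement.Q S) → Placement.lines S ≡ p + 4 * j →
    4 * Placement.size S ≤ 8 * (c * j) + p * p
  bound zero p S cov eq rewrite ℕ.*-zeroʳ c | ℕ.+-identityʳ p =
    subst (λ l → 4 * Placement.size S ≤ l * l) eq (Placement.4size≤ S)
  bound (suc j) p S cov eq rewrite ℕ.*-suc c j with peel-step S cov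
  ... | inj₁ s≤c = linarith 4 (λ s c cj p → s ≼ c ⇒ ⊢ 4 ⊙ s ≼ 8 ⊙ (c ⊕ cj) ⊕ p)
    (Placement.size S) c (c * j) (p * p) s≤c
  ... | inj₂ (2≤A , 2≤B) = linarith 5 (λ s s′ c cj p → s ≼ 2 ⊙ c ⊕ s′ ⇒ 4 ⊙ s′ ≼ 8 ⊙ cj ⊕ p ⇒
      ⊢ 4 ⊙ s ≼ 8 ⊙ (c ⊕ cj) ⊕ p) (Placement.size S) (Placement.size peeled) c (c * j) (p * p) size-peeled
      (bound j p peeled peeled-covered
        (linarith 4 (λ l l′ p j → l ≐ nat 4 ⊕ l′ ⇒ l ≐ p ⊕ 4 ⊙ (nat 1 ⊕ j) ⇒ ⊢ l′ ≐ p ⊕ 4 ⊙ j)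
          (Placement.lines S) (Placement.lines peeled) p j lines-peeled eq))
    where
    open Peeling (peel S cov 2≤A 2≤B)

-- The extremal configurations

-- On the row t the two families of diagonals stay more than α apart. A column served by the same family on the
-- rows t and b would force its translate by α to be another such column, and so on, past the end of the row.
module Opposite (δ ε t b α l r : ℕ) (B : List ℕ) (0<α : 0 < α) (α≤t : α ≤ t) (t+δ<r : t + δ < r) (t+l<δ : t + l < δ)
  (top : ∀ {y} → y ∈ B → t + y < δ ⊎ t + δ < y)
  (≤r : ∀ {y} → y ∈ B → y ≤ r)
  (pushD : ∀ {y} → y ∈ B → δ + 2 * ε < b + y → y ≢ r → y + α ∈ B)
  (pushE : ∀ {y} → y ∈ B → y + δ < b → y ≢ l → ∃ λ y′ → y′ ∈ B × y ≡ y′ + α) where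

  ascend : ∀ n {y} → r ≤ y + n → y ∈ B → t + y < δ → δ + 2 * ε < b + y → ⊥
  ascend zero {y} r≤ y∈ p q =
    linarith 4 (λ r y t δ → r ≼ y ⊕ nat 0 ⇒ t ⊕ y ≺ δ ⇒ t ⊕ δ ≺ r ⇒ ⊢⊥) r y t δ r≤ p t+δ<r
  ascend (suc n) {y} r≤ y∈ p q with pushD y∈ q (λ { refl → linarith 3 (λ y t δ → t ⊕ y ≺ δ ⇒ t ⊕ δ ≺ y ⇒ ⊢⊥) y t δ p t+δ<r })
  ... | y′∈ with top y′∈
  ... | inj₁ p′ = ascend n
    (linarith 4 (λ r y n α → r ≼ y ⊕ (nat 1 ⊕ n) ⇒ nat 0 ≺ α ⇒ ⊢ r ≼ (y ⊕ α) ⊕ n) r y n α r≤ 0<α) y′∈ p′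
    (linarith 5 (λ δ ε b y α → δ ⊕ 2 ⊙ ε ≺ b ⊕ y ⇒ ⊢ δ ⊕ 2 ⊙ ε ≺ b ⊕ (y ⊕ α)) δ ε b y α q)
  -- On row t the two families are separated by a gap of width 2t, and a step of α ≤ t cannot jump
  -- across it.
  ... | inj₂ p′ = linarith 4 (λ t δ y α → t ⊕ y ≺ δ ⇒ t ⊕ δ ≺ y ⊕ α ⇒ α ≼ t ⇒ ⊢⊥) t δ y α p p′ α≤t

  descend : ∀ n {y} → y ≤ n → y ∈ B → t + δ < y → y + δ < b → ⊥
  descend zero {y} y≤ y∈ p q = linarith 3 (λ t δ y → y ≼ nat 0 ⇒ t ⊕ δ ≺ y ⇒ ⊢⊥) t δ y y≤ p
  descend (suc n) {y} y≤ y∈ p q with pushE y∈ q (λ { refl → linarith 3 (λ y t δ → t ⊕ δ ≺ y ⇒ t ⊕ y ≺ δ ⇒ ⊢⊥) y t δ p t+l<δ })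
  ... | y′ , y′∈ , refl with top y′∈
  ... | inj₂ p′ = descend n
    (linarith 3 (λ y α n → y ⊕ α ≼ nat 1 ⊕ n ⇒ nat 0 ≺ α ⇒ ⊢ y ≼ n) y′ α n y≤ 0<α) y′∈ p′
    (linarith 4 (λ y α δ b → (y ⊕ α) ⊕ δ ≺ b ⇒ ⊢ y ⊕ δ ≺ b) y′ α δ b q)
  ... | inj₁ p′ = linarith 4 (λ t δ y α → t ⊕ y ≺ δ ⇒ t ⊕ δ ≺ y ⊕ α ⇒ α ≼ t ⇒ ⊢⊥) t δ y′ α p′ p α≤t

#-image : ∀ {A B : Set} {P : A → Set} {R : B → Set} (P? : Decidable P) (R? : Decidable R) {xs : List A} {ys : List B} (f : A → B) →
  Unique xs → (∀ {x x′} → f x ≡ f x′ → x ≡ x′) → (∀ {x} → x ∈ xs → P x → f x ∈ ys × R (f x)) → # P? xs ≤ # R? ys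
#-image P? R? f u inj h = pigeonhole (λ x y → f x ≡ y) (Unique.filter⁺ P? u)
  (λ x∈ → let x∈ , p = ∈-filter⁻ P? x∈ ; y∈ , r = h x∈ p in ∈-filter⁺ R? y∈ r)
  λ { _ _ refl e → inj (sym e) }

module Cross {A B : List ℕ} {Q : List Point} (A-unique : Unique A) (B-unique : Unique B) (Q-unique : Unique Q)
  (on : ∀ {p} → p ∈ Q → proj₁ p ∈ A × proj₂ p ∈ B) (full : ∀ {x y} → x ∈ A → y ∈ B → (x , y) ∈ Q)
  {x y : ℕ} (x∈ : x ∈ A) (y∈ : y ∈ B) {P : Point → Set} (P? : Decidable P) (Pxy : P (x , y)) where

  row? : Decidable (λ p → P p × proj₁ p ≡ x)
  row? p = P? p ×-dec proj₁ p ≟ x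
  col? : Decidable (λ p → P p × proj₂ p ≡ y)
  col? p = P? p ×-dec proj₂ p ≟ y
  cross? : Decidable (λ p → P p × (proj₁ p ≡ x ⊎ proj₂ p ≡ y))
  cross? p = P? p ×-dec (proj₁ p ≟ x ⊎-dec proj₂ p ≟ y)
  corner? : Decidable (λ p → p ≡ (x , y))
  corner? p = p ≟ᴾ (x , y)

  #-row : # row? Q ≡ # (λ v → P? (x , v)) B
  #-row = ℕ.≤-antisym
    (pigeonhole (λ p v → proj₂ p ≡ v) (Unique.filter⁺ row? Q-unique)
      (λ {p} p∈ → let p∈ , q , e = ∈-filter⁻ row? p∈ in
        ∈-filter⁺ (λ v → P? (x , v)) (proj₂ (on p∈)) (subst (λ u → P (u , proj₂ p)) e q))
      λ p∈ q∈ e f → cong₂ _,_ (trans (proj₂ (proj₂ (∈-filter⁻ row? {xs = Q} p∈))) (sym (proj₂ (proj₂ (∈-filter⁻ row? {xs = Q} q∈))))) (trans e (sym f)))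
    (#-image (λ v → P? (x , v)) row? (x ,_) B-unique (cong proj₂) λ v∈ p → full x∈ v∈ , p , refl)

  #-col : # col? Q ≡ # (λ u → P? (u , y)) A
  #-col = ℕ.≤-antisym
    (pigeonhole (λ p v → proj₁ p ≡ v) (Unique.filter⁺ col? Q-unique)
      (λ {p} p∈ → let p∈ , q , e = ∈-filter⁻ col? p∈ in
        ∈-filter⁺ (λ u → P? (u , y)) (proj₁ (on p∈)) (subst (λ v → P (proj₁ p , v)) e q))
      λ p∈ q∈ e f → cong₂ _,_ (trans e (sym f)) (trans (proj₂ (proj₂ (∈-filter⁻ col? {xs = Q} p∈))) (sym (proj₂ (proj₂ (∈-filter⁻ col? {xs = Q} q∈))))))
    (#-image (λ u → P? (u , y)) col? (_, y) A-unique (cong proj₁) λ v∈ p → full v∈ y∈ , p , refl)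

  #-corner : # corner? Q ≡ 1
  #-corner = ℕ.≤-antisym
    (unique-⊆ {ys = (x , y) ∷ []} (Unique.filter⁺ corner? Q-unique) λ p∈ → here (proj₂ (∈-filter⁻ corner? {xs = Q} p∈)))
    (unique-⊆ ([] ∷ []) λ { (here refl) → ∈-filter⁺ corner? (full x∈ y∈) refl })

  pointwise : ∀ p → 𝟙 (cross? p) + 𝟙 (corner? p) ≡ 𝟙 (row? p) + 𝟙 (col? p)
  pointwise p@(u , v) with P? p | u ≟ x | v ≟ y | p ≟ᴾ (x , y)
  ... | _ | yes _ | no v≢ | yes refl = contradiction refl v≢
  ... | _ | no u≢ | _ | yes refl = contradiction refl u≢
  ... | _ | yes refl | yes refl | no p≢ = contradiction refl p≢
  ... | no ¬P | yes refl | yes refl | yes _ = contradiction Pxy ¬P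
  ... | yes _ | yes _ | yes _ | yes _ = refl
  ... | yes _ | yes _ | no _ | no _ = refl
  ... | yes _ | no _ | yes _ | no _ = refl
  ... | yes _ | no _ | no _ | no _ = refl
  ... | no _ | yes _ | no _ | no _ = refl
  ... | no _ | no _ | yes _ | no _ = refl
  ... | no _ | no _ | no _ | no _ = refl

  -- The common point is counted in the row and in the column, hence the 1. Applied at the four
  -- corners of a full grid, this turns counts of boundary queens into counts along single sides.
  #-cross : # cross? Q + 1 ≡ # (λ v → P? (x , v)) B + # (λ u → P? (u , y)) A
  #-cross = begin
    # cross? Q + 1 ≡⟨ cong (# cross? Q +_) (sym #-corner) ⟩
    # cross? Q + # corner? Q ≡⟨ cong₂ _+_ (#-∑ cross? Q) (#-∑ corner? Q) ⟩
    ∑ Q (𝟙 ∘ cross?) + ∑ Q (𝟙 ∘ corner?) ≡⟨ sym (∑-+ Q (𝟙 ∘ cross?) (𝟙 ∘ corner?)) ⟩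
    ∑ Q (λ p → 𝟙 (cross? p) + 𝟙 (corner? p)) ≡⟨ ∑-cong Q (λ {p} _ → pointwise p) ⟩
    ∑ Q (λ p → 𝟙 (row? p) + 𝟙 (col? p)) ≡⟨ ∑-+ Q (𝟙 ∘ row?) (𝟙 ∘ col?) ⟩
    ∑ Q (𝟙 ∘ row?) + ∑ Q (𝟙 ∘ col?) ≡⟨ cong₂ _+_ (sym (#-∑ row? Q)) (sym (#-∑ col? Q)) ⟩
    # row? Q + # col? Q ≡⟨ cong₂ _+_ #-row #-col ⟩
    # (λ v → P? (x , v)) B + # (λ u → P? (u , y)) A ∎
    where open ≡-Reasoning

-- (a + b)² exceeds 4ab by (a - b)², which is at least 4 as soon as the sides differ by 2.
near-square : ∀ a b s → s ≤ a * b → (a + b) * (a + b) < 4 * s + 4 → a ≤ suc b × b ≤ suc a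
near-square a b s s≤ lt = half a b s≤ lt , half b a (subst (s ≤_) (ℕ.*-comm a b) s≤) (subst (λ l → l * l < 4 * s + 4) (ℕ.+-comm a b) lt)
  where
  lemma : ∀ b d → ((2 + b + d) + b) * ((2 + b + d) + b) ≡ 4 * ((2 + b + d) * b) + 4 + (d * d + 4 * d)
  lemma = ℕ-solve-∀
  half : ∀ a b → s ≤ a * b → (a + b) * (a + b) < 4 * s + 4 → a ≤ suc b
  half a b s≤ lt = ℕ.≮⇒≥ λ 2+b≤a → far (ℕ.m≤n⇒∃[o]m+o≡n 2+b≤a)
    where
    far : (∃ λ d → 2 + b + d ≡ a) → ⊥
    far (d , refl) = linarith 4 (λ s ab dd q → s ≼ ab ⇒ q ≺ 4 ⊙ s ⊕ nat 4 ⇒ q ≐ 4 ⊙ ab ⊕ nat 4 ⊕ dd ⇒ ⊢⊥)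
      s ((2 + b + d) * b) (d * d + 4 * d) (((2 + b + d) + b) * ((2 + b + d) + b)) s≤ lt (lemma b d)

module Extremal (Dg Eg : Point → Set) (Dg? : Decidable Dg) (Eg? : Decidable Eg) (LD LE : List Point) where
  open Diagonals Dg Eg Dg? Eg? LD LE

  record Frame (S : Placement) : Set where
    open Placement S
    field
      X : Extremes A
      Y : Extremes B
      full : ∀ {x y} → x ∈ A → y ∈ B → (x , y) ∈ Q
      near : length A ≤ suc (length B) × length B ≤ suc (length A)
      tight : Tight (enclose X Y) Q

  -- Being within rounding of 4ab ≤ (a + b)² forces size ab, so the grid is full. Its boundary has
  -- 2(a + b) - 4 = 2c points, precisely the perimeter bound; this is what makes c + 2 rows and
  -- columns the critical number.
  frame : (S : Placement) → Covered (Placement.Q S) → 2 ≤ c → Placement.lines S ≡ c + 2 →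
    (c + 2) * (c + 2) < 4 * Placement.size S + 4 → Frame S
  frame S cov 2≤c lines≡ big = record
    { X = P.X ; Y = P.Y ; full = full ; near = near ; tight = P.perimeter-tight boundary-full }
    where
    open Placement S
    a = length A
    b = length B

    big′ : (a + b) * (a + b) < 4 * size + 4
    big′ = subst (λ l → l * l < 4 * size + 4) (sym lines≡) big

    near : a ≤ suc b × b ≤ suc a
    near = near-square a b size size≤ big′

    2≤a : 2 ≤ a
    2≤a = linarith 3 (λ a b c → a ⊕ b ≐ c ⊕ nat 2 ⇒ nat 2 ≼ c ⇒ a ≼ nat 1 ⊕ b ⇒ b ≼ nat 1 ⊕ a ⇒ ⊢ nat 2 ≼ a) a b c lines≡ 2≤c (proj₁ near) (proj₂ near)
    2≤b : 2 ≤ b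
    2≤b = linarith 3 (λ a b c → a ⊕ b ≐ c ⊕ nat 2 ⇒ nat 2 ≼ c ⇒ a ≼ nat 1 ⊕ b ⇒ b ≼ nat 1 ⊕ a ⇒ ⊢ nat 2 ≼ b) a b c lines≡ 2≤c (proj₁ near) (proj₂ near)

    filled : a * b ≤ size
    filled = linarith 3 (λ ab q s → 4 ⊙ ab ≼ q ⇒ q ≺ 4 ⊙ s ⊕ nat 4 ⇒ ⊢ ab ≼ s) (a * b) ((a + b) * (a + b)) size (4ab≤ a b) big′

    full : ∀ {x y} → x ∈ A → y ∈ B → (x , y) ∈ Q
    full x∈ y∈ = unique-⊇ _≟ᴾ_ Q-unique ⊆grid (subst (_≤ size) (sym (length-× A B)) filled) (∈-cartesianProduct⁺ x∈ y∈)

    module P = Peeling (peel S cov 2≤a 2≤b)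

    boundary-full : 2 * c ≤ # (Box.boundary? P.box) Q
    boundary-full = linarith 7 (λ c p s s′ a b ab → p ⊕ s′ ≐ s ⇒ s′ ≼ ab ⇒ ab ⊕ 2 ⊙ a ⊕ 2 ⊙ b ⊕ nat 4 ≼ s ⇒
        (nat 2 ⊕ a) ⊕ (nat 2 ⊕ b) ≐ c ⊕ nat 2 ⇒ ⊢ 2 ⊙ c ≼ p)
      c (# (Box.boundary? P.box) Q) size (Placement.size P.peeled) a′ b′ (a′ * b′) P.size-split
      (Placement.size≤ P.peeled)
      (subst (_≤ size) (trans (cong₂ _*_ (Extremes.size P.X) (Extremes.size P.Y)) (lemma a′ b′)) filled)
      (trans (sym (cong₂ _+_ (Extremes.size P.X) (Extremes.size P.Y))) lines≡)
      where
      a′ = length (Extremes.inner P.X)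
      b′ = length (Extremes.inner P.Y)
      lemma : ∀ a b → (2 + a) * (2 + b) ≡ a * b + 2 * a + 2 * b + 4
      lemma = ℕ-solve-∀

classify : ∀ {A} (X : Extremes A) {a} → a ∈ A → a ≡ Extremes.lo X ⊎ a ≡ Extremes.hi X ⊎ a ∈ Extremes.inner X
classify X {a} a∈ with a ≟ Extremes.lo X | a ≟ Extremes.hi X
... | yes p | _ = inj₁ p
... | no _ | yes q = inj₂ (inj₁ q)
... | no p | no q = inj₂ (inj₂ (Extremes.inner⁺ X a∈ p q))

-- Two tight layers when the families are strips around the main diagonals

module Strips (δ ε : ℕ) (LD LE : List Point) where

  -- On a board of side N + 1 with δ + ε = N these say |x - y| ≤ δ and |x + y - N| ≤ ε: the diagonal
  -- of the point has length at least N + 1 - δ, its antidiagonal length at least δ + 1.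
  Dg Eg : Point → Set
  Dg (x , y) = x ≤ y + δ × y ≤ x + δ
  Eg (x , y) = δ ≤ x + y × x + y ≤ δ + 2 * ε

  Dg? : Decidable Dg
  Dg? (x , y) = x ≤? y + δ ×-dec y ≤? x + δ
  Eg? : Decidable Eg
  Eg? (x , y) = δ ≤? x + y ×-dec x + y ≤? δ + 2 * ε

  open Diagonals Dg Eg Dg? Eg? LD LE public
  open Extremal Dg Eg Dg? Eg? LD LE public

  module Sides (S : Placement) (cov : Covered (Placement.Q S)) (F : Frame S) where
    open Placement S using (A; B; Q)
    open Frame F using (full; near)
    open Tight (Frame.tight F)
    open Covered cov
    module X = Extremes (Frame.X F)
    module Y = Extremes (Frame.Y F)

    t = X.lo
    bt = X.hi
    l = Y.lo
    r = Y.hi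

    -- At this corner an antidiagonal would have both of its ends in one queen, which tightness
    -- forbids. So the four corners alternate between the families.
    tl-D : Dg (t , l)
    tl-D with good (full X.lo∈ Y.lo∈)
    ... | inj₁ d = d
    ... | inj₂ e = contradiction (inj₂ refl) (E-corner (full X.lo∈ Y.lo∈) e (inj₁ refl))
    br-D : Dg (bt , r)
    br-D with good (full X.hi∈ Y.hi∈)
    ... | inj₁ d = d
    ... | inj₂ e = contradiction (inj₁ refl) (E-corner (full X.hi∈ Y.hi∈) e (inj₂ refl))
    tr-E : Eg (t , r)
    tr-E with good (full X.lo∈ Y.hi∈)
    ... | inj₂ e = e
    ... | inj₁ d = contradiction (inj₂ refl) (D-corner (full X.lo∈ Y.hi∈) d (inj₁ refl))
    bl-E : Eg (bt , l)
    bl-E with good (full X.hi∈ Y.lo∈)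
    ... | inj₂ e = e
    ... | inj₁ d = contradiction (inj₁ refl) (D-corner (full X.hi∈ Y.lo∈) d (inj₂ refl))

    module _ {y} (y∈ : y ∈ B) where
      top-single : Dg (t , y) → ¬ Eg (t , y)
      top-single = single (full X.lo∈ y∈) (inj₁ (inj₁ refl))
      bottom-single : Dg (bt , y) → ¬ Eg (bt , y)
      bottom-single = single (full X.hi∈ y∈) (inj₂ (inj₁ refl))
      l≤ = proj₁ (Y.bounds y∈)
      ≤r = proj₂ (Y.bounds y∈)

      -- The corner (t , r) bounds t + y from above by δ + 2ε. If t + y were at least δ as well, the
      -- point would lie in both strips, against `single`. Although the strips overlap in general,
      -- they are thus disjoint along each side of the frame.
      topD : Dg (t , y) → t + y < δ
      topD d = ℕ.≰⇒> λ δ≤ → top-single d (δ≤ , ℕ.≤-trans (ℕ.+-monoʳ-≤ t ≤r) (proj₂ tr-E))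
      topE : Eg (t , y) → t + δ < y
      topE e = ℕ.≰⇒> λ y≤ → top-single (ℕ.≤-trans (proj₁ tl-D) (ℕ.+-monoˡ-≤ δ l≤) , y≤) e
      bottomD : Dg (bt , y) → δ + 2 * ε < bt + y
      bottomD d = ℕ.≰⇒> λ ≤δ → bottom-single d (ℕ.≤-trans (proj₁ bl-E) (ℕ.+-monoʳ-≤ bt l≤) , ≤δ)
      bottomE : Eg (bt , y) → y + δ < bt
      bottomE e = ℕ.≰⇒> λ ≤y → bottom-single (≤y , ℕ.≤-trans ≤r (proj₂ br-D)) e

      top : t + y < δ ⊎ t + δ < y
      top with good (full X.lo∈ y∈)
      ... | inj₁ d = inj₁ (topD d)
      ... | inj₂ e = inj₂ (topE e)

      bottomD⁻ : δ + 2 * ε < bt + y → Dg (bt , y)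
      bottomD⁻ lt with good (full X.hi∈ y∈)
      ... | inj₁ d = d
      ... | inj₂ e = contradiction (proj₂ e) (ℕ.<⇒≱ lt)
      bottomE⁻ : y + δ < bt → Eg (bt , y)
      bottomE⁻ lt with good (full X.hi∈ y∈)
      ... | inj₂ e = e
      ... | inj₁ d = contradiction (proj₁ d) (ℕ.<⇒≱ lt)

    module _ {x} (x∈ : x ∈ A) where
      left-single : Dg (x , l) → ¬ Eg (x , l)
      left-single = single (full x∈ Y.lo∈) (inj₁ (inj₂ refl))
      right-single : Dg (x , r) → ¬ Eg (x , r)
      right-single = single (full x∈ Y.hi∈) (inj₂ (inj₂ refl))
      t≤ = proj₁ (X.bounds x∈)
      ≤bt = proj₂ (X.bounds x∈)

      leftD : Dg (x , l) → l + x < δ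
      leftD d = ℕ.≰⇒> λ δ≤ → left-single d (subst (δ ≤_) (ℕ.+-comm l x) δ≤ , ℕ.≤-trans (ℕ.+-monoˡ-≤ l ≤bt) (proj₂ bl-E))
      leftE : Eg (x , l) → l + δ < x
      leftE e = ℕ.≰⇒> λ x≤ → left-single (x≤ , ℕ.≤-trans (proj₂ tl-D) (ℕ.+-monoˡ-≤ δ t≤)) e
      rightD : Dg (x , r) → δ + 2 * ε < r + x
      rightD d = ℕ.≰⇒> λ ≤δ → right-single d (ℕ.≤-trans (proj₁ tr-E) (ℕ.+-monoˡ-≤ r t≤) , subst (_≤ δ + 2 * ε) (ℕ.+-comm r x) ≤δ)
      rightE : Eg (x , r) → x + δ < r
      rightE e = ℕ.≰⇒> λ ≤x → right-single (ℕ.≤-trans ≤bt (proj₁ br-D) , ≤x) e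

      left : l + x < δ ⊎ l + δ < x
      left with good (full x∈ Y.lo∈)
      ... | inj₁ d = inj₁ (leftD d)
      ... | inj₂ e = inj₂ (leftE e)

      rightD⁻ : δ + 2 * ε < r + x → Dg (x , r)
      rightD⁻ lt with good (full x∈ Y.hi∈)
      ... | inj₁ d = d
      ... | inj₂ e = contradiction (subst (_≤ δ + 2 * ε) (ℕ.+-comm x r) (proj₂ e)) (ℕ.<⇒≱ lt)
      rightE⁻ : x + δ < r → Eg (x , r)
      rightE⁻ lt with good (full x∈ Y.hi∈)
      ... | inj₂ e = e
      ... | inj₁ d = contradiction (proj₂ d) (ℕ.<⇒≱ lt)

    -- Every line enters and leaves the frame once; if opposite sides are served by opposite families, this makes
    -- both side lengths even.
    module Balance (lines≡ : Placement.lines S ≡ c + 2)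
      (⇒bE : ∀ {y} → y ∈ B → Dg (t , y) → Eg (bt , y)) (⇒bD : ∀ {y} → y ∈ B → Eg (t , y) → Dg (bt , y))
      (⇒rE : ∀ {x} → x ∈ A → Dg (x , l) → Eg (x , r)) (⇒rD : ∀ {x} → x ∈ A → Eg (x , l) → Dg (x , r)) where
      open Placement S using (A-unique; B-unique; Q-unique; on)

      tD tE bD bE lD lE rD rE : ℕ
      tD = # (λ y → Dg? (t , y)) B
      tE = # (λ y → Eg? (t , y)) B
      bD = # (λ y → Dg? (bt , y)) B
      bE = # (λ y → Eg? (bt , y)) B
      lD = # (λ x → Dg? (x , l)) A
      lE = # (λ x → Eg? (x , l)) A
      rD = # (λ x → Dg? (x , r)) A
      rE = # (λ x → Eg? (x , r)) A

      other : ∀ {P Q : Set} → P ⊎ Q → ¬ P → Q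
      other (inj₁ p) ¬p = contradiction p ¬p
      other (inj₂ q) _ = q
      other′ : ∀ {P Q : Set} → P ⊎ Q → ¬ Q → P
      other′ (inj₁ p) _ = p
      other′ (inj₂ q) ¬q = contradiction q ¬q

      b≡ : tD + tE ≡ length B
      b≡ = #-complement (λ y → Dg? (t , y)) (λ y → Eg? (t , y)) B top-single (λ y∈ → other (good (full X.lo∈ y∈)))
      a≡ : lD + lE ≡ length A
      a≡ = #-complement (λ x → Dg? (x , l)) (λ x → Eg? (x , l)) A left-single (λ x∈ → other (good (full x∈ Y.lo∈)))
      bE≡ : tD ≡ bE
      bE≡ = #-cong (λ y → Dg? (t , y)) (λ y → Eg? (bt , y)) B ⇒bE
        (λ y∈ e → other′ (good (full X.lo∈ y∈)) λ e′ → bottom-single y∈ (⇒bD y∈ e′) e)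
      bD≡ : tE ≡ bD
      bD≡ = #-cong (λ y → Eg? (t , y)) (λ y → Dg? (bt , y)) B ⇒bD
        (λ y∈ d → other (good (full X.lo∈ y∈)) λ d′ → bottom-single y∈ d (⇒bE y∈ d′))
      rE≡ : lD ≡ rE
      rE≡ = #-cong (λ x → Dg? (x , l)) (λ x → Eg? (x , r)) A ⇒rE
        (λ x∈ e → other′ (good (full x∈ Y.lo∈)) λ e′ → right-single x∈ (⇒rD x∈ e′) e)
      rD≡ : lE ≡ rD
      rD≡ = #-cong (λ x → Eg? (x , l)) (λ x → Dg? (x , r)) A ⇒rD
        (λ x∈ d → other (good (full x∈ Y.lo∈)) λ d′ → right-single x∈ d (⇒rE x∈ d′))

      cross : ∀ {x y} (x∈ : x ∈ A) (y∈ : y ∈ B) {P : Point → Set} (P? : Decidable P) → P (x , y) → _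
      cross x∈ y∈ P? p = Cross.#-cross A-unique B-unique Q-unique on full x∈ y∈ P? p

      -- The corner (t , l) is counted twice on the one end and (bt , r) twice on the other, so the
      -- two corrections by 1 cancel.
      D-sides : tD + lD ≡ tE + lE
      D-sides = trans (sym (cross X.lo∈ Y.lo∈ Dg? tl-D)) (trans (cong (_+ 1) D-balance) (trans (cross X.hi∈ Y.hi∈ Dg? br-D) (sym (cong₂ _+_ bD≡ rD≡))))
      E-sides : tE + lD ≡ tD + lE
      E-sides = trans (cong (tE +_) rE≡) (trans (sym (cross X.lo∈ Y.hi∈ Eg? tr-E)) (trans (cong (_+ 1) E-balance)
        (trans (cross X.hi∈ Y.lo∈ Eg? bl-E) (cong (_+ lE) (sym bE≡)))))

      tD≡tE : tD ≡ tE
      tD≡tE = linarith 4 (λ tD tE lD lE → tD ⊕ lD ≐ tE ⊕ lE ⇒ tE ⊕ lD ≐ tD ⊕ lE ⇒ ⊢ tD ≐ tE) tD tE lD lE D-sides E-sides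
      lD≡lE : lD ≡ lE
      lD≡lE = linarith 4 (λ tD tE lD lE → tD ⊕ lD ≐ tE ⊕ lE ⇒ tE ⊕ lD ≐ tD ⊕ lE ⇒ ⊢ lD ≐ lE) tD tE lD lE D-sides E-sides
      b≡2 : length B ≡ tD + tD
      b≡2 = trans (sym b≡) (cong (tD +_) (sym tD≡tE))
      a≡2 : length A ≡ lD + lD
      a≡2 = trans (sym a≡) (cong (lD +_) (sym lD≡lE))

      lD≡tD : lD ≡ tD
      lD≡tD = linarith 2 (λ lD tD → lD ⊕ lD ≼ nat 1 ⊕ (tD ⊕ tD) ⇒ tD ⊕ tD ≼ nat 1 ⊕ (lD ⊕ lD) ⇒ ⊢ lD ≐ tD) lD tD
        (subst₂ (λ u v → u ≤ suc v) a≡2 b≡2 (proj₁ near)) (subst₂ (λ u v → u ≤ suc v) b≡2 a≡2 (proj₂ near))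

      c≡ : ∃ λ h → c + 2 ≡ 4 * h
      c≡ = tD , trans (sym lines≡) (trans (cong₂ _+_ (trans a≡2 (cong₂ _+_ lD≡tD lD≡tD)) b≡2) (lemma tD))
        where
        lemma : ∀ h → (h + h) + (h + h) ≡ 4 * h
        lemma = ℕ-solve-∀

  module Gaps (S : Placement) (cov : Covered (Placement.Q S)) (P : Peeling S)
    (tight : Tight (Peeling.box P) (Placement.Q S)) (F : Frame (Peeling.peeled P)) where
    open Placement S using (Q; on)
    open Peeling P using (peeled; peeled-covered; Q-peeled; A-peeled; B-peeled; inside)
    open Placement peeled using () renaming (A to Aᴵ; B to Bᴵ; Q to Qᴵ)
    open Sides peeled peeled-covered F
    open Frame F using (full)
    module O = Tight tight
    module U = Extremes (Peeling.X P)
    module V = Extremes (Peeling.Y P)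
    open Box (Peeling.box P) using (TopLeft; BottomRight; TopRight; BottomLeft)

    t₀ = U.lo
    b₀ = U.hi
    l₀ = V.lo
    r₀ = V.hi

    row : ∀ {u v} → (u , v) ∈ Q → u ≡ t₀ ⊎ u ≡ b₀ ⊎ u ∈ Aᴵ
    row p∈ with classify (Peeling.X P) (proj₁ (on p∈))
    ... | inj₁ e = inj₁ e
    ... | inj₂ (inj₁ e) = inj₂ (inj₁ e)
    ... | inj₂ (inj₂ u∈) = inj₂ (inj₂ (subst (_ ∈_) (sym A-peeled) u∈))
    col : ∀ {u v} → (u , v) ∈ Q → v ≡ l₀ ⊎ v ≡ r₀ ⊎ v ∈ Bᴵ
    col p∈ with classify (Peeling.Y P) (proj₂ (on p∈))
    ... | inj₁ e = inj₁ e
    ... | inj₂ (inj₁ e) = inj₂ (inj₁ e)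
    ... | inj₂ (inj₂ v∈) = inj₂ (inj₂ (subst (_ ∈_) (sym B-peeled) v∈))

    between-rows : ∀ {u} → u ∈ Aᴵ → t₀ < u × u < b₀
    between-rows u∈ = proj₂ (U.inner⁻ (subst (_ ∈_) A-peeled u∈))
    between-cols : ∀ {v} → v ∈ Bᴵ → l₀ < v × v < r₀
    between-cols v∈ = proj₂ (V.inner⁻ (subst (_ ∈_) B-peeled v∈))

    -- Tightness of the outer layer concerns all listed lines, hence also those serving inner
    -- queens: such a line reaches the outer layer at a queen.
    D-first : ∀ {p} → p ∈ Qᴵ → Dg p → ∃ λ q → q ∈ Q × TopLeft q × SameD q p
    D-first {p} p∈ d with find (Covered.onD cov (Q-peeled p∈) d)
    ... | r , r∈ , s with O.D-topLeft r∈
    ... | q , q∈ , _ , tl , s′ = q , q∈ , tl , sameD-trans q p r s′ s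
    D-last : ∀ {p} → p ∈ Qᴵ → Dg p → ∃ λ q → q ∈ Q × BottomRight q × SameD q p
    D-last {p} p∈ d with find (Covered.onD cov (Q-peeled p∈) d)
    ... | r , r∈ , s with O.D-bottomRight r∈
    ... | q , q∈ , _ , tl , s′ = q , q∈ , tl , sameD-trans q p r s′ s
    E-first : ∀ {p} → p ∈ Qᴵ → Eg p → ∃ λ q → q ∈ Q × TopRight q × SameE q p
    E-first {p} p∈ d with find (Covered.onE cov (Q-peeled p∈) d)
    ... | r , r∈ , s with O.E-topRight r∈
    ... | q , q∈ , _ , tl , s′ = q , q∈ , tl , sameE-trans q p r s′ s
    E-last : ∀ {p} → p ∈ Qᴵ → Eg p → ∃ λ q → q ∈ Q × BottomLeft q × SameE q p
    E-last {p} p∈ d with find (Covered.onE cov (Q-peeled p∈) d)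
    ... | r , r∈ , s with O.E-bottomLeft r∈
    ... | q , q∈ , _ , tl , s′ = q , q∈ , tl , sameE-trans q p r s′ s

    t₀<t = proj₁ (between-rows X.lo∈)
    bt<b₀ = proj₂ (between-rows X.hi∈)
    l₀<l = proj₁ (between-cols Y.lo∈)
    r<r₀ = proj₂ (between-cols Y.hi∈)

    col-left : ∀ {u v} → (u , v) ∈ Q → v < l → v ≡ l₀
    col-left q∈ v<l with col q∈
    ... | inj₁ e = e
    ... | inj₂ (inj₁ refl) = contradiction (ℕ.<-trans v<l (proj₂ (between-cols Y.lo∈))) (ℕ.n≮n _)
    ... | inj₂ (inj₂ v∈) = contradiction (proj₁ (Y.bounds v∈)) (ℕ.<⇒≱ v<l)
    col-right : ∀ {u v} → (u , v) ∈ Q → r < v → v ≡ r₀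
    col-right q∈ r<v with col q∈
    ... | inj₂ (inj₁ e) = e
    ... | inj₁ refl = contradiction (ℕ.<-trans (proj₁ (between-cols Y.hi∈)) r<v) (ℕ.n≮n _)
    ... | inj₂ (inj₂ v∈) = contradiction (proj₂ (Y.bounds v∈)) (ℕ.<⇒≱ r<v)
    row-top : ∀ {u v} → (u , v) ∈ Q → u < t → u ≡ t₀
    row-top q∈ u<t with row q∈
    ... | inj₁ e = e
    ... | inj₂ (inj₁ refl) = contradiction (ℕ.<-trans u<t (proj₂ (between-rows X.lo∈))) (ℕ.n≮n _)
    ... | inj₂ (inj₂ u∈) = contradiction (proj₁ (X.bounds u∈)) (ℕ.<⇒≱ u<t)
    row-bottom : ∀ {u v} → (u , v) ∈ Q → bt < u → u ≡ b₀
    row-bottom q∈ b<u with row q∈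
    ... | inj₂ (inj₁ e) = e
    ... | inj₁ refl = contradiction (ℕ.<-trans (proj₁ (between-rows X.hi∈)) b<u) (ℕ.n≮n _)
    ... | inj₂ (inj₂ u∈) = contradiction (proj₂ (X.bounds u∈)) (ℕ.<⇒≱ b<u)

    -- The diagonal of the inner corner ends on the outer top row or left column. No queen lies
    -- strictly between the layers, so in either case it passes through the outer corner. With
    -- `gap-tr` and `gap-bl`, all four gaps equal α.
    gap-tl : t₀ + l ≡ t + l₀
    gap-tl with D-first (full X.lo∈ Y.lo∈) tl-D
    ... | (u , v) , q∈ , inj₁ refl , s = subst (λ v → t₀ + l ≡ t + v) (col-left q∈
      (linarith 4 (λ t₀ t l v → t₀ ⊕ l ≐ t ⊕ v ⇒ t₀ ≺ t ⇒ ⊢ v ≺ l) t₀ t l v s t₀<t)) s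
    ... | (u , v) , q∈ , inj₂ refl , s = subst (λ u → u + l ≡ t + l₀) (row-top q∈
      (linarith 4 (λ u t l l₀ → u ⊕ l ≐ t ⊕ l₀ ⇒ l₀ ≺ l ⇒ ⊢ u ≺ t) u t l l₀ s l₀<l)) s

    gap-tr : t₀ + r₀ ≡ t + r
    gap-tr with E-first (full X.lo∈ Y.hi∈) tr-E
    ... | (u , v) , q∈ , inj₁ refl , s = subst (λ v → t₀ + v ≡ t + r) (col-right q∈
      (linarith 4 (λ t₀ t v r → t₀ ⊕ v ≐ t ⊕ r ⇒ t₀ ≺ t ⇒ ⊢ r ≺ v) t₀ t v r s t₀<t)) s
    ... | (u , v) , q∈ , inj₂ refl , s = subst (λ u → u + r₀ ≡ t + r) (row-top q∈
      (linarith 4 (λ u t r r₀ → u ⊕ r₀ ≐ t ⊕ r ⇒ r ≺ r₀ ⇒ ⊢ u ≺ t) u t r r₀ s r<r₀)) s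

    gap-bl : b₀ + l₀ ≡ bt + l
    gap-bl with E-last (full X.hi∈ Y.lo∈) bl-E
    ... | (u , v) , q∈ , inj₁ refl , s = subst (λ v → b₀ + v ≡ bt + l) (col-left q∈
      (linarith 4 (λ b₀ b v l → b₀ ⊕ v ≐ b ⊕ l ⇒ b ≺ b₀ ⇒ ⊢ v ≺ l) b₀ bt v l s bt<b₀)) s
    ... | (u , v) , q∈ , inj₂ refl , s = subst (λ u → u + l₀ ≡ bt + l) (row-bottom q∈
      (linarith 4 (λ u b l l₀ → u ⊕ l₀ ≐ b ⊕ l ⇒ l₀ ≺ l ⇒ ⊢ b ≺ u) u bt l l₀ s l₀<l)) s

    α : ℕ
    α = t ∸ t₀
    t≡ : t ≡ t₀ + α
    t≡ = sym (ℕ.m+[n∸m]≡n (ℕ.<⇒≤ t₀<t))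
    l≡ : l ≡ l₀ + α
    l≡ = linarith 5 (λ t t₀ l l₀ α → t ≐ t₀ ⊕ α ⇒ t₀ ⊕ l ≐ t ⊕ l₀ ⇒ ⊢ l ≐ l₀ ⊕ α) t t₀ l l₀ α t≡ gap-tl
    r≡ : r₀ ≡ r + α
    r≡ = linarith 5 (λ t t₀ r r₀ α → t ≐ t₀ ⊕ α ⇒ t₀ ⊕ r₀ ≐ t ⊕ r ⇒ ⊢ r₀ ≐ r ⊕ α) t t₀ r r₀ α t≡ gap-tr
    b≡ : b₀ ≡ bt + α
    b≡ = linarith 5 (λ b b₀ l l₀ α → l ≐ l₀ ⊕ α ⇒ b₀ ⊕ l₀ ≐ b ⊕ l ⇒ ⊢ b₀ ≐ b ⊕ α) bt b₀ l l₀ α l≡ gap-bl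
    0<α : 0 < α
    0<α = ℕ.m<n⇒0<n∸m t₀<t
    α≤t : α ≤ t
    α≤t = ℕ.m∸n≤m t t₀
    α≤l : α ≤ l
    α≤l = subst (α ≤_) (sym l≡) (ℕ.m≤n+m α l₀)

    inner-col : ∀ {u v} → (u , v) ∈ Q → l₀ < v → v < r₀ → v ∈ Bᴵ
    inner-col q∈ l< <r with col q∈
    ... | inj₁ refl = contradiction l< (ℕ.n≮n _)
    ... | inj₂ (inj₁ refl) = contradiction <r (ℕ.n≮n _)
    ... | inj₂ (inj₂ v∈) = v∈
    inner-row : ∀ {u v} → (u , v) ∈ Q → t₀ < u → u < b₀ → u ∈ Aᴵ
    inner-row q∈ t< <b with row q∈
    ... | inj₁ refl = contradiction t< (ℕ.n≮n _)
    ... | inj₂ (inj₁ refl) = contradiction <b (ℕ.n≮n _)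
    ... | inj₂ (inj₂ u∈) = u∈

    -- The diagonal goes on to the outer bottom row, α further down and therefore α further right.
    -- Since y < r, it arrives before the outer right column, so the column it meets is an inner
    -- one.
    push-bottomD : ∀ {y} → y ∈ Bᴵ → δ + 2 * ε < bt + y → y ≢ r → y + α ∈ Bᴵ
    push-bottomD {y} y∈ lt y≢r with D-last (full X.hi∈ y∈) (bottomD⁻ y∈ lt)
    ... | (u , v) , q∈ , inj₁ refl , s = subst (_∈ Bᴵ) v≡ (inner-col q∈
            (linarith 4 (λ v y α l₀ → v ≐ y ⊕ α ⇒ l₀ ≺ y ⇒ ⊢ l₀ ≺ v) v y α l₀ v≡ (proj₁ (between-cols y∈)))
            (linarith 5 (λ v y α r r₀ → v ≐ y ⊕ α ⇒ r₀ ≐ r ⊕ α ⇒ y ≺ r ⇒ ⊢ v ≺ r₀) v y α r r₀ v≡ r≡ y<r))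
      where
      y<r = ℕ.≤∧≢⇒< (proj₂ (Y.bounds y∈)) y≢r
      v≡ : v ≡ y + α
      v≡ = linarith 5 (λ v y α b b₀ → b₀ ⊕ y ≐ b ⊕ v ⇒ b₀ ≐ b ⊕ α ⇒ ⊢ v ≐ y ⊕ α) v y α bt b₀ s b≡
    ... | (u , v) , q∈ , inj₂ refl , s = ⊥-elim
      (linarith 7 (λ u y α b b₀ r r₀ → u ⊕ y ≐ b ⊕ r₀ ⇒ b₀ ≐ b ⊕ α ⇒ r₀ ≐ r ⊕ α ⇒ y ≺ r ⇒ u ≼ b₀ ⇒ ⊢⊥)
        u y α bt b₀ r r₀ s b≡ r≡ y<r (proj₂ (proj₁ (inside q∈))))
      where
      y<r = ℕ.≤∧≢⇒< (proj₂ (Y.bounds y∈)) y≢r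

    push-bottomE : ∀ {y} → y ∈ Bᴵ → y + δ < bt → y ≢ l → ∃ λ y′ → y′ ∈ Bᴵ × y ≡ y′ + α
    push-bottomE {y} y∈ lt y≢l with E-last (full X.hi∈ y∈) (bottomE⁻ y∈ lt)
    ... | (u , v) , q∈ , inj₁ refl , s = v , inner-col q∈
            (linarith 5 (λ v y α l l₀ → y ≐ v ⊕ α ⇒ l ≐ l₀ ⊕ α ⇒ l ≺ y ⇒ ⊢ l₀ ≺ v) v y α l l₀ v≡ l≡ l<y)
            (linarith 4 (λ v y α r₀ → y ≐ v ⊕ α ⇒ y ≺ r₀ ⇒ ⊢ v ≺ r₀) v y α r₀ v≡ (proj₂ (between-cols y∈))) , v≡
      where
      l<y = ℕ.≤∧≢⇒< (proj₁ (Y.bounds y∈)) (y≢l ∘ sym)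
      v≡ : y ≡ v + α
      v≡ = linarith 5 (λ v y α b b₀ → b₀ ⊕ v ≐ b ⊕ y ⇒ b₀ ≐ b ⊕ α ⇒ ⊢ y ≐ v ⊕ α) v y α bt b₀ s b≡
    ... | (u , v) , q∈ , inj₂ refl , s = ⊥-elim
      (linarith 7 (λ u y α b b₀ l l₀ → u ⊕ l₀ ≐ b ⊕ y ⇒ b₀ ≐ b ⊕ α ⇒ l ≐ l₀ ⊕ α ⇒ l ≺ y ⇒ u ≼ b₀ ⇒ ⊢⊥)
        u y α bt b₀ l l₀ s b≡ l≡ l<y (proj₂ (proj₁ (inside q∈))))
      where
      l<y = ℕ.≤∧≢⇒< (proj₁ (Y.bounds y∈)) (y≢l ∘ sym)

    push-rightD : ∀ {x} → x ∈ Aᴵ → δ + 2 * ε < r + x → x ≢ bt → x + α ∈ Aᴵ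
    push-rightD {x} x∈ lt x≢b with D-last (full x∈ Y.hi∈) (rightD⁻ x∈ lt)
    ... | (u , v) , q∈ , inj₂ refl , s = subst (_∈ Aᴵ) u≡ (inner-row q∈
            (linarith 4 (λ u x α t₀ → u ≐ x ⊕ α ⇒ t₀ ≺ x ⇒ ⊢ t₀ ≺ u) u x α t₀ u≡ (proj₁ (between-rows x∈)))
            (linarith 5 (λ u x α b b₀ → u ≐ x ⊕ α ⇒ b₀ ≐ b ⊕ α ⇒ x ≺ b ⇒ ⊢ u ≺ b₀) u x α bt b₀ u≡ b≡ x<b))
      where
      x<b = ℕ.≤∧≢⇒< (proj₂ (X.bounds x∈)) x≢b
      u≡ : u ≡ x + α
      u≡ = linarith 5 (λ u x α r r₀ → u ⊕ r ≐ x ⊕ r₀ ⇒ r₀ ≐ r ⊕ α ⇒ ⊢ u ≐ x ⊕ α) u x α r r₀ s r≡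
    ... | (u , v) , q∈ , inj₁ refl , s = ⊥-elim
      (linarith 7 (λ v x α b b₀ r r₀ → b₀ ⊕ r ≐ x ⊕ v ⇒ b₀ ≐ b ⊕ α ⇒ r₀ ≐ r ⊕ α ⇒ x ≺ b ⇒ v ≼ r₀ ⇒ ⊢⊥)
        v x α bt b₀ r r₀ s b≡ r≡ x<b (proj₂ (proj₂ (inside q∈))))
      where
      x<b = ℕ.≤∧≢⇒< (proj₂ (X.bounds x∈)) x≢b

    push-rightE : ∀ {x} → x ∈ Aᴵ → x + δ < r → x ≢ t → ∃ λ x′ → x′ ∈ Aᴵ × x ≡ x′ + α
    push-rightE {x} x∈ lt x≢t with E-first (full x∈ Y.hi∈) (rightE⁻ x∈ lt)
    ... | (u , v) , q∈ , inj₂ refl , s = u , inner-row q∈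
            (linarith 5 (λ u x α t t₀ → x ≐ u ⊕ α ⇒ t ≐ t₀ ⊕ α ⇒ t ≺ x ⇒ ⊢ t₀ ≺ u) u x α t t₀ u≡ t≡ t<x)
            (linarith 4 (λ u x α b₀ → x ≐ u ⊕ α ⇒ x ≺ b₀ ⇒ ⊢ u ≺ b₀) u x α b₀ u≡ (proj₂ (between-rows x∈))) , u≡
      where
      t<x = ℕ.≤∧≢⇒< (proj₁ (X.bounds x∈)) (x≢t ∘ sym)
      u≡ : x ≡ u + α
      u≡ = linarith 5 (λ u x α r r₀ → u ⊕ r₀ ≐ x ⊕ r ⇒ r₀ ≐ r ⊕ α ⇒ ⊢ x ≐ u ⊕ α) u x α r r₀ s r≡
    ... | (u , v) , q∈ , inj₁ refl , s = ⊥-elim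
      (linarith 7 (λ v x α t t₀ r r₀ → t₀ ⊕ v ≐ x ⊕ r ⇒ t ≐ t₀ ⊕ α ⇒ r₀ ≐ r ⊕ α ⇒ t ≺ x ⇒ v ≼ r₀ ⇒ ⊢⊥)
        v x α t t₀ r r₀ s t≡ r≡ t<x (proj₂ (proj₂ (inside q∈))))
      where
      t<x = ℕ.≤∧≢⇒< (proj₁ (X.bounds x∈)) (x≢t ∘ sym)

    ascend-cols : ∀ {y} → y ∈ Bᴵ → t + y < δ → δ + 2 * ε < bt + y → ⊥
    ascend-cols {y} = Opposite.ascend δ ε t bt α l r Bᴵ 0<α α≤t (topE Y.hi∈ tr-E) (topD Y.lo∈ tl-D) top
      (proj₂ ∘ Y.bounds) push-bottomD push-bottomE r (ℕ.m≤n+m r y)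
    descend-cols : ∀ {y} → y ∈ Bᴵ → t + δ < y → y + δ < bt → ⊥
    descend-cols {y} = Opposite.descend δ ε t bt α l r Bᴵ 0<α α≤t (topE Y.hi∈ tr-E) (topD Y.lo∈ tl-D) top
      (proj₂ ∘ Y.bounds) push-bottomD push-bottomE y ℕ.≤-refl
    -- `Opposite` with rows and columns exchanged: both strips are symmetric under transposition.
    ascend-rows : ∀ {x} → x ∈ Aᴵ → l + x < δ → δ + 2 * ε < r + x → ⊥
    ascend-rows {x} = Opposite.ascend δ ε l r α t bt Aᴵ 0<α α≤l (leftE X.hi∈ bl-E) (leftD X.lo∈ tl-D) left
      (proj₂ ∘ X.bounds) push-rightD push-rightE bt (ℕ.m≤n+m bt x)
    descend-rows : ∀ {x} → x ∈ Aᴵ → l + δ < x → x + δ < r → ⊥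
    descend-rows {x} = Opposite.descend δ ε l r α t bt Aᴵ 0<α α≤l (leftE X.hi∈ bl-E) (leftD X.lo∈ tl-D) left
      (proj₂ ∘ X.bounds) push-rightD push-rightE x ℕ.≤-refl

    4∣c+2 : Placement.lines peeled ≡ c + 2 → ∃ λ h → c + 2 ≡ 4 * h
    4∣c+2 lines≡ = Balance.c≡ lines≡ ⇒bE ⇒bD ⇒rE ⇒rD
      where
      ⇒bE : ∀ {y} → y ∈ Bᴵ → Dg (t , y) → Eg (bt , y)
      ⇒bE {y} y∈ d with Covered.good peeled-covered (full X.hi∈ y∈)
      ... | inj₂ e = e
      ... | inj₁ d′ = ⊥-elim (ascend-cols y∈ (topD y∈ d) (bottomD y∈ d′))
      ⇒bD : ∀ {y} → y ∈ Bᴵ → Eg (t , y) → Dg (bt , y)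
      ⇒bD {y} y∈ e with Covered.good peeled-covered (full X.hi∈ y∈)
      ... | inj₁ d = d
      ... | inj₂ e′ = ⊥-elim (descend-cols y∈ (topE y∈ e) (bottomE y∈ e′))
      ⇒rE : ∀ {x} → x ∈ Aᴵ → Dg (x , l) → Eg (x , r)
      ⇒rE {x} x∈ d with Covered.good peeled-covered (full x∈ Y.hi∈)
      ... | inj₂ e = e
      ... | inj₁ d′ = ⊥-elim (ascend-rows x∈ (leftD x∈ d) (rightD x∈ d′))
      ⇒rD : ∀ {x} → x ∈ Aᴵ → Eg (x , l) → Dg (x , r)
      ⇒rD {x} x∈ e with Covered.good peeled-covered (full x∈ Y.hi∈)
      ... | inj₁ d = d
      ... | inj₂ e′ = ⊥-elim (descend-rows x∈ (leftE x∈ e) (rightE x∈ e′))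

-- The function G

/12-greatest : ∀ s t → s * 12 ≤ t → s ≤ t / 12
/12-greatest s t h = subst (_≤ t / 12) (m*n/n≡m s 12) (/-monoˡ-≤ 12 h)

≤G : ∀ {m s} → 12 * s ≤ m * m → s ≤ G m
≤G {m} {s} h = ℕ.≤-trans (/12-greatest s (m * m) (subst (_≤ m * m) (ℕ.*-comm 12 s) h)) (ℕ.m≤m+n _ _)

≤G-bonus : ∀ {m s} → bonus m ≡ true → 12 * s ≤ m * m + 12 → s ≤ G m
≤G-bonus {m} {zero} _ _ = z≤n
≤G-bonus {m} {suc s} b h rewrite b | ℕ.+-comm ((m * m) / 12) 1 = s≤s
  (/12-greatest s (m * m) (subst (_≤ m * m) (ℕ.*-comm 12 s)
    (linarith 2 (λ s mm → 12 ⊙ (nat 1 ⊕ s) ≼ mm ⊕ nat 12 ⇒ ⊢ 12 ⊙ s ≼ mm) s (m * m) h)))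

bonus₃ : ∀ m → m % 12 ≡ 3 → bonus m ≡ true
bonus₃ m e rewrite e = refl
bonus₆ : ∀ m → m % 12 ≡ 6 → bonus m ≡ true
bonus₆ m e rewrite e = refl
bonus₉ : ∀ m → m % 12 ≡ 9 → bonus m ≡ true
bonus₉ m e rewrite e = refl

-- Squares are 0, 1, 4 or 9 modulo 12, and 9 only in the residue classes 3 and 9, where the bonus applies.
≤G₃ : ∀ m s → 12 * s ≤ m * m + 3 → s ≤ G m
≤G₃ m s h with m divMod 12
... | result q r eq = residue r eq
  where
  expand : ∀ r q → (r + q * 12) * (r + q * 12) ≡ r * r + 12 * (2 * r * q + 12 * (q * q))
  expand = ℕ-solve-∀
  small : ∀ r k e → m ≡ r + q * 12 → r * r ≡ 12 * k + e → e ≤ 4 → s ≤ G m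
  small r k e refl rr e≤ = ≤G {m} {s} (begin
    12 * s ≤⟨ ℕ.*-monoʳ-≤ 12 (linarith 6 (λ s mm rr k e K → 12 ⊙ s ≼ mm ⊕ nat 3 ⇒ mm ≐ rr ⊕ 12 ⊙ K ⇒ rr ≐ 12 ⊙ k ⊕ e ⇒
         e ≼ nat 4 ⇒ ⊢ s ≼ k ⊕ K) s (m * m) (r * r) k e K h (expand r q) rr e≤) ⟩
    12 * (k + K) ≤⟨ linarith 5 (λ mm rr k e K → mm ≐ rr ⊕ 12 ⊙ K ⇒ rr ≐ 12 ⊙ k ⊕ e ⇒ ⊢ 12 ⊙ (k ⊕ K) ≼ mm)
         (m * m) (r * r) k e K (expand r q) rr ⟩
    m * m ∎)
    where
    open ℕ.≤-Reasoning
    K = 2 * r * q + 12 * (q * q)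
  residue : (r : Fin 12) → m ≡ toℕ r + q * 12 → s ≤ G m
  residue zero eq = small 0 0 0 eq refl z≤n
  residue (suc zero) eq = small 1 0 1 eq refl (s≤s z≤n)
  residue (suc (suc zero)) eq = small 2 0 4 eq refl ℕ.≤-refl
  residue (suc (suc (suc zero))) eq = ≤G-bonus {m} (bonus₃ m (trans (cong (_% 12) eq) ([m+kn]%n≡m%n 3 q 12))) (ℕ.≤-trans h (ℕ.+-monoʳ-≤ (m * m) (ℕ.m≤m+n 3 9)))
  residue (suc (suc (suc (suc zero)))) eq = small 4 1 4 eq refl ℕ.≤-refl
  residue (suc (suc (suc (suc (suc zero))))) eq = small 5 2 1 eq refl (s≤s z≤n)
  residue (suc (suc (suc (suc (suc (suc zero)))))) eq = small 6 3 0 eq refl z≤n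
  residue (suc (suc (suc (suc (suc (suc (suc zero))))))) eq = small 7 4 1 eq refl (s≤s z≤n)
  residue (suc (suc (suc (suc (suc (suc (suc (suc zero)))))))) eq = small 8 5 4 eq refl ℕ.≤-refl
  residue (suc (suc (suc (suc (suc (suc (suc (suc (suc zero))))))))) eq = ≤G-bonus {m} (bonus₉ m (trans (cong (_% 12) eq) ([m+kn]%n≡m%n 9 q 12))) (ℕ.≤-trans h (ℕ.+-monoʳ-≤ (m * m) (ℕ.m≤m+n 3 9)))
  residue (suc (suc (suc (suc (suc (suc (suc (suc (suc (suc zero)))))))))) eq = small 10 8 4 eq refl ℕ.≤-refl
  residue (suc (suc (suc (suc (suc (suc (suc (suc (suc (suc (suc zero))))))))))) eq = small 11 10 1 eq refl (s≤s z≤n)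

-- The peeling bound against m², by the residue of p - c modulo 4

amgm : ∀ x y → 2 * (x * y) ≤ x * x + y * y
amgm x y = linarith 4 (λ xy xx yy q → 4 ⊙ xy ≼ q ⇒ q ≐ xx ⊕ 2 ⊙ xy ⊕ yy ⇒ ⊢ 2 ⊙ xy ≼ xx ⊕ yy) (x * y) (x * x) (y * y) _ (4ab≤ x y) (lemma x y)
  where
  lemma : ∀ x y → (x + y) * (x + y) ≡ x * x + 2 * (x * y) + y * y
  lemma = ℕ-solve-∀

-- With p rows and columns and c diagonals, m = p + c; the defect of each estimate is the square (3c − m)².
module Estimates (c j s : ℕ) where

  ρ₀ : 4 * s ≤ 8 * (c * j) + c * c → 12 * s ≤ (c + 4 * j + c) * (c + 4 * j + c) + 3
  ρ₀ h = linarith 6 (λ s cj cc jj m a → 4 ⊙ s ≼ 8 ⊙ cj ⊕ cc ⇒ m ≐ 4 ⊙ cc ⊕ 16 ⊙ cj ⊕ 16 ⊙ jj ⇒ 8 ⊙ cj ≼ cc ⊕ 16 ⊙ jj ⇒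
      ⊢ 12 ⊙ s ≼ m ⊕ nat 3) s (c * j) (c * c) (j * j) _ 0 h (expand c j) (subst₂ _≤_ (l c j) (r c j) (amgm c (4 * j)))
    where
    expand : ∀ c j → (c + 4 * j + c) * (c + 4 * j + c) ≡ 4 * (c * c) + 16 * (c * j) + 16 * (j * j)
    expand = ℕ-solve-∀
    l : ∀ c j → 2 * (c * (4 * j)) ≡ 8 * (c * j)
    l = ℕ-solve-∀
    r : ∀ c j → c * c + 4 * j * (4 * j) ≡ c * c + 16 * (j * j)
    r = ℕ-solve-∀

  ρ₁ : 4 * s ≤ 8 * (c * j) + (c + 1) * (c + 1) → 12 * s ≤ (c + 1 + 4 * j + c) * (c + 1 + 4 * j + c) + 3
  ρ₁ h = linarith 8 (λ s cj cc jj c j q m → 4 ⊙ s ≼ 8 ⊙ cj ⊕ q ⇒ q ≐ cc ⊕ 2 ⊙ c ⊕ nat 1 ⇒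
      m ≐ 4 ⊙ cc ⊕ 16 ⊙ cj ⊕ 16 ⊙ jj ⊕ 4 ⊙ c ⊕ 8 ⊙ j ⊕ nat 1 ⇒
      8 ⊙ cj ⊕ 2 ⊙ c ≼ cc ⊕ 16 ⊙ jj ⊕ 8 ⊙ j ⊕ nat 1 ⇒ ⊢ 12 ⊙ s ≼ m ⊕ nat 3) s (c * j) (c * c) (j * j) c j _ _
      h (square c) (expand c j) (subst₂ _≤_ (l c j) (r c j) (amgm c (4 * j + 1)))
    where
    square : ∀ c → (c + 1) * (c + 1) ≡ c * c + 2 * c + 1
    square = ℕ-solve-∀
    expand : ∀ c j → (c + 1 + 4 * j + c) * (c + 1 + 4 * j + c) ≡ 4 * (c * c) + 16 * (c * j) + 16 * (j * j) + 4 * c + 8 * j + 1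
    expand = ℕ-solve-∀
    l : ∀ c j → 2 * (c * (4 * j + 1)) ≡ 8 * (c * j) + 2 * c
    l = ℕ-solve-∀
    r : ∀ c j → c * c + (4 * j + 1) * (4 * j + 1) ≡ c * c + 16 * (j * j) + 8 * j + 1
    r = ℕ-solve-∀

  -- Residue 3 is treated as -1: there are `suc c` diagonals, and peeling goes down to c rows and
  -- columns, one fewer than diagonals. The bound 12s is m² + 3 - (c + 2 - 4j)² at most, and `≤G₃`
  -- absorbs the 3.
  ρ₃ : 4 * s ≤ 8 * (suc c * j) + c * c → 12 * s ≤ (c + 4 * j + suc c) * (c + 4 * j + suc c) + 3
  ρ₃ h = linarith 8 (λ s cj cc jj c j q m → 4 ⊙ s ≼ 8 ⊙ q ⊕ cc ⇒ q ≐ cj ⊕ j ⇒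
      m ≐ 4 ⊙ cc ⊕ 16 ⊙ cj ⊕ 16 ⊙ jj ⊕ 4 ⊙ c ⊕ 8 ⊙ j ⊕ nat 1 ⇒
      8 ⊙ cj ⊕ 16 ⊙ j ≼ cc ⊕ 4 ⊙ c ⊕ 16 ⊙ jj ⊕ nat 4 ⇒ ⊢ 12 ⊙ s ≼ m ⊕ nat 3) s (c * j) (c * c) (j * j) c j _ _
      h (square c j) (expand c j) (subst₂ _≤_ (l c j) (r c j) (amgm (c + 2) (4 * j)))
    where
    square : ∀ c j → suc c * j ≡ c * j + j
    square = ℕ-solve-∀
    expand : ∀ c j → (c + 4 * j + suc c) * (c + 4 * j + suc c) ≡ 4 * (c * c) + 16 * (c * j) + 16 * (j * j) + 4 * c + 8 * j + 1
    expand = ℕ-solve-∀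
    l : ∀ c j → 2 * ((c + 2) * (4 * j)) ≡ 8 * (c * j) + 16 * j
    l = ℕ-solve-∀
    r : ∀ c j → (c + 2) * (c + 2) + 4 * j * (4 * j) ≡ c * c + 4 * c + 16 * (j * j) + 4
    r = ℕ-solve-∀

-- The identity m² + 12 = 24cj + 3(c + 2)² + (c − 4j − 2)², for c ≥ 4j + 2 and for c ≤ 4j + 2.
ρ₂-above : ∀ c j d → c ≡ 4 * j + 2 + d →
  (c + 2 + 4 * j + c) * (c + 2 + 4 * j + c) + 12 ≡ 24 * (c * j) + 3 * ((c + 2) * (c + 2)) + d * d
ρ₂-above _ j d refl = identity j d
  where
  identity : ∀ j d → (4 * j + 2 + d + 2 + 4 * j + (4 * j + 2 + d)) * (4 * j + 2 + d + 2 + 4 * j + (4 * j + 2 + d)) + 12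
    ≡ 24 * ((4 * j + 2 + d) * j) + 3 * ((4 * j + 2 + d + 2) * (4 * j + 2 + d + 2)) + d * d
  identity = ℕ-solve-∀

ρ₂-below : ∀ c j d → c + d ≡ 4 * j + 2 →
  (c + 2 + 4 * j + c) * (c + 2 + 4 * j + c) + 12 ≡ 24 * (c * j) + 3 * ((c + 2) * (c + 2)) + d * d
ρ₂-below c j d e = begin
  (c + 2 + 4 * j + c) * (c + 2 + 4 * j + c) + 12 ≡⟨ cong (λ w → w * w + 12) (lemma₁ c j) ⟩
  (c + (c + (4 * j + 2))) * (c + (c + (4 * j + 2))) + 12 ≡⟨ cong (λ w → (c + (c + w)) * (c + (c + w)) + 12) (sym e) ⟩
  (c + (c + (c + d))) * (c + (c + (c + d))) + 12 ≡⟨ lemma₂ c d ⟩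
  6 * (c * (c + d)) + 3 * (c * c) + 12 + d * d ≡⟨ cong (λ w → 6 * (c * w) + 3 * (c * c) + 12 + d * d) e ⟩
  6 * (c * (4 * j + 2)) + 3 * (c * c) + 12 + d * d ≡⟨ lemma₃ c j d ⟩
  24 * (c * j) + 3 * ((c + 2) * (c + 2)) + d * d ∎
  where
  open ≡-Reasoning
  lemma₁ : ∀ c j → c + 2 + 4 * j + c ≡ c + (c + (4 * j + 2))
  lemma₁ = ℕ-solve-∀
  lemma₂ : ∀ c d → (c + (c + (c + d))) * (c + (c + (c + d))) + 12 ≡ 6 * (c * (c + d)) + 3 * (c * c) + 12 + d * d
  lemma₂ = ℕ-solve-∀
  lemma₃ : ∀ c j d → 6 * (c * (4 * j + 2)) + 3 * (c * c) + 12 + d * d ≡ 24 * (c * j) + 3 * ((c + 2) * (c + 2)) + d * d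
  lemma₃ = ℕ-solve-∀

-- At most G (p + c) queens on p rows and columns and c diagonals

module Count≤G (δ ε : ℕ) (LD LE : List Point) where
  open Strips δ ε LD LE

  -- If the bound were attained up to rounding, the outer layer and the grid inside it would both be
  -- extremal, and two tight layers force 4 to divide c + 2. The summand 4 on the left is the one
  -- queen saved.
  nested : (S : Placement) → Covered (Placement.Q S) → 2 ≤ c → ¬ (∃ λ h → c + 2 ≡ 4 * h) →
    Placement.lines S ≡ c + 2 + 4 → 4 * Placement.size S + 4 ≤ 8 * c + (c + 2) * (c + 2)
  nested S cov 2≤c 4∤ lines≡ with peel-step S cov
  ... | inj₁ s≤c = linarith 4 (λ s c q cc → s ≼ c ⇒ q ≐ cc ⊕ 4 ⊙ c ⊕ nat 4 ⇒ ⊢ 4 ⊙ s ⊕ nat 4 ≼ 8 ⊙ c ⊕ q)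
    (Placement.size S) c ((c + 2) * (c + 2)) (c * c) s≤c (square c)
    where
    square : ∀ c → (c + 2) * (c + 2) ≡ c * c + 4 * c + 4
    square = ℕ-solve-∀
  ... | inj₂ (2≤A , 2≤B) = ℕ.≮⇒≥ λ big → 4∤ (Gaps.4∣c+2 S cov P
      (P.perimeter-tight (shell big)) (frame P.peeled P.peeled-covered 2≤c lines′ (inner-big big)) lines′)
    where
    P = peel S cov 2≤A 2≤B
    module P = Peeling P
    s = Placement.size S
    s′ = Placement.size P.peeled
    q = (c + 2) * (c + 2)
    lines′ : Placement.lines P.peeled ≡ c + 2
    lines′ = linarith 3 (λ l l′ c → l ≐ nat 4 ⊕ l′ ⇒ l ≐ c ⊕ nat 2 ⊕ nat 4 ⇒ ⊢ l′ ≐ c ⊕ nat 2)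
      (Placement.lines S) (Placement.lines P.peeled) c P.lines-peeled lines≡
    inner-big : 8 * c + q < 4 * s + 4 → q < 4 * s′ + 4
    inner-big big = linarith 4 (λ s s′ c q → 8 ⊙ c ⊕ q ≺ 4 ⊙ s ⊕ nat 4 ⇒ s ≼ 2 ⊙ c ⊕ s′ ⇒ ⊢ q ≺ 4 ⊙ s′ ⊕ nat 4)
      s s′ c q big P.size-peeled
    shell : 8 * c + q < 4 * s + 4 → 2 * c ≤ # (Box.boundary? P.box) (Placement.Q S)
    shell big = linarith 5 (λ s s′ c q p → 8 ⊙ c ⊕ q ≺ 4 ⊙ s ⊕ nat 4 ⇒ p ⊕ s′ ≐ s ⇒ 4 ⊙ s′ ≼ q ⇒ ⊢ 2 ⊙ c ≼ p)
      s s′ c q (# (Box.boundary? P.box) (Placement.Q S)) big P.size-split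
      (subst (λ l → 4 * s′ ≤ l * l) lines′ (Placement.4size≤ P.peeled))

  -- Further layers are peeled until exactly one surrounds the critical grid of c + 2 rows and
  -- columns. At least one layer is indispensable, so the critical grid by itself has to be treated
  -- separately.
  strict : ∀ j (S : Placement) → Covered (Placement.Q S) → 2 ≤ c → ¬ (∃ λ h → c + 2 ≡ 4 * h) →
    Placement.lines S ≡ c + 2 + 4 * suc j → 4 * Placement.size S + 4 ≤ 8 * (c * suc j) + (c + 2) * (c + 2)
  strict zero S cov 2≤c 4∤ lines≡ = subst (λ k → 4 * Placement.size S + 4 ≤ 8 * k + (c + 2) * (c + 2))
    (sym (ℕ.*-identityʳ c)) (nested S cov 2≤c 4∤ lines≡)
  strict (suc j) S cov 2≤c 4∤ lines≡ with peel-step S cov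
  ... | inj₁ s≤c = linarith 5 (λ s c k k′ q → s ≼ c ⇒ nat 2 ≼ c ⇒ k ≐ c ⊕ k′ ⇒ ⊢ 4 ⊙ s ⊕ nat 4 ≼ 8 ⊙ k ⊕ q)
    (Placement.size S) c (c * suc (suc j)) (c * suc j) ((c + 2) * (c + 2)) s≤c 2≤c (ℕ.*-suc c (suc j))
  ... | inj₂ (2≤A , 2≤B) = linarith 6 (λ s s′ c k k′ q → s ≼ 2 ⊙ c ⊕ s′ ⇒ 4 ⊙ s′ ⊕ nat 4 ≼ 8 ⊙ k ⊕ q ⇒ k′ ≐ c ⊕ k ⇒
      ⊢ 4 ⊙ s ⊕ nat 4 ≼ 8 ⊙ k′ ⊕ q) (Placement.size S) (Placement.size P.peeled) c (c * suc j) (c * suc (suc j)) ((c + 2) * (c + 2))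
      P.size-peeled (strict j P.peeled P.peeled-covered 2≤c 4∤
        (linarith 4 (λ l l′ c j → l ≐ nat 4 ⊕ l′ ⇒ l ≐ c ⊕ nat 2 ⊕ 4 ⊙ (nat 2 ⊕ j) ⇒ ⊢ l′ ≐ c ⊕ nat 2 ⊕ 4 ⊙ (nat 1 ⊕ j))
          (Placement.lines S) (Placement.lines P.peeled) c j P.lines-peeled lines≡)) (ℕ.*-suc c (suc j))
    where
    module P = Peeling (peel S cov 2≤A 2≤B)

  -- A 2 × 3 or 3 × 2 grid cannot be covered by three diagonals.
  module Domino (S : Placement) (cov : Covered (Placement.Q S)) (F : Frame S) where
    open Placement S using (A; B; Q; on)
    open Frame F using (full; near; tight)
    open Sides S cov F
    module T = Tight tight

    open Box (enclose (Frame.X F) (Frame.Y F)) using (BottomRight; TopRight; BottomLeft)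

    t<b = X.lo<hi
    l<r = Y.lo<hi

    D-last : ∀ {p} → p ∈ Q → Dg p → ∃ λ q → q ∈ Q × BottomRight q × SameD q p
    D-last {p} p∈ d with find (Covered.onD cov p∈ d)
    ... | r , r∈ , s with T.D-bottomRight r∈
    ... | q , q∈ , _ , br , s′ = q , q∈ , br , sameD-trans q p r s′ s
    E-first : ∀ {p} → p ∈ Q → Eg p → ∃ λ q → q ∈ Q × TopRight q × SameE q p
    E-first {p} p∈ d with find (Covered.onE cov p∈ d)
    ... | r , r∈ , s with T.E-topRight r∈
    ... | q , q∈ , _ , tr , s′ = q , q∈ , tr , sameE-trans q p r s′ s
    E-last : ∀ {p} → p ∈ Q → Eg p → ∃ λ q → q ∈ Q × BottomLeft q × SameE q p
    E-last {p} p∈ d with find (Covered.onE cov p∈ d)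
    ... | r , r∈ , s with T.E-bottomLeft r∈
    ... | q , q∈ , _ , bl , s′ = q , q∈ , bl , sameE-trans q p r s′ s

    module Wide (rows : ∀ {u} → u ∈ A → u ≡ t ⊎ u ≡ bt) {m} (m∈ : m ∈ B) (l<m : l < m) (m<r : m < r)
      (cols : ∀ {v} → v ∈ B → v ≡ l ⊎ v ≡ r ⊎ v ≡ m) where

      exitD : ∀ {y} → y ∈ B → y < r → Dg (t , y) → ∃ λ v → v ∈ B × bt + y ≡ t + v
      exitD {y} y∈ y<r d with D-last (full X.lo∈ y∈) d
      ... | (u , v) , q∈ , br , s with rows (proj₁ (on q∈)) | br
      ... | inj₂ refl | _ = v , proj₂ (on q∈) , s
      ... | inj₁ refl | inj₁ e = contradiction e (ℕ.<⇒≢ t<b)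
      ... | inj₁ refl | inj₂ refl = contradiction (ℕ.+-cancelˡ-≡ t _ _ s) (ℕ.<⇒≢ y<r)
      exitE : ∀ {y} → y ∈ B → l < y → Eg (t , y) → ∃ λ v → v ∈ B × bt + v ≡ t + y
      exitE {y} y∈ l<y e with E-last (full X.lo∈ y∈) e
      ... | (u , v) , q∈ , bl , s with rows (proj₁ (on q∈)) | bl
      ... | inj₂ refl | _ = v , proj₂ (on q∈) , s
      ... | inj₁ refl | inj₁ e = contradiction e (ℕ.<⇒≢ t<b)
      ... | inj₁ refl | inj₂ refl = contradiction (ℕ.+-cancelˡ-≡ t _ _ s) (ℕ.<⇒≢ l<y)

      -- The lines from the two top corners reach the bottom row shifted by the height of the grid
      -- to the right and to the left. If the height is half the width, the middle point of the top
      -- row lies in both strips; if it is the whole width, the line of that middle point has no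
      -- second end in the grid.
      impossible : ⊥
      impossible with exitD Y.lo∈ l<r tl-D | exitE Y.hi∈ l<r tr-E
      ... | v , v∈ , s | w , w∈ , s′ with cols v∈ | cols w∈
      ... | inj₁ refl | _ = ℕ.<⇒≢ t<b (sym (ℕ.+-cancelʳ-≡ l _ _ s))
      ... | _ | inj₂ (inj₁ refl) = ℕ.<⇒≢ t<b (sym (ℕ.+-cancelʳ-≡ r _ _ s′))
      ... | inj₂ (inj₂ refl) | inj₁ refl = ℕ.<⇒≢ m<r (ℕ.+-cancelˡ-≡ t _ _ (trans (sym s) s′))
      ... | inj₂ (inj₁ refl) | inj₂ (inj₂ refl) = ℕ.<⇒≢ l<m (ℕ.+-cancelˡ-≡ bt _ _ (trans s (sym s′)))
      ... | inj₂ (inj₂ refl) | inj₂ (inj₂ refl) = top-single m∈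
        ( linarith 5 (λ t b m r δ → b ⊕ m ≐ t ⊕ r ⇒ b ≼ r ⊕ δ ⇒ ⊢ t ≼ m ⊕ δ) t bt m r δ s′ (proj₁ br-D)
        , linarith 5 (λ t b m r δ → b ⊕ m ≐ t ⊕ r ⇒ r ≼ b ⊕ δ ⇒ ⊢ m ≼ t ⊕ δ) t bt m r δ s′ (proj₂ br-D))
        (subst (λ k → δ ≤ k × k ≤ δ + 2 * ε) s bl-E)
      ... | inj₂ (inj₁ refl) | inj₁ refl with Covered.good cov (full X.lo∈ m∈)
      ...   | inj₁ d with exitD m∈ m<r d
      ...     | x , x∈ , s″ = linarith 6 (λ t b m r l x → b ⊕ m ≐ t ⊕ x ⇒ b ⊕ l ≐ t ⊕ r ⇒ x ≼ r ⇒ l ≺ m ⇒ ⊢⊥)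
                t bt m r l x s″ s (proj₂ (Y.bounds x∈)) l<m
      impossible | v , v∈ , s | w , w∈ , s′ | inj₂ (inj₁ refl) | inj₁ refl
            | inj₂ e with exitE m∈ l<m e
      ...     | x , x∈ , s″ = linarith 6 (λ t b m r l x → b ⊕ x ≐ t ⊕ m ⇒ b ⊕ l ≐ t ⊕ r ⇒ l ≼ x ⇒ m ≺ r ⇒ ⊢⊥)
                t bt m r l x s″ s (proj₁ (Y.bounds x∈)) m<r

    module Tall (cols : ∀ {v} → v ∈ B → v ≡ l ⊎ v ≡ r) {m} (m∈ : m ∈ A) (t<m : t < m) (m<b : m < bt)
      (rows : ∀ {u} → u ∈ A → u ≡ t ⊎ u ≡ bt ⊎ u ≡ m) where

      exitD : ∀ {x} → x ∈ A → x < bt → Dg (x , l) → ∃ λ u → u ∈ A × u + l ≡ x + r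
      exitD {x} x∈ x<b d with D-last (full x∈ Y.lo∈) d
      ... | (u , v) , q∈ , br , s with cols (proj₂ (on q∈)) | br
      ... | inj₂ refl | _ = u , proj₁ (on q∈) , s
      ... | inj₁ refl | inj₂ e = contradiction e (ℕ.<⇒≢ l<r)
      ... | inj₁ refl | inj₁ refl = contradiction (sym (ℕ.+-cancelʳ-≡ l _ _ s)) (ℕ.<⇒≢ x<b)
      exitE : ∀ {x} → x ∈ A → t < x → Eg (x , l) → ∃ λ u → u ∈ A × u + r ≡ x + l
      exitE {x} x∈ t<x e with E-first (full x∈ Y.lo∈) e
      ... | (u , v) , q∈ , tr , s with cols (proj₂ (on q∈)) | tr
      ... | inj₂ refl | _ = u , proj₁ (on q∈) , s
      ... | inj₁ refl | inj₂ e = contradiction e (ℕ.<⇒≢ l<r)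
      ... | inj₁ refl | inj₁ refl = contradiction (ℕ.+-cancelʳ-≡ l _ _ s) (ℕ.<⇒≢ t<x)

      impossible : ⊥
      impossible with exitD X.lo∈ t<b tl-D | exitE X.hi∈ t<b bl-E
      ... | v , v∈ , s | w , w∈ , s′ with rows v∈ | rows w∈
      ... | inj₁ refl | _ = ℕ.<⇒≢ l<r (ℕ.+-cancelˡ-≡ t _ _ s)
      ... | _ | inj₂ (inj₁ refl) = ℕ.<⇒≢ l<r (sym (ℕ.+-cancelˡ-≡ bt _ _ s′))
      ... | inj₂ (inj₂ refl) | inj₁ refl = ℕ.<⇒≢ m<b (ℕ.+-cancelʳ-≡ l _ _ (trans s s′))
      ... | inj₂ (inj₁ refl) | inj₂ (inj₂ refl) = ℕ.<⇒≢ t<m (ℕ.+-cancelʳ-≡ r _ _ (trans (sym s) (sym s′)))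
      ... | inj₂ (inj₂ refl) | inj₂ (inj₂ refl) = left-single m∈
        ( linarith 5 (λ l b m r δ → m ⊕ r ≐ b ⊕ l ⇒ b ≼ r ⊕ δ ⇒ ⊢ m ≼ l ⊕ δ) l bt m r δ s′ (proj₁ br-D)
        , linarith 5 (λ l b m r δ → m ⊕ r ≐ b ⊕ l ⇒ r ≼ b ⊕ δ ⇒ ⊢ l ≼ m ⊕ δ) l bt m r δ s′ (proj₂ br-D))
        (subst (λ k → δ ≤ k × k ≤ δ + 2 * ε) (sym s) tr-E)
      ... | inj₂ (inj₁ refl) | inj₁ refl with Covered.good cov (full m∈ Y.lo∈)
      ...   | inj₁ d with exitD m∈ m<b d
      ...     | x , x∈ , s″ = linarith 6 (λ t b m r l x → x ⊕ l ≐ m ⊕ r ⇒ b ⊕ l ≐ t ⊕ r ⇒ x ≼ b ⇒ t ≺ m ⇒ ⊢⊥)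
                t bt m r l x s″ s (proj₂ (X.bounds x∈)) t<m
      impossible | v , v∈ , s | w , w∈ , s′ | inj₂ (inj₁ refl) | inj₁ refl
            | inj₂ e with exitE m∈ t<m e
      ...     | x , x∈ , s″ = linarith 6 (λ t b m r l x → x ⊕ r ≐ m ⊕ l ⇒ b ⊕ l ≐ t ⊕ r ⇒ t ≼ x ⇒ m ≺ b ⇒ ⊢⊥)
                t bt m r l x s″ s (proj₁ (X.bounds x∈)) m<b

    impossible : Placement.lines S ≡ 5 → ⊥
    impossible lines≡ = go X.inner Y.inner refl refl
      where
      two : ∀ {C} (Z : Extremes C) → Extremes.inner Z ≡ [] → ∀ {z} → z ∈ C → z ≡ Extremes.lo Z ⊎ z ≡ Extremes.hi Z
      two Z e z∈ with classify Z z∈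
      ... | inj₁ p = inj₁ p
      ... | inj₂ (inj₁ p) = inj₂ p
      ... | inj₂ (inj₂ p) rewrite e = contradiction p λ ()
      three : ∀ {C m} (Z : Extremes C) → Extremes.inner Z ≡ m ∷ [] → ∀ {z} → z ∈ C →
        z ≡ Extremes.lo Z ⊎ z ≡ Extremes.hi Z ⊎ z ≡ m
      three Z e z∈ with classify Z z∈
      ... | inj₁ p = inj₁ p
      ... | inj₂ (inj₁ p) = inj₂ (inj₁ p)
      ... | inj₂ (inj₂ p) rewrite e with p
      ...   | here q = inj₂ (inj₂ q)
      sum : length X.inner + length Y.inner ≡ 1
      sum = linarith 4 (λ a b x y → a ⊕ b ≐ nat 5 ⇒ a ≐ nat 2 ⊕ x ⇒ b ≐ nat 2 ⊕ y ⇒ ⊢ x ⊕ y ≐ nat 1)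
        (length A) (length B) (length X.inner) (length Y.inner) lines≡ X.size Y.size
      go : ∀ xs ys → X.inner ≡ xs → Y.inner ≡ ys → ⊥
      go [] [] e f = contradiction (trans (sym (cong₂ (λ u v → length u + length v) e f)) sum) λ ()
      go [] (m ∷ []) e f with Y.inner⁻ (subst (m ∈_) (sym f) (here refl))
      ... | m∈ , l<m , m<r = Wide.impossible (two (Frame.X F) e) m∈ l<m m<r (three (Frame.Y F) f)
      go (m ∷ []) [] e f with X.inner⁻ (subst (m ∈_) (sym e) (here refl))
      ... | m∈ , t<m , m<b = Tall.impossible (two (Frame.Y F) f) m∈ t<m m<b (three (Frame.X F) e)
      go [] (_ ∷ _ ∷ _) e f = contradiction (trans (sym (cong₂ (λ u v → length u + length v) e f)) sum) λ ()
      go (_ ∷ xs) (_ ∷ ys) e f = contradiction (trans (sym (cong₂ (λ u v → length u + length v) e f)) sum)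
        λ eq → ℕ.1+n≢0 (trans (sym (ℕ.+-suc (length xs) (length ys))) (ℕ.suc-injective eq))
      go (_ ∷ _ ∷ _) [] e f = contradiction (trans (sym (cong₂ (λ u v → length u + length v) e f)) sum) λ ()

  domino : (S : Placement) → Covered (Placement.Q S) → c ≡ 3 → Placement.lines S ≡ 5 → 4 * Placement.size S + 4 ≤ 25
  domino S cov c≡3 lines≡ = ℕ.≮⇒≥ λ big → Domino.impossible S cov
    (frame S cov (subst (2 ≤_) (sym c≡3) (s≤s (s≤s z≤n))) (trans lines≡ (cong (_+ 2) (sym c≡3)))
      (subst (λ k → (k + 2) * (k + 2) < 4 * Placement.size S + 4) (sym c≡3) big)) lines≡

  no-diagonals : (S : Placement) → Covered (Placement.Q S) → c ≡ 0 → Placement.size S ≡ 0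
  no-diagonals S cov c≡0 = empty (Placement.Q S) refl
    where
    none : ∀ {R : Point → Set} L → length L ≡ 0 → ¬ Any R L
    none [] _ ()
    empty : ∀ Q → Placement.Q S ≡ Q → length (Placement.Q S) ≡ 0
    empty [] refl = refl
    empty (p ∷ _) e with subst (p ∈_) (sym e) (here refl)
    ... | p∈ with Covered.good cov p∈
    ... | inj₁ d = contradiction (Covered.onD cov p∈ d) (none LD (ℕ.m+n≡0⇒m≡0 (length LD) c≡0))
    ... | inj₂ d = contradiction (Covered.onE cov p∈ d) (none LE (ℕ.m+n≡0⇒n≡0 (length LD) c≡0))

  module _ (S : Placement) (cov : Covered (Placement.Q S)) where
    open Placement S using (size; lines)

    few : lines < c → size ≤ G (lines + c)
    few p<c with ℕ.m≤n⇒∃[o]m+o≡n (ℕ.<⇒≤ p<c)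
    ... | d , eq = ≤G {lines + c} (linarith 3 (λ s pp m → 4 ⊙ s ≼ pp ⇒ 4 ⊙ pp ≼ m ⇒ ⊢ 12 ⊙ s ≼ m)
      size (lines * lines) ((lines + c) * (lines + c)) (Placement.4size≤ S)
      (subst (λ c → 4 * (lines * lines) ≤ (lines + c) * (lines + c)) eq
        (subst (4 * (lines * lines) ≤_) (square lines d) (ℕ.m≤m+n _ _))))
      where
      square : ∀ p d → 4 * (p * p) + (4 * (p * d) + d * d) ≡ (p + (p + d)) * (p + (p + d))
      square = ℕ-solve-∀

    residue₀ : ∀ j → lines ≡ c + 4 * j → size ≤ G (lines + c)
    residue₀ j eq = ≤G₃ (lines + c) size (subst (λ p → 12 * size ≤ (p + c) * (p + c) + 3) (sym eq)
      (Estimates.ρ₀ c j size (bound j c S cov eq)))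

    residue₁ : ∀ j → lines ≡ c + 1 + 4 * j → size ≤ G (lines + c)
    residue₁ j eq = ≤G₃ (lines + c) size (subst (λ p → 12 * size ≤ (p + c) * (p + c) + 3) (sym eq)
      (Estimates.ρ₁ c j size (bound j (c + 1) S cov eq)))

    residue₃ : ∀ j → lines ≡ c + 3 + 4 * j → size ≤ G (lines + c)
    residue₃ j eq = go c refl
      where
      go : ∀ c′ → c ≡ c′ → size ≤ G (lines + c)
      go zero e = subst (_≤ G (lines + c)) (sym (no-diagonals S cov e)) z≤n
      go (suc c′) e = ≤G₃ (lines + c) size (subst₂ (λ p c → 12 * size ≤ (p + c) * (p + c) + 3) (sym lines≡) (sym e)
        (Estimates.ρ₃ c′ (suc j) size (subst (λ c → 4 * size ≤ 8 * (c * suc j) + c′ * c′) e (bound (suc j) c′ S cov lines≡))))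
        where
        lines≡ : lines ≡ c′ + 4 * suc j
        lines≡ = linarith 4 (λ l c c′ j → l ≐ c ⊕ nat 3 ⊕ 4 ⊙ j ⇒ c ≐ nat 1 ⊕ c′ ⇒ ⊢ l ≐ c′ ⊕ 4 ⊙ (nat 1 ⊕ j)) lines c c′ j eq e

    module Residue₂ (j : ℕ) (eq : lines ≡ c + 2 + 4 * j) where
      m = lines + c

      identity : ∀ d → (c ≡ 4 * j + 2 + d ⊎ c + d ≡ 4 * j + 2) → m * m + 12 ≡ 24 * (c * j) + 3 * ((c + 2) * (c + 2)) + d * d
      identity d h = subst (λ p → (p + c) * (p + c) + 12 ≡ 24 * (c * j) + 3 * ((c + 2) * (c + 2)) + d * d) (sym eq) (case h)
        where
        case : (c ≡ 4 * j + 2 + d ⊎ c + d ≡ 4 * j + 2) →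
          (c + 2 + 4 * j + c) * (c + 2 + 4 * j + c) + 12 ≡ 24 * (c * j) + 3 * ((c + 2) * (c + 2)) + d * d
        case (inj₁ e) = ρ₂-above c j d e
        case (inj₂ e) = ρ₂-below c j d e

      defect : ∀ d → (c ≡ 4 * j + 2 + d ⊎ c + d ≡ 4 * j + 2) → 12 * size + d * d ≤ m * m + 12
      defect d h = linarith 5 (λ s cj q dd mm → 4 ⊙ s ≼ 8 ⊙ cj ⊕ q ⇒ mm ⊕ nat 12 ≐ 24 ⊙ cj ⊕ 3 ⊙ q ⊕ dd ⇒
        ⊢ 12 ⊙ s ⊕ dd ≼ mm ⊕ nat 12) size (c * j) ((c + 2) * (c + 2)) (d * d) (m * m) (bound j (c + 2) S cov eq) (identity d h)

      strict-defect : ∀ d → (c ≡ 4 * j + 2 + d ⊎ c + d ≡ 4 * j + 2) →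
        4 * size + 4 ≤ 8 * (c * j) + (c + 2) * (c + 2) → size ≤ G m
      strict-defect d h st = ≤G {m} (linarith 5 (λ s cj q dd mm → 4 ⊙ s ⊕ nat 4 ≼ 8 ⊙ cj ⊕ q ⇒
        mm ⊕ nat 12 ≐ 24 ⊙ cj ⊕ 3 ⊙ q ⊕ dd ⇒ ⊢ 12 ⊙ s ≼ mm) size (c * j) ((c + 2) * (c + 2)) (d * d) (m * m) st (identity d h))

      -- At distance 3 or more from the optimum the squared defect is at least 9; it lowers the
      -- slack from 12 to the 3 that `≤G₃` absorbs.
      far : ∀ d → (c ≡ 4 * j + 2 + (3 + d) ⊎ c + (3 + d) ≡ 4 * j + 2) → size ≤ G m
      far d h = ≤G₃ m size (linarith 4 (λ s k l mm → 12 ⊙ s ⊕ k ≼ mm ⊕ nat 12 ⇒ k ≐ nat 9 ⊕ l ⇒ ⊢ 12 ⊙ s ≼ mm ⊕ nat 3)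
        size ((3 + d) * (3 + d)) (6 * d + d * d) (m * m) (defect (3 + d) h) (square d))
        where
        square : ∀ d → (3 + d) * (3 + d) ≡ 9 + (6 * d + d * d)
        square = ℕ-solve-∀

      -- At the exact optimum nothing can be gained, but then m = 6 + 12j and G has its bonus.
      central : c ≡ 4 * j + 2 + 0 → size ≤ G m
      central e = ≤G-bonus {m} (bonus₆ m (trans (cong (_% 12) m≡) ([m+kn]%n≡m%n 6 j 12)))
        (subst (_≤ m * m + 12) (ℕ.+-identityʳ _) (defect 0 (inj₁ e)))
        where
        m≡ : m ≡ 6 + j * 12
        m≡ = trans (linarith 3 (λ l c j → l ≐ c ⊕ nat 2 ⊕ 4 ⊙ j ⇒ c ≐ 4 ⊙ j ⊕ nat 2 ⊕ nat 0 ⇒ ⊢ l ⊕ c ≐ nat 6 ⊕ 12 ⊙ j) lines c j eq e)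
          (cong (6 +_) (ℕ.*-comm 12 j))

    module _ (4∤ : ¬ (∃ λ h → c + 2 ≡ 4 * h)) where

      nearby : ∀ j (eq : lines ≡ c + 2 + 4 * suc j) d → (c ≡ 4 * suc j + 2 + d ⊎ c + d ≡ 4 * suc j + 2) → d ≤ 2 → size ≤ G (lines + c)
      nearby j eq d h d≤ = Residue₂.strict-defect (suc j) eq d h (strict j S cov (2≤c h) 4∤ eq)
        where
        2≤c : (c ≡ 4 * suc j + 2 + d ⊎ c + d ≡ 4 * suc j + 2) → 2 ≤ c
        2≤c (inj₁ e) = linarith 3 (λ c j d → c ≐ 4 ⊙ (nat 1 ⊕ j) ⊕ nat 2 ⊕ d ⇒ ⊢ nat 2 ≼ c) c j d e
        2≤c (inj₂ e) = linarith 3 (λ c j d → c ⊕ d ≐ 4 ⊙ (nat 1 ⊕ j) ⊕ nat 2 ⇒ d ≼ nat 2 ⇒ ⊢ nat 2 ≼ c) c j d e d≤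

    4∤4k+ : ∀ k e → 0 < e → e < 4 → c + 2 ≡ 4 * k + e → ¬ (∃ λ h → c + 2 ≡ 4 * h)
    4∤4k+ k e 0<e e<4 eq (h , eq′) with ℕ.≤-<-connex h k
    ... | inj₁ h≤k = linarith 4 (λ x k e h → x ≐ 4 ⊙ k ⊕ e ⇒ x ≐ 4 ⊙ h ⇒ h ≼ k ⇒ nat 0 ≺ e ⇒ ⊢⊥) (c + 2) k e h eq eq′ h≤k 0<e
    ... | inj₂ k<h = linarith 4 (λ x k e h → x ≐ 4 ⊙ k ⊕ e ⇒ x ≐ 4 ⊙ h ⇒ k ≺ h ⇒ e ≺ nat 4 ⇒ ⊢⊥) (c + 2) k e h eq eq′ k<h e<4

    above : ∀ j → lines ≡ c + 2 + 4 * j → ∀ d → c ≡ 4 * j + 2 + d → size ≤ G (lines + c)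
    above j eq zero e = Residue₂.central j eq e
    -- For j = 0 no layer surrounds the critical grid, so `strict` does not apply; here c = 3 and
    -- there are 5 rows and columns.
    above zero eq (suc zero) e = Residue₂.strict-defect 0 eq 1 (inj₁ e)
      (subst (λ k → 4 * size + 4 ≤ 8 * (k * 0) + (k + 2) * (k + 2)) (sym e) (domino S cov e (trans eq (cong (λ k → k + 2 + 0) e))))
    -- Here c = 4 with 6 rows and columns, so m = 10. The bound of nine queens is not improved, and
    -- it is exactly the exceptional value `G 10`.
    above zero eq (suc (suc zero)) e = subst (size ≤_) (sym (cong G (cong₂ _+_ (trans eq (cong (λ k → k + 2 + 0) e)) e)))
      (linarith 1 (λ s → 4 ⊙ s ≼ nat 36 ⇒ ⊢ s ≼ nat 9) size
        (subst (λ l → 4 * size ≤ l * l) (trans eq (cong (λ k → k + 2 + 0) e)) (Placement.4size≤ S)))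
    above (suc j) eq (suc zero) e = nearby (4∤4k+ (suc (suc j)) 1 (s≤s z≤n) (s≤s (s≤s z≤n))
      (linarith 2 (λ c j → c ≐ 4 ⊙ (nat 1 ⊕ j) ⊕ nat 2 ⊕ nat 1 ⇒ ⊢ c ⊕ nat 2 ≐ 4 ⊙ (nat 2 ⊕ j) ⊕ nat 1) c j e)) j eq 1 (inj₁ e) (s≤s z≤n)
    above (suc j) eq (suc (suc zero)) e = nearby (4∤4k+ (suc (suc j)) 2 (s≤s z≤n) (s≤s (s≤s (s≤s z≤n)))
      (linarith 2 (λ c j → c ≐ 4 ⊙ (nat 1 ⊕ j) ⊕ nat 2 ⊕ nat 2 ⇒ ⊢ c ⊕ nat 2 ≐ 4 ⊙ (nat 2 ⊕ j) ⊕ nat 2) c j e)) j eq 2 (inj₁ e) ℕ.≤-refl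
    above j eq (suc (suc (suc d))) e = Residue₂.far j eq d (inj₁ e)

    below : ∀ j → lines ≡ c + 2 + 4 * j → ∀ d → c + d ≡ 4 * j + 2 → size ≤ G (lines + c)
    below j eq zero e = Residue₂.central j eq (trans (sym (ℕ.+-identityʳ c)) (trans e (sym (ℕ.+-identityʳ _))))
    below zero eq (suc zero) e = Residue₂.strict-defect 0 eq 1 (inj₂ e) (thin (peel-step S cov))
      where
      c≡1 : c ≡ 1
      c≡1 = ℕ.+-cancelʳ-≡ 1 c 1 e
      lines≡ : lines ≡ 3
      lines≡ = trans eq (cong (λ k → k + 2 + 0) c≡1)
      thin : size ≤ c ⊎ (2 ≤ length (Placement.A S) × 2 ≤ length (Placement.B S)) → 4 * size + 4 ≤ 8 * (c * 0) + (c + 2) * (c + 2)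
      thin (inj₁ s≤) = subst (λ k → 4 * size + 4 ≤ 8 * (k * 0) + (k + 2) * (k + 2)) (sym c≡1)
        (linarith 1 (λ s → s ≼ nat 1 ⇒ ⊢ 4 ⊙ s ⊕ nat 4 ≼ nat 9) size (subst (size ≤_) c≡1 s≤))
      thin (inj₂ (p , q)) = contradiction (subst (4 ≤_) lines≡ (ℕ.+-mono-≤ p q)) (ℕ.<⇒≱ ℕ.≤-refl)
    below zero eq (suc (suc zero)) e = subst (_≤ G (lines + c))
      (sym (no-diagonals S cov (ℕ.+-cancelʳ-≡ 2 c 0 e))) z≤n
    below (suc j) eq (suc zero) e = nearby (4∤4k+ (suc j) 3 (s≤s z≤n) ℕ.≤-refl
      (linarith 2 (λ c j → c ⊕ nat 1 ≐ 4 ⊙ (nat 1 ⊕ j) ⊕ nat 2 ⇒ ⊢ c ⊕ nat 2 ≐ 4 ⊙ (nat 1 ⊕ j) ⊕ nat 3) c j e)) j eq 1 (inj₂ e) (s≤s z≤n)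
    below (suc j) eq (suc (suc zero)) e = nearby (4∤4k+ (suc j) 2 (s≤s z≤n) (s≤s (s≤s (s≤s z≤n)))
      (linarith 2 (λ c j → c ⊕ nat 2 ≐ 4 ⊙ (nat 1 ⊕ j) ⊕ nat 2 ⇒ ⊢ c ⊕ nat 2 ≐ 4 ⊙ (nat 1 ⊕ j) ⊕ nat 2) c j e)) j eq 2 (inj₂ e) ℕ.≤-refl
    below j eq (suc (suc (suc d))) e = Residue₂.far j eq d (inj₂ e)

    residue₂ : ∀ j → lines ≡ c + 2 + 4 * j → size ≤ G (lines + c)
    residue₂ j eq with ℕ.≤-total (4 * j + 2) c
    ... | inj₁ p = let d , e = ℕ.m≤n⇒∃[o]m+o≡n p in above j eq d (sym e)
    ... | inj₂ p = let d , e = ℕ.m≤n⇒∃[o]m+o≡n p in below j eq d e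

    size≤G : size ≤ G (lines + c)
    size≤G with ℕ.<-≤-connex lines c
    ... | inj₁ p<c = few p<c
    ... | inj₂ c≤p with ℕ.m≤n⇒∃[o]m+o≡n c≤p
    ... | o , eq with o divMod 4
    ... | result j zero e = residue₀ j (trans (sym eq) (linarith 4 (λ o j J c → o ≐ nat 0 ⊕ J ⇒ J ≐ 4 ⊙ j ⇒ ⊢ c ⊕ o ≐ c ⊕ 4 ⊙ j) o j (j * 4) c e (ℕ.*-comm j 4)))
    ... | result j (suc zero) e = residue₁ j (trans (sym eq) (linarith 4 (λ o j J c → o ≐ nat 1 ⊕ J ⇒ J ≐ 4 ⊙ j ⇒ ⊢ c ⊕ o ≐ c ⊕ nat 1 ⊕ 4 ⊙ j) o j (j * 4) c e (ℕ.*-comm j 4)))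
    ... | result j (suc (suc zero)) e = residue₂ j (trans (sym eq) (linarith 4 (λ o j J c → o ≐ nat 2 ⊕ J ⇒ J ≐ 4 ⊙ j ⇒ ⊢ c ⊕ o ≐ c ⊕ nat 2 ⊕ 4 ⊙ j) o j (j * 4) c e (ℕ.*-comm j 4)))
    ... | result j (suc (suc (suc zero))) e = residue₃ j (trans (sym eq) (linarith 4 (λ o j J c → o ≐ nat 3 ⊕ J ⇒ J ≐ 4 ⊙ j ⇒ ⊢ c ⊕ o ≐ c ⊕ nat 3 ⊕ 4 ⊙ j) o j (j * 4) c e (ℕ.*-comm j 4)))

-- Lines on the board

representatives : ∀ {A : Set} {R : A → A → Set} → (∀ x y → Dec (R x y)) → List A → List A
representatives R? [] = []
representatives R? (x ∷ xs) with Any.any? (R? x) (representatives R? xs)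
... | yes _ = representatives R? xs
... | no _ = x ∷ representatives R? xs

module Representatives {A : Set} {R : A → A → Set} (R? : ∀ x y → Dec (R x y)) (R-refl : ∀ {x} → R x x) where

  rep-⊆ : ∀ xs {x} → x ∈ representatives R? xs → x ∈ xs
  rep-⊆ (y ∷ xs) x∈ with Any.any? (R? y) (representatives R? xs)
  ... | yes _ = there (rep-⊆ xs x∈)
  rep-⊆ (y ∷ xs) (here e) | no _ = here e
  rep-⊆ (y ∷ xs) (there x∈) | no _ = there (rep-⊆ xs x∈)

  rep-hit : ∀ xs {x} → x ∈ xs → Any (R x) (representatives R? xs)
  rep-hit (y ∷ xs) x∈ with Any.any? (R? y) (representatives R? xs)
  rep-hit (y ∷ xs) (here refl) | yes p = p
  rep-hit (y ∷ xs) (there x∈) | yes _ = rep-hit xs x∈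
  rep-hit (y ∷ xs) (here refl) | no _ = here R-refl
  rep-hit (y ∷ xs) (there x∈) | no _ = there (rep-hit xs x∈)

  rep-apart : ∀ xs → AllPairs (λ x y → ¬ R x y) (representatives R? xs)
  rep-apart [] = []
  rep-apart (y ∷ xs) with Any.any? (R? y) (representatives R? xs)
  ... | yes _ = rep-apart xs
  ... | no ¬p = All.¬Any⇒All¬ _ ¬p ∷ rep-apart xs

∈-take : ∀ {A : Set} m {xs : List A} {x} → x ∈ take m xs → x ∈ xs
∈-take (suc m) {_ ∷ _} (here e) = here e
∈-take (suc m) {_ ∷ _} (there x∈) = there (∈-take m x∈)

length-take≤ : ∀ {A : Set} m (xs : List A) → length (take m xs) ≤ m
length-take≤ zero xs = z≤n
length-take≤ (suc m) [] = z≤n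
length-take≤ (suc m) (x ∷ xs) = s≤s (length-take≤ m xs)

#-none : ∀ {A : Set} {P : A → Set} (P? : Decidable P) {xs} → All (λ x → ¬ P x) xs → # P? xs ≡ 0
#-none P? [] = refl
#-none P? {x ∷ xs} (¬p ∷ ¬ps) with P? x
... | yes p = contradiction p ¬p
... | no _ = #-none P? ¬ps

-- One choice of at most m elements that is good enough for every threshold θ at once.
record Selection {A : Set} (R : A → A → Set) (κ : A → ℕ) (m : ℕ) (L : List A) : Set where
  field
    chosen : List A
    ⊆L : ∀ {x} → x ∈ chosen → x ∈ L
    apart : AllPairs (λ x y → ¬ R x y) chosen
    few : length chosen ≤ m
    enough : ∀ θ → m ≤ # (λ x → κ x ≤? θ) chosen ⊎ # (λ x → κ x ≤? θ) L ≤ # (λ x → κ x ≤? θ) chosen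

-- Sorting by κ and keeping a prefix serves all thresholds: for a condition inherited by earlier
-- elements, the first m elements either all satisfy it or include every element that does.
select : ∀ {A : Set} {R : A → A → Set} → (∀ {x y} → R x y → R y x) → (κ : A → ℕ) → ∀ m {L} →
  AllPairs (λ x y → ¬ R x y) L → Selection R κ m L
select {A} {R} R-sym κ m {L} apart = record
  { chosen = take m sorted
  ; ⊆L = ∈-resp-↭ (sort-↭ L) ∘ ∈-take m
  ; apart = AllPairs.take⁺ m (resp (↭⇒↭ₛ (↭-sym (sort-↭ L))) apart)
  ; few = length-take≤ m sorted
  ; enough = λ θ → subst (λ k → m ≤ # (λ x → κ x ≤? θ) (take m sorted) ⊎ k ≤ # (λ x → κ x ≤? θ) (take m sorted))
      (↭-length (filter-↭ (λ x → κ x ≤? θ) (sort-↭ L)))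
      (prefix (λ x → κ x ≤? θ) m (AllPairs.map ℕ.≤-trans (Sorted⇒AllPairs (On.totalOrder ℕ.≤-totalOrder κ) (sort-↗ L))))
  }
  where
  open Sort (On.decTotalOrder ℕ.≤-decTotalOrder κ) using (sort; sort-↭; sort-↗)
  sorted = sort L
  resp = Permutation.AllPairs-resp-↭ (setoid A) (λ ¬r r → ¬r (R-sym r)) ((λ { refl ¬r → ¬r }) , (λ { refl ¬r → ¬r }))
  prefix : ∀ {P : A → Set} (P? : Decidable P) m {xs} → AllPairs (λ x y → P y → P x) xs →
    m ≤ # P? (take m xs) ⊎ # P? xs ≤ # P? (take m xs)
  prefix P? zero _ = inj₁ z≤n
  prefix P? (suc m) [] = inj₂ z≤n
  prefix P? (suc m) {x ∷ xs} (x≤ ∷ ps) with P? x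
  ... | no ¬p = inj₂ (subst (_≤ # P? (take m xs)) (sym (#-none P? (All.map (λ f q → ¬p (f q)) x≤))) z≤n)
  ... | yes _ with prefix P? m ps
  ...   | inj₁ p = inj₁ (s≤s p)
  ...   | inj₂ p = inj₂ (s≤s p)

-- The Bonferroni inequality; the pairs of sets contribute at most the square of their number.
module Union {X A : Set} {P : X → A → Set} (P? : ∀ x → Decidable (P x)) (S : List A) where

  some? : ∀ xs → Decidable (λ s → Any (λ x → P x s) xs)
  some? xs s = Any.any? (λ x → P? x s) xs

  both? : ∀ x y → Decidable (λ s → P x s × P y s)
  both? x y s = P? x s ×-dec P? y s

  union-≥ : ∀ {xs} → AllPairs (λ x y → # (both? x y) S ≤ 1) xs →
    ∑ xs (λ x → # (P? x) S) ≤ # (some? xs) S + length xs * length xs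
  union-≥ [] = z≤n
  union-≥ {x ∷ xs} (meets ∷ ps) = subst (∑ (x ∷ xs) (λ x → # (P? x) S) ≤_) (cong (# (some? (x ∷ xs)) S +_) (square (length xs)))
    (linarith 7 (λ p t u u′ b l ll →
      p ⊕ u ≼ u′ ⊕ b ⇒ b ≼ l ⇒ t ≼ u ⊕ ll ⇒ ⊢ p ⊕ t ≼ u′ ⊕ (nat 1 ⊕ l ⊕ (l ⊕ ll)))
      (# (P? x) S) (∑ xs (λ x → # (P? x) S)) (# (some? xs) S) (# (some? (x ∷ xs)) S) (∑ xs (λ y → # (both? x y) S))
      (length xs) (length xs * length xs) split few (union-≥ ps))
    where
    square : ∀ l → suc l + (l + l * l) ≡ suc l * suc l
    square = ℕ-solve-∀
    few : ∑ xs (λ y → # (both? x y) S) ≤ length xs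
    few = subst (∑ xs (λ y → # (both? x y) S) ≤_) (trans (∑-const xs 1) (ℕ.*-identityʳ _)) (∑-≤ xs (λ y∈ → All.lookup meets y∈))
    shared : ∀ s ys → P x s → Any (λ y → P y s) ys → 1 ≤ ∑ ys (λ y → 𝟙 (both? x y s))
    shared s (y ∷ ys) p (here q) = ℕ.≤-trans (𝟙-≥ (both? x y s) (p , q)) (ℕ.m≤m+n _ _)
    shared s (y ∷ ys) p (there q) = ℕ.≤-trans (shared s ys p q) (ℕ.m≤n+m _ (𝟙 (both? x y s)))
    pointwise : ∀ s → 𝟙 (P? x s) + 𝟙 (some? xs s) ≤ 𝟙 (some? (x ∷ xs) s) + ∑ xs (λ y → 𝟙 (both? x y s))
    pointwise s = cases (P? x s) (some? xs s)
      where
      cases : (d : Dec (P x s)) (e : Dec (Any (λ x → P x s) xs)) →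
        𝟙 d + 𝟙 e ≤ 𝟙 (some? (x ∷ xs) s) + ∑ xs (λ y → 𝟙 (both? x y s))
      cases (yes p) (yes q) = ℕ.+-mono-≤ (𝟙-≥ (some? (x ∷ xs) s) (here p)) (shared s xs p q)
      cases (yes p) (no _) = ℕ.≤-trans (𝟙-≥ (some? (x ∷ xs) s) (here p)) (ℕ.m≤m+n _ _)
      cases (no _) (yes q) = ℕ.≤-trans (𝟙-≥ (some? (x ∷ xs) s) (there q)) (ℕ.m≤m+n _ _)
      cases (no _) (no _) = z≤n
    split : # (P? x) S + # (some? xs) S ≤ # (some? (x ∷ xs)) S + ∑ xs (λ y → # (both? x y) S)
    split = begin
      # (P? x) S + # (some? xs) S ≡⟨ cong₂ _+_ (#-∑ (P? x) S) (#-∑ (some? xs) S) ⟩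
      ∑ S (𝟙 ∘ P? x) + ∑ S (𝟙 ∘ some? xs) ≡⟨ sym (∑-+ S _ _) ⟩
      ∑ S (λ s → 𝟙 (P? x s) + 𝟙 (some? xs s)) ≤⟨ ∑-≤ S (λ {s} _ → pointwise s) ⟩
      ∑ S (λ s → 𝟙 (some? (x ∷ xs) s) + ∑ xs (λ y → 𝟙 (both? x y s))) ≡⟨ ∑-+ S _ _ ⟩
      ∑ S (𝟙 ∘ some? (x ∷ xs)) + ∑ S (λ s → ∑ xs (λ y → 𝟙 (both? x y s)))
        ≡⟨ cong₂ _+_ (sym (#-∑ (some? (x ∷ xs)) S)) (trans (∑-comm S xs _) (∑-cong xs (λ {y} _ → sym (#-∑ (both? x y) S)))) ⟩
      # (some? (x ∷ xs)) S + ∑ xs (λ y → # (both? x y) S) ∎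
      where open ℕ.≤-Reasoning

-- The four directions and the attack relation

data Direction : Set where
  row col diagonal antidiagonal : Direction

Same : Direction → Point → Point → Set
Same row p q = proj₁ p ≡ proj₁ q
Same col p q = proj₂ p ≡ proj₂ q
Same diagonal p q = SameD p q
Same antidiagonal p q = SameE p q

same? : ∀ τ p q → Dec (Same τ p q)
same? row p q = proj₁ p ≟ proj₁ q
same? col p q = proj₂ p ≟ proj₂ q
same? diagonal (x , y) (u , v) = x + v ≟ u + y
same? antidiagonal (x , y) (u , v) = x + y ≟ u + v

same-refl : ∀ τ {p} → Same τ p p
same-refl row = refl
same-refl col = refl
same-refl diagonal = refl
same-refl antidiagonal = refl

same-sym : ∀ τ {p q} → Same τ p q → Same τ q p
same-sym row = sym
same-sym col = sym
same-sym diagonal = sym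
same-sym antidiagonal = sym

same-trans : ∀ τ p q r → Same τ p q → Same τ q r → Same τ p r
same-trans row _ _ _ = trans
same-trans col _ _ _ = trans
same-trans diagonal p q r s t = sameD-trans p r q s (sym t)
same-trans antidiagonal _ _ _ = trans

meet : ∀ τ σ → τ ≢ σ → ∀ p q → Same τ p q → Same σ p q → p ≡ q
meet row row ne _ _ _ _ = contradiction refl ne
meet col col ne _ _ _ _ = contradiction refl ne
meet diagonal diagonal ne _ _ _ _ = contradiction refl ne
meet antidiagonal antidiagonal ne _ _ _ _ = contradiction refl ne
meet row col _ _ _ refl refl = refl
meet row diagonal _ (x , _) _ refl e = cong (x ,_) (sym (ℕ.+-cancelˡ-≡ x _ _ e))
meet row antidiagonal _ (x , _) _ refl e = cong (x ,_) (ℕ.+-cancelˡ-≡ x _ _ e)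
meet col diagonal _ (_ , y) _ refl e = cong (_, y) (ℕ.+-cancelʳ-≡ y _ _ e)
meet col antidiagonal _ (_ , y) _ refl e = cong (_, y) (ℕ.+-cancelʳ-≡ y _ _ e)
meet diagonal antidiagonal _ (x , y) (u , v) d e = cong₂ _,_
  (linarith 4 (λ x y u v → x ⊕ v ≐ u ⊕ y ⇒ x ⊕ y ≐ u ⊕ v ⇒ ⊢ x ≐ u) x y u v d e)
  (linarith 4 (λ x y u v → x ⊕ v ≐ u ⊕ y ⇒ x ⊕ y ≐ u ⊕ v ⇒ ⊢ y ≐ v) x y u v d e)
meet col row _ _ _ refl refl = refl
meet diagonal row _ (x , _) _ e refl = cong (x ,_) (sym (ℕ.+-cancelˡ-≡ x _ _ e))
meet antidiagonal row _ (x , _) _ e refl = cong (x ,_) (ℕ.+-cancelˡ-≡ x _ _ e)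
meet diagonal col _ (_ , y) _ e refl = cong (_, y) (ℕ.+-cancelʳ-≡ y _ _ e)
meet antidiagonal col _ (_ , y) _ e refl = cong (_, y) (ℕ.+-cancelʳ-≡ y _ _ e)
meet antidiagonal diagonal _ (x , y) (u , v) e d = cong₂ _,_
  (linarith 4 (λ x y u v → x ⊕ v ≐ u ⊕ y ⇒ x ⊕ y ≐ u ⊕ v ⇒ ⊢ x ≐ u) x y u v d e)
  (linarith 4 (λ x y u v → x ⊕ v ≐ u ⊕ y ⇒ x ⊕ y ≐ u ⊕ v ⇒ ⊢ y ≐ v) x y u v d e)

pt : ∀ {n} → Square n → Point
pt (r , c) = toℕ r , toℕ c

pt-injective : ∀ {n} {s s′ : Square n} → pt s ≡ pt s′ → s ≡ s′
pt-injective e = cong₂ _,_ (toℕ-injective (cong proj₁ e)) (toℕ-injective (cong proj₂ e))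

square : ∀ {n x y} → x < n → y < n → Square n
square x< y< = fromℕ< x< , fromℕ< y<

pt-square : ∀ {n x y} (x< : x < n) (y< : y < n) → pt (square x< y<) ≡ (x , y)
pt-square x< y< = cong₂ _,_ (toℕ-fromℕ< x<) (toℕ-fromℕ< y<)

allSquares-complete : ∀ {n} (s : Square n) → s ∈ allSquares n
allSquares-complete (r , c) = ∈-cartesianProduct⁺ (∈-allFin r) (∈-allFin c)

allSquares-unique : ∀ n → Unique (allSquares n)
allSquares-unique n = Unique.cartesianProduct⁺ (Unique.allFin⁺ n) (Unique.allFin⁺ n)

attacks⁺ : ∀ τ {n} (q s : Square n) → Same τ (pt q) (pt s) → T (attacks q s)
attacks⁺ row q s e = Equivalence.from T-∨ (inj₁ (ℕ.≡⇒≡ᵇ _ _ e))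
attacks⁺ col (r , c) (r′ , c′) e = Equivalence.from (T-∨ {toℕ r Data.Nat.≡ᵇ toℕ r′}) (inj₂
  (Equivalence.from T-∨ (inj₁ (ℕ.≡⇒≡ᵇ _ _ e))))
attacks⁺ antidiagonal (r , c) (r′ , c′) e = Equivalence.from (T-∨ {toℕ r Data.Nat.≡ᵇ toℕ r′}) (inj₂
  (Equivalence.from (T-∨ {toℕ c Data.Nat.≡ᵇ toℕ c′}) (inj₂ (Equivalence.from T-∨ (inj₁ (ℕ.≡⇒≡ᵇ _ _ e))))))
attacks⁺ diagonal (r , c) (r′ , c′) e = Equivalence.from (T-∨ {toℕ r Data.Nat.≡ᵇ toℕ r′}) (inj₂
  (Equivalence.from (T-∨ {toℕ c Data.Nat.≡ᵇ toℕ c′}) (inj₂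
  (Equivalence.from (T-∨ {toℕ r + toℕ c Data.Nat.≡ᵇ toℕ r′ + toℕ c′}) (inj₂ (ℕ.≡⇒≡ᵇ _ _ e))))))

attacks⁻ : ∀ {n} (q s : Square n) → T (attacks q s) → ∃ λ τ → Same τ (pt q) (pt s)
attacks⁻ (r , c) (r′ , c′) t with Equivalence.to (T-∨ {toℕ r Data.Nat.≡ᵇ toℕ r′}) t
... | inj₁ e = row , ℕ.≡ᵇ⇒≡ _ _ e
... | inj₂ t with Equivalence.to (T-∨ {toℕ c Data.Nat.≡ᵇ toℕ c′}) t
... | inj₁ e = col , ℕ.≡ᵇ⇒≡ _ _ e
... | inj₂ t with Equivalence.to (T-∨ {toℕ r + toℕ c Data.Nat.≡ᵇ toℕ r′ + toℕ c′}) t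
... | inj₁ e = antidiagonal , ℕ.≡ᵇ⇒≡ _ _ e
... | inj₂ e = diagonal , ℕ.≡ᵇ⇒≡ _ _ e

attacked? : ∀ {n} (qs : List (Square n)) → Decidable (λ s → T (any (λ q → attacks q s) qs))
attacked? qs s = T? (any (λ q → attacks q s) qs)

attackedCount≡ : ∀ {n} (qs : List (Square n)) → attackedCount qs ≡ # (attacked? qs) (allSquares n)
attackedCount≡ {n} qs = go (allSquares n)
  where
  go : ∀ xs → count (λ s → any (λ q → attacks q s) qs) xs ≡ # (attacked? qs) xs
  go [] = refl
  go (s ∷ xs) with any (λ q → attacks q s) qs
  ... | true = cong suc (go xs)
  ... | false = go xs

#-≤1 : ∀ {A : Set} {P : A → Set} (P? : Decidable P) {xs} → Unique xs → (∀ {x y} → P x → P y → x ≡ y) → # P? xs ≤ 1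
#-≤1 {P = P} P? {xs} u h = pigeonhole (λ _ (_ : ⊤) → ⊤) {ks = tt ∷ []} (Unique.filter⁺ P? u) (λ _ → here tt)
  (λ p q _ _ → h (proj₂ (∈-filter⁻ P? {xs = xs} p)) (proj₂ (∈-filter⁻ P? {xs = xs} q)))

#-mono : ∀ {A : Set} {P R : A → Set} (P? : Decidable P) (R? : Decidable R) xs → (∀ {x} → x ∈ xs → P x → R x) → # P? xs ≤ # R? xs
#-mono P? R? xs h rewrite #-∑ P? xs | #-∑ R? xs = ∑-≤ xs λ {x} x∈ → 𝟙-≤ (P? x) (𝟙-≥ (R? x) ∘ h x∈)

module Board (N : ℕ) where

  -- For a threshold 0 ≤ δ ≤ N the diagonals at distance at most δ from the main diagonal and the
  -- antidiagonals at distance at most N − δ from the main antidiagonal together cover the board.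
  κ : Direction → Point → ℕ
  κ row _ = 0
  κ col _ = 0
  κ diagonal (x , y) = ∣ x - y ∣
  κ antidiagonal (x , y) = ∣ x + y - N ∣

  threshold : Direction → ℕ → ℕ
  threshold row _ = 0
  threshold col _ = 0
  threshold diagonal δ = δ
  threshold antidiagonal δ = N ∸ δ

  good? : ∀ τ δ → Decidable (λ p → κ τ p ≤ threshold τ δ)
  good? τ δ p = κ τ p ≤? threshold τ δ

  line? : ∀ τ p → Decidable (λ (s : Square (suc N)) → Same τ p (pt s))
  line? τ p s = same? τ p (pt s)

  -- Each threshold is sent to a square of the line; `R δ q` ties a coordinate of q to δ, which
  -- makes the assignment injective.
  length-from : ∀ τ p (R : ℕ → Point → Set) → (∀ {δ δ′ q} → R δ q → R δ′ q → δ ≡ δ′) →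
    (∀ δ → δ ≤ N → κ τ p ≤ threshold τ δ → ∃ λ q → (proj₁ q ≤ N × proj₂ q ≤ N) × R δ q × Same τ p q) →
    # (λ δ → good? τ δ p) (upTo (suc N)) ≤ # (line? τ p) (allSquares (suc N))
  length-from τ p R R-inj wit = pigeonhole (λ δ s → R δ (pt s)) (Unique.filter⁺ (λ δ → good? τ δ p) (Unique.upTo⁺ (suc N)))
    hit (λ _ _ → R-inj)
    where
    hit : ∀ {δ} → δ ∈ filter (λ δ → good? τ δ p) (upTo (suc N)) → Any (λ s → R δ (pt s)) (filter (line? τ p) (allSquares (suc N)))
    hit {δ} δ∈ with ∈-filter⁻ (λ δ → good? τ δ p) δ∈
    ... | δ∈ , g with wit δ (ℕ.≤-pred (∈-upTo⁻ δ∈)) g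
    ... | q , (x≤ , y≤) , r , s with pt-square (s≤s x≤) (s≤s y≤)
    ... | e = lose (∈-filter⁺ (line? τ p) (allSquares-complete (square (s≤s x≤) (s≤s y≤))) (subst (Same τ p) (sym e) s)) (subst (R δ) (sym e) r)

  -- A diagonal at distance d from the main one counts from δ = d on, an antidiagonal at distance d
  -- up to δ = N - d. For these δ its square with a suitable coordinate equal to δ or N - δ is on
  -- the board. This turns the sum over thresholds into a total length.
  line-length : ∀ τ x y → x ≤ N → y ≤ N →
    # (λ δ → good? τ δ (x , y)) (upTo (suc N)) ≤ # (line? τ (x , y)) (allSquares (suc N))
  line-length row x y x≤ y≤ = length-from row (x , y) (λ δ q → proj₂ q ≡ δ) (λ e f → trans (sym e) f)
    (λ δ δ≤ _ → (x , δ) , (x≤ , δ≤) , refl , refl)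
  line-length col x y x≤ y≤ = length-from col (x , y) (λ δ q → proj₁ q ≡ δ) (λ e f → trans (sym e) f)
    (λ δ δ≤ _ → (δ , y) , (δ≤ , y≤) , refl , refl)
  line-length diagonal x y x≤ y≤ with ℕ.≤-total x y
  ... | inj₁ x≤y = length-from diagonal (x , y) (λ δ q → proj₂ q ≡ δ) (λ e f → trans (sym e) f) λ δ δ≤ g →
    let d = ∣ x - y ∣
        d≡ : d ≡ y ∸ x
        d≡ = ℕ.m≤n⇒∣m-n∣≡n∸m x≤y
        e : x + d ≡ y
        e = trans (cong (x +_) d≡) (ℕ.m+[n∸m]≡n x≤y)
        f : d + (δ ∸ d) ≡ δ
        f = ℕ.m+[n∸m]≡n g
    in (δ ∸ d , δ) , (ℕ.≤-trans (ℕ.m∸n≤m δ d) δ≤ , δ≤) , refl ,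
      linarith 5 (λ x y d δ e → x ⊕ d ≐ y ⇒ d ⊕ e ≐ δ ⇒ ⊢ x ⊕ δ ≐ e ⊕ y) x y d δ (δ ∸ d) e f
  ... | inj₂ y≤x = length-from diagonal (x , y) (λ δ q → proj₁ q ≡ δ) (λ e f → trans (sym e) f) λ δ δ≤ g →
    let d = ∣ x - y ∣
        e : y + d ≡ x
        e = trans (cong (y +_) (ℕ.m≤n⇒∣n-m∣≡n∸m y≤x)) (ℕ.m+[n∸m]≡n y≤x)
        f : d + (δ ∸ d) ≡ δ
        f = ℕ.m+[n∸m]≡n g
    in (δ , δ ∸ d) , (δ≤ , ℕ.≤-trans (ℕ.m∸n≤m δ d) δ≤) , refl ,
      linarith 5 (λ x y d δ e → y ⊕ d ≐ x ⇒ d ⊕ e ≐ δ ⇒ ⊢ x ⊕ e ≐ δ ⊕ y) x y d δ (δ ∸ d) e f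
  line-length antidiagonal x y x≤ y≤ with ℕ.≤-total (x + y) N
  ... | inj₁ s≤N = length-from antidiagonal (x , y) (λ δ q → proj₁ q ≡ δ) (λ e f → trans (sym e) f) λ δ δ≤ g →
    let d = ∣ x + y - N ∣
        e : x + y + d ≡ N
        e = trans (cong (x + y +_) (ℕ.m≤n⇒∣m-n∣≡n∸m s≤N)) (ℕ.m+[n∸m]≡n s≤N)
        δ≤s : δ ≤ x + y
        δ≤s = linarith 6 (λ x y d N δ e → x ⊕ y ⊕ d ≐ N ⇒ d ≼ e ⇒ δ ⊕ e ≐ N ⇒ ⊢ δ ≼ x ⊕ y) x y d N δ (N ∸ δ) e g (ℕ.m+[n∸m]≡n δ≤)
    in (δ , x + y ∸ δ) , (δ≤ , ℕ.≤-trans (ℕ.m∸n≤m (x + y) δ) s≤N) , refl , sym (ℕ.m+[n∸m]≡n δ≤s)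
  ... | inj₂ N≤s = length-from antidiagonal (x , y) (λ δ q → proj₁ q + δ ≡ N) (λ e f → ℕ.+-cancelˡ-≡ _ _ _ (trans e (sym f))) λ δ δ≤ g →
    let d = ∣ x + y - N ∣
        e : N + d ≡ x + y
        e = trans (cong (N +_) (ℕ.m≤n⇒∣n-m∣≡n∸m N≤s)) (ℕ.m+[n∸m]≡n N≤s)
    in (N ∸ δ , d + δ) , (ℕ.m∸n≤m N δ , linarith 4 (λ d δ N e → d ≼ e ⇒ δ ⊕ e ≐ N ⇒ ⊢ d ⊕ δ ≼ N) d δ N (N ∸ δ) g (ℕ.m+[n∸m]≡n δ≤))
      , ℕ.m∸n+n≡m δ≤ ,
      linarith 6 (λ x y d N δ e → N ⊕ d ≐ x ⊕ y ⇒ δ ⊕ e ≐ N ⇒ ⊢ x ⊕ y ≐ e ⊕ (d ⊕ δ)) x y d N δ (N ∸ δ) e (ℕ.m+[n∸m]≡n δ≤)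

near-diagonal⁺ : ∀ x y {δ} → x ≤ y + δ → y ≤ x + δ → ∣ x - y ∣ ≤ δ
near-diagonal⁺ x y {δ} p q with ℕ.≤-total x y
... | inj₁ x≤y = subst (_≤ δ) (sym (ℕ.m≤n⇒∣m-n∣≡n∸m x≤y)) (ℕ.m≤n+o⇒m∸n≤o y x q)
... | inj₂ y≤x = subst (_≤ δ) (sym (ℕ.m≤n⇒∣n-m∣≡n∸m y≤x)) (ℕ.m≤n+o⇒m∸n≤o x y p)

∑-++ : ∀ {A : Set} (xs ys : List A) f → ∑ (xs ++ ys) f ≡ ∑ xs f + ∑ ys f
∑-++ [] ys f = refl
∑-++ (x ∷ xs) ys f = trans (cong (f x +_) (∑-++ xs ys f)) (sym (ℕ.+-assoc (f x) _ _))

∑-map : ∀ {A B : Set} (g : A → B) xs f → ∑ (map g xs) f ≡ ∑ xs (f ∘ g)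
∑-map g [] f = refl
∑-map g (x ∷ xs) f = cong (f (g x) +_) (∑-map g xs f)

-- The lower bound: summation over the thresholds

module Covering (N m : ℕ) (qs : List (Square (suc N))) (qs-unique : Unique qs) (0<k : 0 < length qs)
  (minimal : ∀ m′ → 0 < m′ → m′ < m → G m′ < length qs) where
  open Board N

  Q : List Point
  Q = map pt qs

  Q-unique : Unique Q
  Q-unique = Unique.map⁺ pt-injective qs-unique

  on-board : ∀ {p} → p ∈ Q → proj₁ p ≤ N × proj₂ p ≤ N
  on-board p∈ with ∈-map⁻ pt p∈
  ... | (r , c) , _ , refl = ℕ.≤-pred (toℕ<n r) , ℕ.≤-pred (toℕ<n c)

  reps : Direction → List Point
  reps τ = representatives (same? τ) Q

  reps-⊆ : ∀ τ {p} → p ∈ reps τ → p ∈ Q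
  reps-⊆ τ = Representatives.rep-⊆ (same? τ) (same-refl τ) Q
  reps-hit : ∀ τ {p} → p ∈ Q → Any (Same τ p) (reps τ)
  reps-hit τ = Representatives.rep-hit (same? τ) (same-refl τ) Q
  reps-apart : ∀ τ → AllPairs (λ p q → ¬ Same τ p q) (reps τ)
  reps-apart τ = Representatives.rep-apart (same? τ) (same-refl τ) Q

  module Threshold (δ : ℕ) (δ≤N : δ ≤ N) where
    ε = N ∸ δ
    δ+ε : δ + ε ≡ N
    δ+ε = ℕ.m+[n∸m]≡n δ≤N

    LD LE : List Point
    LD = filter (good? diagonal δ) (reps diagonal)
    LE = filter (good? antidiagonal δ) (reps antidiagonal)

    open Strips δ ε LD LE

    placement : Placement
    placement = record
      { A = map proj₁ (reps row) ; B = map proj₂ (reps col) ; Q = Q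
      ; A-unique = AllPairs.map⁺ (reps-apart row)
      ; B-unique = AllPairs.map⁺ (reps-apart col)
      ; Q-unique = Q-unique
      ; on = λ {p} p∈ → row∈ {p} (find (reps-hit row p∈)) , col∈ {p} (find (reps-hit col p∈)) }
      where
      row∈ : ∀ {p} → ∃ (λ r → r ∈ reps row × Same row p r) → proj₁ p ∈ map proj₁ (reps row)
      row∈ (r , r∈ , refl) = ∈-map⁺ proj₁ r∈
      col∈ : ∀ {p} → ∃ (λ r → r ∈ reps col × Same col p r) → proj₂ p ∈ map proj₂ (reps col)
      col∈ (r , r∈ , refl) = ∈-map⁺ proj₂ r∈

    near-D : ∀ x y u v → Dg (x , y) → SameD (x , y) (u , v) → ∣ u - v ∣ ≤ δ
    near-D x y u v (p , q) e = near-diagonal⁺ u v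
      (linarith 5 (λ x y u v δ → x ≼ y ⊕ δ ⇒ x ⊕ v ≐ u ⊕ y ⇒ ⊢ u ≼ v ⊕ δ) x y u v δ p e)
      (linarith 5 (λ x y u v δ → y ≼ x ⊕ δ ⇒ x ⊕ v ≐ u ⊕ y ⇒ ⊢ v ≼ u ⊕ δ) x y u v δ q e)
    near-E : ∀ x y u v → Eg (x , y) → SameE (x , y) (u , v) → ∣ u + v - N ∣ ≤ N ∸ δ
    near-E x y u v (p , q) e = near-diagonal⁺ (u + v) N
      (linarith 5 (λ s t δ ε N → s ≼ δ ⊕ 2 ⊙ ε ⇒ s ≐ t ⇒ δ ⊕ ε ≐ N ⇒ ⊢ t ≼ N ⊕ ε) (x + y) (u + v) δ ε N q e δ+ε)
      (linarith 5 (λ s t δ ε N → δ ≼ s ⇒ s ≐ t ⇒ δ ⊕ ε ≐ N ⇒ ⊢ N ≼ t ⊕ ε) (x + y) (u + v) δ ε N p e δ+ε)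

    -- |x − y| > δ and |x + y − N| > ε would force |x − y| + |x + y − N| > N, off the board.
    good : ∀ x y → x ≤ N → y ≤ N → Dg (x , y) ⊎ Eg (x , y)
    good x y x≤ y≤ with x ≤? y + δ | y ≤? x + δ
    ... | yes p | yes q = inj₁ (p , q)
    ... | no p | _ = inj₂
      ( linarith 3 (λ x y δ → y ⊕ δ ≺ x ⇒ ⊢ δ ≼ x ⊕ y) x y δ (ℕ.≰⇒> p)
      , linarith 5 (λ x y δ ε N → y ⊕ δ ≺ x ⇒ x ≼ N ⇒ δ ⊕ ε ≐ N ⇒ ⊢ x ⊕ y ≼ δ ⊕ 2 ⊙ ε) x y δ ε N (ℕ.≰⇒> p) x≤ δ+ε )
    ... | yes _ | no q = inj₂
      ( linarith 3 (λ x y δ → x ⊕ δ ≺ y ⇒ ⊢ δ ≼ x ⊕ y) x y δ (ℕ.≰⇒> q)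
      , linarith 5 (λ x y δ ε N → x ⊕ δ ≺ y ⇒ y ≼ N ⇒ δ ⊕ ε ≐ N ⇒ ⊢ x ⊕ y ≼ δ ⊕ 2 ⊙ ε) x y δ ε N (ℕ.≰⇒> q) y≤ δ+ε )

    covered : Covered Q
    covered = record
      { good = λ {p} p∈ → good (proj₁ p) (proj₂ p) (proj₁ (on-board p∈)) (proj₂ (on-board p∈))
      ; onD = λ {p} p∈ d → onD p d (find (reps-hit diagonal p∈))
      ; onE = λ {p} p∈ e → onE p e (find (reps-hit antidiagonal p∈)) }
      where
      onD : ∀ p → Dg p → ∃ (λ r → r ∈ reps diagonal × SameD p r) → Any (SameD p) LD
      onD (x , y) d ((u , v) , r∈ , s) = lose (∈-filter⁺ (good? diagonal δ) r∈ (near-D x y u v d s)) s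
      onE : ∀ p → Eg p → ∃ (λ r → r ∈ reps antidiagonal × SameE p r) → Any (SameE p) LE
      onE (x , y) d ((u , v) , r∈ , s) = lose (∈-filter⁺ (good? antidiagonal δ) r∈ (near-E x y u v d s)) s

    -- With fewer than m lines, k ≤ G of their number would contradict the minimality of m.
    -- Minimality speaks of positive numbers only, hence `nonzero`: there is a queen, and it
    -- occupies a row.
    lines≥ : m ≤ length (reps row) + length (reps col) + (length LD + length LE)
    lines≥ = ℕ.≮⇒≥ λ small → ℕ.<⇒≱ (minimal w nonzero small) (subst (_≤ G w) (length-map pt qs)
      (subst (λ l → length Q ≤ G (l + (length LD + length LE)))
        (cong₂ _+_ (length-map proj₁ (reps row)) (length-map proj₂ (reps col))) (Count≤G.size≤G δ ε LD LE placement covered)))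
      where
      w = length (reps row) + length (reps col) + (length LD + length LE)
      nonempty : ∀ {R : Point → Set} {xs} → Any R xs → 0 < length xs
      nonempty (here _) = s≤s z≤n
      nonempty (there _) = s≤s z≤n
      nonzero : 0 < w
      nonzero = go qs 0<k (λ p → reps-hit row (∈-map⁺ pt p))
        where
        go : ∀ xs → 0 < length xs → (∀ {s} → s ∈ xs → Any (Same row (pt s)) (reps row)) → 0 < w
        go (s ∷ _) _ h = ℕ.≤-trans (nonempty (h (here refl))) (ℕ.≤-trans (ℕ.m≤m+n _ (length (reps col))) (ℕ.m≤m+n _ _))

  chosen : Direction → List Point
  chosen τ = Selection.chosen (select (λ {p} {q} → same-sym τ {p} {q}) (κ τ) m (reps-apart τ))

  module Chosen (τ : Direction) = Selection (select (λ {p} {q} → same-sym τ {p} {q}) (κ τ) m (reps-apart τ))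

  weight : Direction → ℕ → ℕ
  weight τ δ = # (good? τ δ) (chosen τ)

  total : ℕ → ℕ
  total δ = weight row δ + (weight col δ + (weight diagonal δ + weight antidiagonal δ))

  -- If m chosen lines of one direction are good, these suffice; otherwise the restriction to m
  -- lines has lost no good line of any direction.
  total≥ : ∀ δ → δ ≤ N → m ≤ total δ
  total≥ δ δ≤N with Chosen.enough row (threshold row δ) | Chosen.enough col (threshold col δ)
    | Chosen.enough diagonal (threshold diagonal δ) | Chosen.enough antidiagonal (threshold antidiagonal δ)
  ... | inj₁ p | _ | _ | _ = ℕ.≤-trans p (ℕ.m≤m+n _ _)
  ... | inj₂ _ | inj₁ p | _ | _ = ℕ.≤-trans p (ℕ.≤-trans (ℕ.m≤m+n _ _) (ℕ.m≤n+m _ (weight row δ)))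
  ... | inj₂ _ | inj₂ _ | inj₁ p | _ = ℕ.≤-trans p (ℕ.≤-trans (ℕ.m≤m+n _ _)
          (ℕ.≤-trans (ℕ.m≤n+m _ (weight col δ)) (ℕ.m≤n+m _ (weight row δ))))
  ... | inj₂ _ | inj₂ _ | inj₂ _ | inj₁ p = ℕ.≤-trans p (ℕ.≤-trans (ℕ.m≤n+m _ (weight diagonal δ))
          (ℕ.≤-trans (ℕ.m≤n+m _ (weight col δ)) (ℕ.m≤n+m _ (weight row δ))))
  ... | inj₂ r | inj₂ c | inj₂ d | inj₂ e = ℕ.≤-trans (Threshold.lines≥ δ δ≤N) (subst (_≤ total δ) (sym (ℕ.+-assoc (length (reps row)) _ _))
          (ℕ.+-mono-≤ (subst (_≤ weight row δ) (all row (λ _ → z≤n)) r) (ℕ.+-mono-≤ (subst (_≤ weight col δ) (all col (λ _ → z≤n)) c) (ℕ.+-mono-≤ d e))))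
    where
    all : ∀ τ → (∀ p → κ τ p ≤ threshold τ δ) → # (good? τ δ) (reps τ) ≡ length (reps τ)
    all τ h = cong length (filter-all (good? τ δ) {xs = reps τ} (All.tabulate λ {p} _ → h p))

  Line : Set
  Line = Direction × Point

  tagged : Direction → List Line
  tagged τ = map (τ ,_) (chosen τ)

  lines₂ lines₁ lines : List Line
  lines₂ = tagged diagonal ++ tagged antidiagonal
  lines₁ = tagged col ++ lines₂
  lines = tagged row ++ lines₁

  On : Line → Square (suc N) → Set
  On (τ , p) s = Same τ p (pt s)
  on? : ∀ ℓ → Decidable (On ℓ)
  on? (τ , p) = line? τ p

  S : List (Square (suc N))
  S = allSquares (suc N)

  open Union on? S

  Few : Line → Line → Set
  Few ℓ ℓ′ = # (both? ℓ ℓ′) S ≤ 1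

  few-parallel : ∀ τ → AllPairs Few (tagged τ)
  few-parallel τ = AllPairs.map⁺ (AllPairs.map (λ {p} {q} ¬s → subst (_≤ 1)
    (sym (#-none (both? (τ , p) (τ , q)) {xs = S} (All.tabulate λ {s} _ (a , b) → ¬s (same-trans τ p (pt s) q a (same-sym τ {q} {pt s} b)))))
    z≤n) (Chosen.apart τ))

  few-crossing : ∀ τ σ → τ ≢ σ → ∀ p q → Few (τ , p) (σ , q)
  few-crossing τ σ ne p q = #-≤1 (both? (τ , p) (σ , q)) {xs = S} (allSquares-unique (suc N)) λ {s} {s′} (a , b) (a′ , b′) →
    pt-injective (meet τ σ ne (pt s) (pt s′) (same-trans τ (pt s) p (pt s′) (same-sym τ {p} {pt s} a) a′)
      (same-trans σ (pt s) q (pt s′) (same-sym σ {q} {pt s} b) b′))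

  cross : ∀ τ {ℓs} → All (λ ℓ → τ ≢ proj₁ ℓ) ℓs → All (λ ℓ → All (Few ℓ) ℓs) (tagged τ)
  cross τ ne = All.map⁺ (All.tabulate λ {p} _ → All.map (λ {ℓ} n → few-crossing τ (proj₁ ℓ) n p (proj₂ ℓ)) ne)

  other : ∀ τ σ → τ ≢ σ → All (λ ℓ → τ ≢ proj₁ ℓ) (tagged σ)
  other τ σ ne = All.map⁺ (All.tabulate λ _ → ne)

  lines-few : AllPairs Few lines
  lines-few = AllPairs.++⁺ (few-parallel row) (AllPairs.++⁺ (few-parallel col) (AllPairs.++⁺ (few-parallel diagonal) (few-parallel antidiagonal)
      (cross diagonal (other diagonal antidiagonal λ ())))
      (cross col (All.++⁺ (other col diagonal λ ()) (other col antidiagonal λ ()))))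
      (cross row (All.++⁺ (other row col λ ()) (All.++⁺ (other row diagonal λ ()) (other row antidiagonal λ ()))))

  length-lines : length lines ≤ 4 * m
  length-lines = subst (_≤ 4 * m) (sym eq) (linarith 5 (λ a b c d m → a ≼ m ⇒ b ≼ m ⇒ c ≼ m ⇒ d ≼ m ⇒ ⊢ a ⊕ (b ⊕ (c ⊕ d)) ≼ 4 ⊙ m)
    (length (chosen row)) (length (chosen col)) (length (chosen diagonal)) (length (chosen antidiagonal)) m
    (Chosen.few row) (Chosen.few col) (Chosen.few diagonal) (Chosen.few antidiagonal))
    where
    part : ∀ τ → length (tagged τ) ≡ length (chosen τ)
    part τ = length-map (τ ,_) (chosen τ)
    eq : length lines ≡ length (chosen row) + (length (chosen col) + (length (chosen diagonal) + length (chosen antidiagonal)))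
    eq = trans (length-++ (tagged row) {lines₁}) (cong₂ _+_ (part row)
      (trans (length-++ (tagged col) {lines₂}) (cong₂ _+_ (part col)
      (trans (length-++ (tagged diagonal) {tagged antidiagonal}) (cong₂ _+_ (part diagonal) (part antidiagonal))))))

  T-δ : List ℕ
  T-δ = upTo (suc N)

  lengths : ∀ τ → ∑ T-δ (weight τ) ≤ ∑ (tagged τ) (λ ℓ → # (on? ℓ) S)
  lengths τ = begin
    ∑ T-δ (weight τ) ≡⟨ ∑-cong T-δ (λ {δ} _ → #-∑ (good? τ δ) (chosen τ)) ⟩
    ∑ T-δ (λ δ → ∑ (chosen τ) (λ p → 𝟙 (good? τ δ p))) ≡⟨ ∑-comm T-δ (chosen τ) _ ⟩
    ∑ (chosen τ) (λ p → ∑ T-δ (λ δ → 𝟙 (good? τ δ p)))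
      ≤⟨ ∑-≤ (chosen τ) (λ {p} p∈ → subst (_≤ # (line? τ p) S) (#-∑ (λ δ → good? τ δ p) T-δ)
          (let x≤ , y≤ = on-board (reps-⊆ τ (Chosen.⊆L τ p∈)) in line-length τ (proj₁ p) (proj₂ p) x≤ y≤)) ⟩
    ∑ (chosen τ) (λ p → # (line? τ p) S) ≡⟨ sym (∑-map (τ ,_) (chosen τ) _) ⟩
    ∑ (tagged τ) (λ ℓ → # (on? ℓ) S) ∎
    where open ℕ.≤-Reasoning

  sum≥ : suc N * m ≤ ∑ lines (λ ℓ → # (on? ℓ) S)
  sum≥ = begin
    suc N * m ≡⟨ cong (_* m) (sym (length-upTo (suc N))) ⟩
    length T-δ * m ≡⟨ sym (∑-const T-δ m) ⟩
    ∑ T-δ (λ _ → m) ≤⟨ ∑-≤ T-δ (λ {δ} δ∈ → total≥ δ (ℕ.≤-pred (∈-upTo⁻ δ∈))) ⟩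
    ∑ T-δ total ≡⟨ trans (∑-+ T-δ (weight row) _) (cong (∑ T-δ (weight row) +_)
        (trans (∑-+ T-δ (weight col) _) (cong (∑ T-δ (weight col) +_) (∑-+ T-δ (weight diagonal) (weight antidiagonal))))) ⟩
    ∑ T-δ (weight row) + (∑ T-δ (weight col) + (∑ T-δ (weight diagonal) + ∑ T-δ (weight antidiagonal)))
      ≤⟨ ℕ.+-mono-≤ (lengths row) (ℕ.+-mono-≤ (lengths col) (ℕ.+-mono-≤ (lengths diagonal) (lengths antidiagonal))) ⟩
    ∑ M₁ f + (∑ M₂ f + (∑ M₃ f + ∑ M₄ f)) ≡⟨ sym (trans (∑-++ M₁ _ f) (cong (∑ M₁ f +_) (trans (∑-++ M₂ _ f) (cong (∑ M₂ f +_) (∑-++ M₃ M₄ f))))) ⟩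
    ∑ lines f ∎
    where
    open ℕ.≤-Reasoning
    f = λ ℓ → # (on? ℓ) S
    M₁ = tagged row
    M₂ = tagged col
    M₃ = tagged diagonal
    M₄ = tagged antidiagonal

  hit⇒attacked : ∀ {s} → Any (λ ℓ → On ℓ s) lines → T (any (λ q → attacks q s) qs)
  hit⇒attacked {s} h = any⁺ (λ q → attacks q s) (go (find h))
    where
    member : ∀ {ℓ} → ℓ ∈ lines → proj₂ ℓ ∈ Q
    member {ℓ} ℓ∈ = split (∈-++⁻ (tagged row) ℓ∈)
      where
      one : ∀ τ {ℓ} → ℓ ∈ tagged τ → proj₂ ℓ ∈ Q
      one τ ℓ∈ with ∈-map⁻ (τ ,_) ℓ∈
      ... | p , p∈ , refl = reps-⊆ τ (Chosen.⊆L τ p∈)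
      split₃ : ∀ {ℓ} → ℓ ∈ tagged diagonal ⊎ ℓ ∈ tagged antidiagonal → proj₂ ℓ ∈ Q
      split₃ (inj₁ ℓ∈) = one diagonal ℓ∈
      split₃ (inj₂ ℓ∈) = one antidiagonal ℓ∈
      split₂ : ∀ {ℓ} → ℓ ∈ tagged col ⊎ ℓ ∈ lines₂ → proj₂ ℓ ∈ Q
      split₂ (inj₁ ℓ∈) = one col ℓ∈
      split₂ (inj₂ ℓ∈) = split₃ (∈-++⁻ (tagged diagonal) ℓ∈)
      split : ∀ {ℓ} → ℓ ∈ tagged row ⊎ ℓ ∈ lines₁ → proj₂ ℓ ∈ Q
      split (inj₁ ℓ∈) = one row ℓ∈
      split (inj₂ ℓ∈) = split₂ (∈-++⁻ (tagged col) ℓ∈)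
    go : ∃ (λ ℓ → ℓ ∈ lines × On ℓ s) → Any (T ∘ λ q → attacks q s) qs
    go ((τ , p) , ℓ∈ , e) with ∈-map⁻ pt (member ℓ∈)
    ... | q , q∈ , refl = lose q∈ (attacks⁺ τ q s e)

  attacked≥ : m * suc N ≤ attackedCount qs + 16 * (m * m)
  attacked≥ = begin
    m * suc N ≡⟨ ℕ.*-comm m (suc N) ⟩
    suc N * m ≤⟨ sum≥ ⟩
    ∑ lines (λ ℓ → # (on? ℓ) S) ≤⟨ union-≥ lines-few ⟩
    # (some? lines) S + length lines * length lines ≤⟨ ℕ.+-mono-≤ (#-mono (some? lines) (attacked? qs) S (λ _ → hit⇒attacked))
        (ℕ.*-mono-≤ length-lines length-lines) ⟩
    # (attacked? qs) S + 4 * m * (4 * m) ≡⟨ cong₂ _+_ (sym (attackedCount≡ qs)) (lemma m) ⟩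
    attackedCount qs + 16 * (m * m) ∎
    where
    open ℕ.≤-Reasoning
    lemma : ∀ m → 4 * m * (4 * m) ≡ 16 * (m * m)
    lemma = ℕ-solve-∀

-- Constructions

unique-map : ∀ {A B : Set} (f : A → B) {xs} → Unique xs → (∀ {x y} → x ∈ xs → y ∈ xs → f x ≡ f y → x ≡ y) → Unique (map f xs)
unique-map f [] inj = []
unique-map f (x∉ ∷ u) inj =
  All.map⁺ (All.tabulate λ y∈ e → All.lookup x∉ y∈ (inj (here refl) (there y∈) e))
  ∷ unique-map f u (λ p q → inj (there p) (there q))

∑-bound : ∀ {A : Set} (xs : List A) {f b} → (∀ {x} → x ∈ xs → f x ≤ b) → ∑ xs f ≤ length xs * b
∑-bound xs {f} {b} h = subst (∑ xs f ≤_) (∑-const xs b) (∑-≤ xs h)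

union-≤ : ∀ {X A : Set} {P : X → A → Set} (P? : ∀ x → Decidable (P x)) {U : A → Set} (U? : Decidable U) (S : List A) xs →
  (∀ {s} → s ∈ S → U s → Any (λ x → P x s) xs) → # U? S ≤ ∑ xs (λ x → # (P? x) S)
union-≤ {P = P} P? U? S xs h = begin
  # U? S ≡⟨ #-∑ U? S ⟩
  ∑ S (𝟙 ∘ U?) ≤⟨ ∑-≤ S (λ {s} s∈ → 𝟙-≤ (U? s) λ u → hit xs (h s∈ u)) ⟩
  ∑ S (λ s → ∑ xs (λ x → 𝟙 (P? x s))) ≡⟨ ∑-comm S xs _ ⟩
  ∑ xs (λ x → ∑ S (λ s → 𝟙 (P? x s))) ≡⟨ ∑-cong xs (λ {x} _ → sym (#-∑ (P? x) S)) ⟩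
  ∑ xs (λ x → # (P? x) S) ∎
  where
  open ℕ.≤-Reasoning
  hit : ∀ {s} ys → Any (λ x → P x s) ys → 1 ≤ ∑ ys (λ x → 𝟙 (P? x s))
  hit {s} (y ∷ ys) (here p) = ℕ.≤-trans (𝟙-≥ (P? y s) p) (ℕ.m≤m+n _ _)
  hit {s} (y ∷ ys) (there p) = ℕ.≤-trans (hit ys p) (ℕ.m≤n+m _ (𝟙 (P? y s)))

module Placing (N : ℕ) where
  open Board N using (line?)

  S : List (Square (suc N))
  S = allSquares (suc N)

  len : Direction → Point → ℕ
  len τ p = # (line? τ p) S

  -- A coordinate that is injective on each line of the given direction; line lengths are bounded by
  -- its range.
  rowLike : Direction → Point → ℕ
  rowLike row = proj₂
  rowLike _ = proj₁

  rowLike-inj : ∀ τ p q r → rowLike τ p ≡ rowLike τ q → Same τ r p → Same τ r q → p ≡ q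
  rowLike-inj row p q r e s t = meet row col (λ ()) p q (trans (sym s) t) e
  rowLike-inj col p q r e s t = meet row col (λ ()) p q e (trans (sym s) t)
  rowLike-inj diagonal p q r e s t = meet row diagonal (λ ()) p q e (same-trans diagonal p r q (same-sym diagonal {r} {p} s) t)
  rowLike-inj antidiagonal p q r e s t = meet row antidiagonal (λ ()) p q e (trans (sym s) t)

  len≤ : ∀ τ p a L → (∀ q → proj₁ q ≤ N → proj₂ q ≤ N → Same τ p q → a ≤ rowLike τ q × rowLike τ q < a + L) → len τ p ≤ L
  len≤ τ p a L h = subst (len τ p ≤_) (length-upTo L)
    (pigeonhole (λ s i → rowLike τ (pt s) ≡ a + i) {ks = upTo L} (Unique.filter⁺ (line? τ p) (allSquares-unique (suc N))) hit
      λ {s} {s′} s∈ s∈′ e f → pt-injective (rowLike-inj τ (pt s) (pt s′) p (trans e (sym f))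
        (proj₂ (∈-filter⁻ (line? τ p) {xs = S} s∈)) (proj₂ (∈-filter⁻ (line? τ p) {xs = S} s∈′))))
    where
    hit : ∀ {s} → s ∈ filter (line? τ p) S → Any (λ i → rowLike τ (pt s) ≡ a + i) (upTo L)
    hit {s} s∈ with ℕ.m≤n⇒∃[o]m+o≡n (proj₁ (range s∈)) | proj₂ (range s∈)
      where
      range : ∀ {s} → s ∈ filter (line? τ p) S → a ≤ rowLike τ (pt s) × rowLike τ (pt s) < a + L
      range {s} s∈ = h (pt s) (ℕ.≤-pred (toℕ<n (proj₁ s))) (ℕ.≤-pred (toℕ<n (proj₂ s))) (proj₂ (∈-filter⁻ (line? τ p) {xs = S} s∈))
    ... | i , e | lt = lose (∈-upTo⁺ (ℕ.+-cancelˡ-< a i L (subst (_< a + L) (sym e) lt))) (sym e)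

  len≤n : ∀ τ p → len τ p ≤ suc N
  len≤n τ p = len≤ τ p 0 (suc N) λ q x≤ y≤ _ → z≤n , s≤s (bound τ q x≤ y≤)
    where
    bound : ∀ τ q → proj₁ q ≤ N → proj₂ q ≤ N → rowLike τ q ≤ N
    bound row _ _ y≤ = y≤
    bound col _ x≤ _ = x≤
    bound diagonal _ x≤ _ = x≤
    bound antidiagonal _ x≤ _ = x≤

  short-topLeft : ∀ x y → len antidiagonal (x , y) ≤ suc (x + y)
  short-topLeft x y = len≤ antidiagonal (x , y) 0 (suc (x + y)) λ (u , v) _ _ e →
    z≤n , s≤s (subst (u ≤_) (sym e) (ℕ.m≤m+n u v))

  short-bottomRight : ∀ x y s → N + N ≤ x + y + s → len antidiagonal (x , y) ≤ suc s
  short-bottomRight x y s h = len≤ antidiagonal (x , y) (N ∸ s) (suc s) λ (u , v) u≤ v≤ e →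
    ℕ.m≤n+o⇒m∸n≤o N s (linarith 6 (λ x y s u v N → N ⊕ N ≼ x ⊕ y ⊕ s ⇒ v ≼ N ⇒ x ⊕ y ≐ u ⊕ v ⇒ ⊢ N ≼ s ⊕ u) x y s u v N h v≤ e)
    , subst (u <_) (sym (ℕ.+-suc (N ∸ s) s)) (s≤s (ℕ.≤-trans u≤ (subst (N ≤_) (ℕ.+-comm s (N ∸ s)) (ℕ.m≤n+m∸n N s))))

  short-bottomLeft : ∀ x y s → N + y ≤ x + s → len diagonal (x , y) ≤ suc s
  short-bottomLeft x y s h = len≤ diagonal (x , y) (N ∸ s) (suc s) λ (u , v) u≤ v≤ e →
    ℕ.m≤n+o⇒m∸n≤o N s (linarith 6 (λ x y s u v N → N ⊕ y ≼ x ⊕ s ⇒ x ⊕ v ≐ u ⊕ y ⇒ ⊢ N ≼ s ⊕ u) x y s u v N h e)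
    , subst (u <_) (sym (ℕ.+-suc (N ∸ s) s)) (s≤s (ℕ.≤-trans u≤ (subst (N ≤_) (ℕ.+-comm s (N ∸ s)) (ℕ.m≤n+m∸n N s))))

  short-topRight : ∀ x y s → N + x ≤ y + s → len diagonal (x , y) ≤ suc s
  short-topRight x y s h = len≤ diagonal (x , y) 0 (suc s) λ (u , v) u≤ v≤ e →
    z≤n , s≤s (linarith 6 (λ x y s u v N → N ⊕ x ≼ y ⊕ s ⇒ v ≼ N ⇒ x ⊕ v ≐ u ⊕ y ⇒ ⊢ u ≼ s) x y s u v N h v≤ e)

  -- The cost concerns covering lines rather than queens, so any k of the K points may be kept. The
  -- term m² is the allowance for short lines.
  record Configuration (m K : ℕ) : Set where
    field
      points : List Point
      unique : Unique points
      on-board : ∀ {p} → p ∈ points → proj₁ p ≤ N × proj₂ p ≤ N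
      size : length points ≡ K
      lines : Direction → List Point
      covers : ∀ τ {p} → p ∈ points → Any (Same τ p) (lines τ)
      cost : ∑ (lines row) (len row) + (∑ (lines col) (len col) + (∑ (lines diagonal) (len diagonal)
        + ∑ (lines antidiagonal) (len antidiagonal))) ≤ m * suc N + m * m

  place : ∀ {m K k} → Configuration m K → k ≤ K →
    Σ (List (Square (suc N))) λ qs → length qs ≡ k × Unique qs × attackedCount qs ≤ m * suc N + m * m
  place {m} {K} {k} C k≤K = take k squares
    , trans (length-take k squares) (ℕ.m≤n⇒m⊓n≡m (ℕ.≤-trans k≤K (ℕ.≤-reflexive (sym (trans squares-length size)))))
    , Unique.take⁺ k (AllPairs.map (λ ne e → ne (cong pt e)) (AllPairs.map⁻ (subst Unique (sym pt-squares) unique)))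
    , attacked≤
    where
    open Configuration C

    toSquares : ∀ ps → (∀ {p} → p ∈ ps → proj₁ p ≤ N × proj₂ p ≤ N) → Σ (List (Square (suc N))) λ ss → map pt ss ≡ ps
    toSquares [] h = [] , refl
    toSquares (p ∷ ps) h = square (s≤s (proj₁ (h (here refl)))) (s≤s (proj₂ (h (here refl)))) ∷ proj₁ (toSquares ps (h ∘ there))
      , cong₂ _∷_ (pt-square (s≤s (proj₁ (h (here refl)))) (s≤s (proj₂ (h (here refl))))) (proj₂ (toSquares ps (h ∘ there)))

    squares : List (Square (suc N))
    squares = proj₁ (toSquares points on-board)
    pt-squares : map pt squares ≡ points
    pt-squares = proj₂ (toSquares points on-board)
    squares-length : length squares ≡ length points
    squares-length = trans (sym (length-map pt squares)) (cong length pt-squares)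

    all-lines : List (Direction × Point)
    all-lines = map (row ,_) (lines row) ++ (map (col ,_) (lines col) ++ (map (diagonal ,_) (lines diagonal) ++ map (antidiagonal ,_) (lines antidiagonal)))

    on? : ∀ ℓ → Decidable (λ (s : Square (suc N)) → Same (proj₁ ℓ) (proj₂ ℓ) (pt s))
    on? (τ , p) = line? τ p

    tag : ∀ τ {P : Direction × Point → Set} → Any (λ p → P (τ , p)) (lines τ) → Any P all-lines
    tag row h = ++⁺ˡ (Any-map⁺ h)
    tag col h = ++⁺ʳ (map (row ,_) (lines row)) (++⁺ˡ (Any-map⁺ h))
    tag diagonal h = ++⁺ʳ (map (row ,_) (lines row)) (++⁺ʳ (map (col ,_) (lines col)) (++⁺ˡ (Any-map⁺ h)))
    tag antidiagonal h = ++⁺ʳ (map (row ,_) (lines row)) (++⁺ʳ (map (col ,_) (lines col)) (++⁺ʳ (map (diagonal ,_) (lines diagonal)) (Any-map⁺ h)))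

    attacked⇒line : ∀ {s} → T (any (λ q → attacks q s) (take k squares)) → Any (λ ℓ → Same (proj₁ ℓ) (proj₂ ℓ) (pt s)) all-lines
    attacked⇒line {s} t with find (any⁻ (λ q → attacks q s) (take k squares) t)
    ... | q , q∈ , a with attacks⁻ q s a
    ... | τ , e = tag τ (Any.map (λ {p} e′ → same-trans τ p (pt q) (pt s) (same-sym τ {pt q} {p} e′) e)
          (covers τ (subst (pt q ∈_) pt-squares (∈-map⁺ pt (∈-take k q∈)))))

    attacked≤ : attackedCount (take k squares) ≤ m * suc N + m * m
    attacked≤ = begin
      attackedCount (take k squares) ≡⟨ attackedCount≡ (take k squares) ⟩
      # (attacked? (take k squares)) S ≤⟨ union-≤ on? (attacked? (take k squares)) S all-lines (λ _ → attacked⇒line) ⟩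
      ∑ all-lines f ≡⟨ trans (∑-++ (map (row ,_) (lines row)) _ f) (cong₂ _+_ (∑-map (row ,_) (lines row) f)
        (trans (∑-++ (map (col ,_) (lines col)) _ f) (cong₂ _+_ (∑-map (col ,_) (lines col) f)
        (trans (∑-++ (map (diagonal ,_) (lines diagonal)) _ f) (cong₂ _+_ (∑-map (diagonal ,_) (lines diagonal) f)
          (∑-map (antidiagonal ,_) (lines antidiagonal) f)))))) ⟩
      _ ≤⟨ cost ⟩
      m * suc N + m * m ∎
      where
      open ℕ.≤-Reasoning
      f : Direction × Point → ℕ
      f ℓ = # (on? ℓ) S

∑-upTo : ∀ {A : Set} (g : ℕ → A) s {f b} → (∀ i → i < s → f (g i) ≤ b) → ∑ (map g (upTo s)) f ≤ s * b
∑-upTo g s {f} {b} h = subst (_≤ s * b) (sym (∑-map g (upTo s) f))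
  (subst (λ l → ∑ (upTo s) (f ∘ g) ≤ l * b) (length-upTo s) (∑-bound (upTo s) (λ i∈ → h _ (∈-upTo⁻ i∈))))

leftEdge : ℕ → List Point
leftEdge s = map (_, 0) (upTo s)

topEdge : ℕ → List Point
topEdge s = map (0 ,_) (upTo s)

diagonals : ℕ → ℕ → List Point
diagonals r ℓ = leftEdge r ++ map (λ i → 0 , suc i) (upTo ℓ)

on-row : ∀ {s x y} → x < s → Any (Same row (x , y)) (leftEdge s)
on-row x< = Any-map⁺ (lose (∈-upTo⁺ x<) refl)

on-col : ∀ {s x y} → y < s → Any (Same col (x , y)) (topEdge s)
on-col y< = Any-map⁺ (lose (∈-upTo⁺ y<) refl)

on-antidiagonal : ∀ {s x y} → x + y < s → Any (SameE (x , y)) (leftEdge s)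
on-antidiagonal {x = x} {y} s< = Any-map⁺ (lose (∈-upTo⁺ s<) (sym (ℕ.+-identityʳ (x + y))))

on-diagonal : ∀ {r ℓ} x y → x < y + r → y ≤ x + ℓ → Any (SameD (x , y)) (diagonals r ℓ)
on-diagonal {r} {ℓ} x y x< y≤ with ℕ.≤-<-connex y x
... | inj₁ y≤x with ℕ.m≤n⇒∃[o]m+o≡n y≤x
...   | d , refl = ++⁺ˡ (Any-map⁺ (lose (∈-upTo⁺ (ℕ.+-cancelˡ-< y d r x<))
          (linarith 2 (λ y d → ⊢ (y ⊕ d) ⊕ nat 0 ≐ d ⊕ y) y d)))
on-diagonal {r} {ℓ} x y x< y≤ | inj₂ x<y with ℕ.m≤n⇒∃[o]m+o≡n x<y
...   | d , refl = ++⁺ʳ (leftEdge r) (Any-map⁺ (lose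
          (∈-upTo⁺ (linarith 3 (λ x d l → nat 1 ⊕ (x ⊕ d) ≼ x ⊕ l ⇒ ⊢ d ≺ l) x d ℓ y≤))
          (linarith 2 (λ x d → ⊢ x ⊕ (nat 1 ⊕ d) ≐ nat 0 ⊕ (nat 1 ⊕ (x ⊕ d))) x d)))

-- One hexagon in a corner

module Hexagon (r ℓ q e : ℕ) (r≡ : r ≡ q + e) (e≤1 : e ≤ 1) where

  a W : ℕ
  a = r + q
  W = ℓ + r

  -- The ℓ + r diagonals -ℓ ≤ x - y < r cut two opposite corners off an a by W rectangle. There are
  -- as many diagonals as columns, so a + 2W lines are used.
  InHex : Point → Set
  InHex (x , y) = (x < a × y < W) × (x < y + r × y ≤ x + ℓ)

  -- Row r + i of the hexagon complements row i to a row of constant length 2 ℓ + r.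
  indices : List Point
  indices = cartesianProduct (upTo q) (upTo (2 * ℓ + r)) ++ cartesianProduct (map (q +_) (upTo e)) (upTo W)

  Index : Point → Set
  Index (i , y) = i < r × (y ≤ ℓ + i ⊎ (i < q × y < 2 * ℓ + r))

  fold-row : (p : Point) → Dec (proj₂ p ≤ ℓ + proj₁ p) → Point
  fold-row p (yes _) = p
  fold-row (i , y) (no _) = r + i , y ∸ ℓ

  at : Point → Point
  at p = fold-row p (proj₂ p ≤? ℓ + proj₁ p)

  points : List Point
  points = map at indices

  indices⁻ : ∀ {p} → p ∈ indices → Index p
  indices⁻ {p} p∈ with ∈-++⁻ (cartesianProduct (upTo q) (upTo (2 * ℓ + r))) p∈
  ... | inj₁ p∈′ with ∈-cartesianProduct⁻ (upTo q) (upTo (2 * ℓ + r)) p∈′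
  ...   | i∈ , y∈ = ℕ.<-≤-trans (∈-upTo⁻ i∈) (subst (q ≤_) (sym r≡) (ℕ.m≤m+n q e)) , inj₂ (∈-upTo⁻ i∈ , ∈-upTo⁻ y∈)
  indices⁻ {p} p∈ | inj₂ p∈′ with ∈-cartesianProduct⁻ (map (q +_) (upTo e)) (upTo W) p∈′
  ...   | i∈ , y∈ with ∈-map⁻ (q +_) i∈
  ...     | j , j∈ , i≡ = linarith 5 (λ i j q e r → j ≺ e ⇒ i ≐ q ⊕ j ⇒ r ≐ q ⊕ e ⇒ ⊢ i ≺ r) (proj₁ p) j q e r (∈-upTo⁻ j∈) i≡ r≡
            , inj₁ (linarith 7 (λ i j q e r y l → e ≼ nat 1 ⇒ i ≐ q ⊕ j ⇒ r ≐ q ⊕ e ⇒ y ≺ l ⊕ r ⇒ ⊢ y ≼ l ⊕ i)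
                (proj₁ p) j q e r (proj₂ p) ℓ e≤1 i≡ r≡ (∈-upTo⁻ y∈))

  z-form : ∀ {i y} → ¬ y ≤ ℓ + i → ℓ + (y ∸ ℓ) ≡ y
  z-form {i} {y} n = ℕ.m+[n∸m]≡n (ℕ.≤-trans (ℕ.m≤m+n ℓ i) (ℕ.<⇒≤ (ℕ.≰⇒> n)))

  in-hex : ∀ p (d : Dec (proj₂ p ≤ ℓ + proj₁ p)) → Index p → InHex (fold-row p d)
  in-hex (i , y) (yes y≤) (i< , _) = (ℕ.<-≤-trans i< (ℕ.m≤m+n r q) , ℕ.≤-<-trans y≤ (ℕ.+-monoʳ-< ℓ i<))
    , ℕ.<-≤-trans i< (ℕ.m≤n+m r y) , subst (y ≤_) (ℕ.+-comm ℓ i) y≤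
  in-hex (i , y) (no n) (_ , inj₁ y≤) = contradiction y≤ n
  in-hex (i , y) (no n) (_ , inj₂ (i<q , y<)) =
    ( ℕ.+-monoʳ-< r i<q
    , linarith 4 (λ l z y r → l ⊕ z ≐ y ⇒ y ≺ 2 ⊙ l ⊕ r ⇒ ⊢ z ≺ l ⊕ r) ℓ z y r (z-form n) y<)
    , linarith 5 (λ l z y r i → l ⊕ z ≐ y ⇒ l ⊕ i ≺ y ⇒ ⊢ r ⊕ i ≺ z ⊕ r) ℓ z y r i (z-form n) (ℕ.≰⇒> n)
    , linarith 5 (λ l z y r i → l ⊕ z ≐ y ⇒ y ≺ 2 ⊙ l ⊕ r ⇒ ⊢ z ≼ (r ⊕ i) ⊕ l) ℓ z y r i (z-form n) y<
    where z = y ∸ ℓ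

  points⁻ : ∀ {p} → p ∈ points → InHex p
  points⁻ p∈ with ∈-map⁻ at p∈
  ... | p , p∈ , refl = in-hex p (proj₂ p ≤? ℓ + proj₁ p) (indices⁻ p∈)

  fold-row-inj : ∀ p p′ (d : Dec (proj₂ p ≤ ℓ + proj₁ p)) (d′ : Dec (proj₂ p′ ≤ ℓ + proj₁ p′)) → Index p → Index p′ →
    fold-row p d ≡ fold-row p′ d′ → p ≡ p′
  fold-row-inj p p′ (yes _) (yes _) _ _ eq = eq
  fold-row-inj (i , y) (i′ , y′) (yes _) (no _) (i< , _) _ eq =
    contradiction (subst (_< r) (cong proj₁ eq) i<) (ℕ.m+n≮m r i′)
  fold-row-inj (i , y) (i′ , y′) (no _) (yes _) _ (i< , _) eq =
    contradiction (subst (_< r) (sym (cong proj₁ eq)) i<) (ℕ.m+n≮m r i)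
  fold-row-inj (i , y) (i′ , y′) (no n) (no n′) _ _ eq = cong₂ _,_ (ℕ.+-cancelˡ-≡ r _ _ (cong proj₁ eq))
    (trans (sym (z-form n)) (trans (cong (ℓ +_) (cong proj₂ eq)) (z-form n′)))

  indices-unique : Unique indices
  indices-unique = Unique.++⁺ (Unique.cartesianProduct⁺ (Unique.upTo⁺ q) (Unique.upTo⁺ (2 * ℓ + r)))
    (Unique.cartesianProduct⁺ (Unique.map⁺ (ℕ.+-cancelˡ-≡ q _ _) (Unique.upTo⁺ e)) (Unique.upTo⁺ W)) disjoint
    where
    disjoint : ∀ {p} → p ∈ cartesianProduct (upTo q) (upTo (2 * ℓ + r)) × p ∈ cartesianProduct (map (q +_) (upTo e)) (upTo W) → ⊥
    disjoint (p∈ , p∈′) with ∈-map⁻ (q +_) (proj₁ (∈-cartesianProduct⁻ (map (q +_) (upTo e)) (upTo W) p∈′))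
    ... | j , _ , refl = ℕ.m+n≮m q j (∈-upTo⁻ (proj₁ (∈-cartesianProduct⁻ (upTo q) (upTo (2 * ℓ + r)) p∈)))

  points-unique : Unique points
  points-unique = unique-map at indices-unique λ {p} {p′} p∈ p∈′ →
    fold-row-inj p p′ (proj₂ p ≤? ℓ + proj₁ p) (proj₂ p′ ≤? ℓ + proj₁ p′) (indices⁻ p∈) (indices⁻ p∈′)

  K : ℕ
  K = q * (2 * ℓ + r) + e * W

  length-points : length points ≡ K
  length-points = trans (length-map at indices) (trans (length-++ (cartesianProduct (upTo q) (upTo (2 * ℓ + r))))
    (cong₂ _+_ (trans (length-× (upTo q) _) (cong₂ _*_ (length-upTo q) (length-upTo (2 * ℓ + r))))
      (trans (length-× (map (q +_) (upTo e)) (upTo W)) (cong₂ _*_ (trans (length-map (q +_) (upTo e)) (length-upTo e)) (length-upTo W)))))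

  module _ (N : ℕ) (a≤N : a ≤ N) (W≤N : W ≤ N) where
    open Placing N

    -- The antidiagonals that occur have x + y < a + W: there are at most a + W of them, each with
    -- at most a + W squares, and (a + W)² is within the allowance.
    corner : Configuration (a + (W + W)) K
    corner = record
      { points = points ; unique = points-unique
      ; on-board = λ p∈ → let (x< , y<) , _ = points⁻ p∈ in ℕ.≤-trans (ℕ.<⇒≤ x<) a≤N , ℕ.≤-trans (ℕ.<⇒≤ y<) W≤N
      ; size = length-points
      ; lines = lines
      ; covers = covers
      ; cost = cost }
      where
      lines : Direction → List Point
      lines row = leftEdge a
      lines col = topEdge W
      lines diagonal = diagonals r ℓ
      lines antidiagonal = leftEdge (a + W)
      covers : ∀ τ {p} → p ∈ points → Any (Same τ p) (lines τ)
      covers row {x , y} p∈ = on-row {a} {x} {y} (proj₁ (proj₁ (points⁻ p∈)))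
      covers col {x , y} p∈ = on-col {W} {x} {y} (proj₂ (proj₁ (points⁻ p∈)))
      covers diagonal {x , y} p∈ = on-diagonal x y (proj₁ (proj₂ (points⁻ p∈))) (proj₂ (proj₂ (points⁻ p∈)))
      covers antidiagonal {x , y} p∈ = on-antidiagonal {a + W} {x} {y} (ℕ.+-mono-< (proj₁ (proj₁ (points⁻ p∈))) (proj₂ (proj₁ (points⁻ p∈))))
      n = suc N
      cost : ∑ (leftEdge a) (len row) + (∑ (topEdge W) (len col) + (∑ (diagonals r ℓ) (len diagonal)
        + ∑ (leftEdge (a + W)) (len antidiagonal))) ≤ (a + (W + W)) * n + (a + (W + W)) * (a + (W + W))
      cost = begin
        _ ≤⟨ ℕ.+-mono-≤ (∑-upTo (_, 0) a (λ i _ → len≤n row (i , 0))) (ℕ.+-mono-≤ (∑-upTo (0 ,_) W (λ i _ → len≤n col (0 , i)))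
          (ℕ.+-mono-≤ (subst (_≤ r * n + ℓ * n) (sym (∑-++ (leftEdge r) _ (len diagonal)))
              (ℕ.+-mono-≤ (∑-upTo (_, 0) r (λ i _ → len≤n diagonal (i , 0))) (∑-upTo (λ i → 0 , suc i) ℓ (λ i _ → len≤n diagonal (0 , suc i)))))
            (∑-upTo (_, 0) (a + W) (λ i i< → ℕ.≤-trans (short-topLeft i 0) (subst (_< a + W) (sym (ℕ.+-identityʳ i)) i<))))) ⟩
        a * n + (W * n + ((r * n + ℓ * n) + (a + W) * (a + W))) ≡⟨ lemma a ℓ r n ⟩
        (a + (W + W)) * n + (a + W) * (a + W)
          ≤⟨ ℕ.+-monoʳ-≤ ((a + (W + W)) * n) (ℕ.*-mono-≤ (ℕ.+-monoʳ-≤ a (ℕ.m≤m+n W W)) (ℕ.+-monoʳ-≤ a (ℕ.m≤m+n W W))) ⟩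
        (a + (W + W)) * n + (a + (W + W)) * (a + (W + W)) ∎
        where
        open ℕ.≤-Reasoning
        lemma : ∀ a ℓ r n → a * n + ((ℓ + r) * n + ((r * n + ℓ * n) + (a + (ℓ + r)) * (a + (ℓ + r))))
          ≡ (a + ((ℓ + r) + (ℓ + r))) * n + (a + (ℓ + r)) * (a + (ℓ + r))
        lemma = ℕ-solve-∀

-- Four hexagons in the corners for m ≡ 6 modulo 12

module FourCorners (v N : ℕ) (2w≤N : suc v + v + (suc v + v) ≤ N) where
  open Placing N
  module H = Hexagon (suc v) v v 1 (ℕ.+-comm 1 v) ℕ.≤-refl

  w : ℕ
  w = suc v + v

  -- For r = v + 1 and q = ℓ = v the hexagon is the part |x - y| ≤ v of a square of side w = 2v + 1.
  -- This symmetry under transposition lets opposite corners use the same w long diagonals.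
  record Small (x y : ℕ) : Set where
    field
      x<w : x < w
      y<w : y < w
      x≤ : x ≤ y + v
      y≤ : y ≤ x + v

    complement : ∀ z → z < w → z + (N ∸ z) ≡ N
    complement z z< = ℕ.m+[n∸m]≡n (ℕ.≤-trans (ℕ.<⇒≤ z<) (ℕ.≤-trans (ℕ.m≤m+n w w) 2w≤N))
    X : x + (N ∸ x) ≡ N
    X = complement x x<w
    Y : y + (N ∸ y) ≡ N
    Y = complement y y<w
    s<2w : x + y < w + w
    s<2w = ℕ.+-mono-< x<w y<w
    Z : x + y + (N ∸ (x + y)) ≡ N
    Z = ℕ.m+[n∸m]≡n (ℕ.≤-trans (ℕ.<⇒≤ s<2w) 2w≤N)

  small : ∀ {x y} → (x , y) ∈ H.points → Small x y
  small {x} {y} p∈ with H.points⁻ p∈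
  ... | (x< , y<) , x<y+ , y≤ = record { x<w = x< ; y<w = subst (y <_) (ℕ.+-suc v v) y<
    ; x≤ = linarith 3 (λ x y v → x ≺ y ⊕ (nat 1 ⊕ v) ⇒ ⊢ x ≼ y ⊕ v) x y v x<y+ ; y≤ = y≤ }

  flip : Bool → ℕ → ℕ
  flip false x = x
  flip true x = N ∸ x

  reflect : (Bool × Bool) × Point → Point
  reflect ((b , c) , x , y) = flip b x , flip c y

  flip-inj : ∀ b b′ x x′ → x < w → x′ < w → flip b x ≡ flip b′ x′ → b ≡ b′ × x ≡ x′
  flip-inj false false x x′ _ _ e = refl , e
  flip-inj true true x x′ x< x′< e = refl , ℕ.∸-cancelˡ-≡ (w≤N x<) (w≤N x′<) e
    where
    w≤N : ∀ {z} → z < w → z ≤ N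
    w≤N z< = ℕ.≤-trans (ℕ.<⇒≤ z<) (ℕ.≤-trans (ℕ.m≤m+n w w) 2w≤N)
  flip-inj false true x x′ x< x′< e = ⊥-elim (ℕ.<⇒≱ (ℕ.+-mono-< x< x′<) (ℕ.≤-trans 2w≤N
    (subst (N ≤_) (trans (cong (x′ +_) (sym e)) (ℕ.+-comm x′ x)) (ℕ.m≤n+m∸n N x′))))
  flip-inj true false x x′ x< x′< e = ⊥-elim (ℕ.<⇒≱ (ℕ.+-mono-< x< x′<) (ℕ.≤-trans 2w≤N
    (subst (N ≤_) (cong (x +_) e) (ℕ.m≤n+m∸n N x))))

  flags : List (Bool × Bool)
  flags = (false , false) ∷ (false , true) ∷ (true , false) ∷ (true , true) ∷ []

  flags-unique : Unique flags
  flags-unique = ((λ ()) ∷ (λ ()) ∷ (λ ()) ∷ []) ∷ ((λ ()) ∷ (λ ()) ∷ []) ∷ ((λ ()) ∷ []) ∷ [] ∷ []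

  indices : List ((Bool × Bool) × Point)
  indices = cartesianProduct flags H.points

  index⁻ : ∀ {i} → i ∈ indices → Small (proj₁ (proj₂ i)) (proj₂ (proj₂ i))
  index⁻ i∈ = small (proj₂ (∈-cartesianProduct⁻ flags H.points i∈))

  points-unique : Unique (map reflect indices)
  points-unique = unique-map reflect (Unique.cartesianProduct⁺ flags-unique H.points-unique) inj
    where
    inj : ∀ {i j} → i ∈ indices → j ∈ indices → reflect i ≡ reflect j → i ≡ j
    inj {(b , c) , x , y} {(b′ , c′) , x′ , y′} i∈ j∈ e with
      flip-inj b b′ x x′ (Small.x<w (index⁻ i∈)) (Small.x<w (index⁻ j∈)) (cong proj₁ e)
      | flip-inj c c′ y y′ (Small.y<w (index⁻ i∈)) (Small.y<w (index⁻ j∈)) (cong proj₂ e)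
    ... | refl , refl | refl , refl = refl

  length-points : length (map reflect indices) ≡ 4 * H.K
  length-points = trans (length-map reflect indices) (trans (length-flags flags) (cong (4 *_) H.length-points))
    where
    length-flags : ∀ fs → length (cartesianProduct fs H.points) ≡ length fs * length H.points
    length-flags [] = refl
    length-flags (f ∷ fs) = trans (length-++ (map (f ,_) H.points)) (cong₂ _+_ (length-map (f ,_) H.points) (length-flags fs))

  flip≤ : ∀ b x → x < w → flip b x ≤ N
  flip≤ false x x< = ℕ.≤-trans (ℕ.<⇒≤ x<) (ℕ.≤-trans (ℕ.m≤m+n w w) 2w≤N)
  flip≤ true x x< = ℕ.m∸n≤m N x

  on-board : ∀ {p} → p ∈ map reflect indices → proj₁ p ≤ N × proj₂ p ≤ N
  on-board p∈ with ∈-map⁻ reflect p∈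
  ... | ((b , c) , x , y) , i∈ , refl = flip≤ b x (Small.x<w (index⁻ i∈)) , flip≤ c y (Small.y<w (index⁻ i∈))

  bottomRow rightCol topCorner bottomCorner rightCorner antidiagonals : List Point
  bottomRow = map (λ i → N ∸ i , 0) (upTo w)
  rightCol = map (λ i → 0 , N ∸ i) (upTo w)
  topCorner = map (λ s → 0 , N ∸ s) (upTo (w + w))
  bottomCorner = map (λ s → N ∸ s , 0) (upTo (w + w))
  rightCorner = map (λ s → N ∸ s , N) (upTo (w + w))
  antidiagonals = map (_, N) (upTo (suc v)) ++ map (λ i → 0 , N ∸ suc i) (upTo v)

  -- The lines to be paid in full are 2w rows, 2w columns, w diagonals and w antidiagonals, 6w = m
  -- in all. Each of the two diagonal families has in addition two groups of 2w short lines at the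
  -- corners it cuts off.
  lines : Direction → List Point
  lines row = leftEdge w ++ bottomRow
  lines col = topEdge w ++ rightCol
  lines diagonal = diagonals (suc v) v ++ (topCorner ++ bottomCorner)
  lines antidiagonal = antidiagonals ++ (leftEdge (w + w) ++ rightCorner)

  on-antidiagonals : ∀ x y x′ y′ → x ≤ y + v → y ≤ x + v → x′ + y′ + y ≡ N + x → y ≤ N → Any (SameE (x′ , y′)) antidiagonals
  on-antidiagonals x y x′ y′ x≤ y≤ e y≤N with ℕ.≤-<-connex y x
  ... | inj₁ y≤x with ℕ.m≤n⇒∃[o]m+o≡n y≤x
  ...   | d , refl = ++⁺ˡ (Any-map⁺ (lose (∈-upTo⁺ (s≤s (ℕ.+-cancelˡ-≤ y d v x≤)))
          (linarith 5 (λ x y d N s → s ⊕ y ≐ N ⊕ (y ⊕ d) ⇒ ⊢ s ≐ d ⊕ N) 0 y d N (x′ + y′) e)))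
  on-antidiagonals x y x′ y′ x≤ y≤ e y≤N | inj₂ x<y with ℕ.m≤n⇒∃[o]m+o≡n x<y
  ...   | d , refl = ++⁺ʳ (map (_, N) (upTo (suc v))) (Any-map⁺ (lose
          (∈-upTo⁺ (linarith 3 (λ x d v → nat 1 ⊕ (x ⊕ d) ≼ x ⊕ v ⇒ ⊢ d ≺ v) x d v y≤))
          (linarith 5 (λ x d N s t → s ⊕ (nat 1 ⊕ (x ⊕ d)) ≐ N ⊕ x ⇒ nat 1 ⊕ d ⊕ t ≐ N ⇒ ⊢ s ≐ nat 0 ⊕ t) x d N (x′ + y′) (N ∸ suc d) e
            (ℕ.m+[n∸m]≡n (ℕ.≤-trans (s≤s (ℕ.m≤n+m d x)) y≤N)))))

  cover : ∀ τ b c x y → Small x y → Any (Same τ (flip b x , flip c y)) (lines τ)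
  cover row false c x y h = ++⁺ˡ (on-row {w} {x} {flip c y} (Small.x<w h))
  cover row true c x y h = ++⁺ʳ (leftEdge w) (Any-map⁺ (lose (∈-upTo⁺ (Small.x<w h)) refl))
  cover col b false x y h = ++⁺ˡ (on-col {w} {flip b x} {y} (Small.y<w h))
  cover col b true x y h = ++⁺ʳ (topEdge w) (Any-map⁺ (lose (∈-upTo⁺ (Small.y<w h)) refl))
  cover diagonal false false x y h = ++⁺ˡ (on-diagonal {suc v} {v} x y
    (linarith 3 (λ x y v → x ≼ y ⊕ v ⇒ ⊢ x ≺ y ⊕ (nat 1 ⊕ v)) x y v (Small.x≤ h)) (Small.y≤ h))
  cover diagonal true true x y h = ++⁺ˡ (on-diagonal {suc v} {v} (N ∸ x) (N ∸ y)
    (linarith 6 (λ x y v X Y N → y ≼ x ⊕ v ⇒ x ⊕ X ≐ N ⇒ y ⊕ Y ≐ N ⇒ ⊢ X ≺ Y ⊕ (nat 1 ⊕ v)) x y v (N ∸ x) (N ∸ y) N (Small.y≤ h) (Small.X h) (Small.Y h))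
    (linarith 6 (λ x y v X Y N → x ≼ y ⊕ v ⇒ x ⊕ X ≐ N ⇒ y ⊕ Y ≐ N ⇒ ⊢ Y ≼ X ⊕ v) x y v (N ∸ x) (N ∸ y) N (Small.x≤ h) (Small.X h) (Small.Y h)))
  cover diagonal false true x y h = ++⁺ʳ (diagonals (suc v) v) (++⁺ˡ (Any-map⁺ (lose (∈-upTo⁺ (Small.s<2w h))
    (linarith 5 (λ x y Y Z N → y ⊕ Y ≐ N ⇒ x ⊕ y ⊕ Z ≐ N ⇒ ⊢ x ⊕ Z ≐ nat 0 ⊕ Y) x y (N ∸ y) (N ∸ (x + y)) N (Small.Y h) (Small.Z h)))))
  cover diagonal true false x y h = ++⁺ʳ (diagonals (suc v) v) (++⁺ʳ topCorner (Any-map⁺ (lose (∈-upTo⁺ (Small.s<2w h))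
    (linarith 5 (λ x y X Z N → x ⊕ X ≐ N ⇒ x ⊕ y ⊕ Z ≐ N ⇒ ⊢ X ⊕ nat 0 ≐ Z ⊕ y) x y (N ∸ x) (N ∸ (x + y)) N (Small.X h) (Small.Z h)))))
  cover antidiagonal false false x y h = ++⁺ʳ antidiagonals (++⁺ˡ (on-antidiagonal {w + w} {x} {y} (Small.s<2w h)))
  cover antidiagonal true true x y h = ++⁺ʳ antidiagonals (++⁺ʳ (leftEdge (w + w)) (Any-map⁺ (lose (∈-upTo⁺ (Small.s<2w h))
    (linarith 6 (λ x y X Y Z N → x ⊕ X ≐ N ⇒ y ⊕ Y ≐ N ⇒ x ⊕ y ⊕ Z ≐ N ⇒ ⊢ X ⊕ Y ≐ Z ⊕ N) x y (N ∸ x) (N ∸ y) (N ∸ (x + y)) N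
      (Small.X h) (Small.Y h) (Small.Z h)))))
  cover antidiagonal false true x y h = ++⁺ˡ (on-antidiagonals x y x (N ∸ y) (Small.x≤ h) (Small.y≤ h)
    (linarith 4 (λ x y Y N → y ⊕ Y ≐ N ⇒ ⊢ x ⊕ Y ⊕ y ≐ N ⊕ x) x y (N ∸ y) N (Small.Y h)) (flip≤ false y (Small.y<w h)))
  cover antidiagonal true false x y h = ++⁺ˡ (on-antidiagonals y x (N ∸ x) y (Small.y≤ h) (Small.x≤ h)
    (linarith 4 (λ x y X N → x ⊕ X ≐ N ⇒ ⊢ X ⊕ y ⊕ x ≐ N ⊕ y) x y (N ∸ x) N (Small.X h)) (flip≤ false x (Small.x<w h)))

  n = suc N

  edge : ∀ τ (g : ℕ → Point) s {b} → (∀ i → i < s → len τ (g i) ≤ b) → ∑ (map g (upTo s)) (len τ) ≤ s * b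
  edge τ g s = ∑-upTo g s {len τ}

  join : ∀ τ (xs ys : List Point) {s t} → ∑ xs (len τ) ≤ s → ∑ ys (len τ) ≤ t → ∑ (xs ++ ys) (len τ) ≤ s + t
  join τ xs ys {s} {t} p q = subst (_≤ s + t) (sym (∑-++ xs ys (len τ))) (ℕ.+-mono-≤ p q)

  fill : ∀ s → N ≤ N ∸ s + s
  fill s = subst (N ≤_) (ℕ.+-comm s (N ∸ s)) (ℕ.m≤n+m∸n N s)

  cost : ∑ (lines row) (len row) + (∑ (lines col) (len col) + (∑ (lines diagonal) (len diagonal)
        + ∑ (lines antidiagonal) (len antidiagonal))) ≤ 6 * w * n + 6 * w * (6 * w)
  cost = begin
    _ ≤⟨ ℕ.+-mono-≤ (join row (leftEdge w) bottomRow (edge row (_, 0) w λ i _ → len≤n row (i , 0)) (edge row (λ i → N ∸ i , 0) w λ i _ → len≤n row (N ∸ i , 0)))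
      (ℕ.+-mono-≤ (join col (topEdge w) rightCol (edge col (0 ,_) w λ i _ → len≤n col (0 , i)) (edge col (λ i → 0 , N ∸ i) w λ i _ → len≤n col (0 , N ∸ i)))
      (ℕ.+-mono-≤
        (join diagonal (diagonals (suc v) v) (topCorner ++ bottomCorner)
          (join diagonal (leftEdge (suc v)) (map (λ i → 0 , suc i) (upTo v)) (edge diagonal (_, 0) (suc v) λ i _ → len≤n diagonal (i , 0))
            (edge diagonal (λ i → 0 , suc i) v λ i _ → len≤n diagonal (0 , suc i)))
          (join diagonal topCorner bottomCorner
            (edge diagonal (λ s → 0 , N ∸ s) (w + w) λ s s< → ℕ.≤-trans (short-topRight 0 (N ∸ s) s (subst (_≤ N ∸ s + s) (sym (ℕ.+-identityʳ N)) (fill s))) s<)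
            (edge diagonal (λ s → N ∸ s , 0) (w + w) λ s s< → ℕ.≤-trans (short-bottomLeft (N ∸ s) 0 s (subst (_≤ N ∸ s + s) (sym (ℕ.+-identityʳ N)) (fill s))) s<)))
        (join antidiagonal antidiagonals (leftEdge (w + w) ++ rightCorner)
          (join antidiagonal (map (_, N) (upTo (suc v))) (map (λ i → 0 , N ∸ suc i) (upTo v)) (edge antidiagonal (_, N) (suc v) λ i _ → len≤n antidiagonal (i , N))
            (edge antidiagonal (λ i → 0 , N ∸ suc i) v λ i _ → len≤n antidiagonal (0 , N ∸ suc i)))
          (join antidiagonal (leftEdge (w + w)) rightCorner
            (edge antidiagonal (_, 0) (w + w) λ s s< → ℕ.≤-trans (short-topLeft s 0) (subst (_< w + w) (sym (ℕ.+-identityʳ s)) s<))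
            (edge antidiagonal (λ s → N ∸ s , N) (w + w) λ s s< → ℕ.≤-trans (short-bottomRight (N ∸ s) N s
              (linarith 3 (λ N s t → N ≼ t ⊕ s ⇒ ⊢ N ⊕ N ≼ t ⊕ N ⊕ s) N s (N ∸ s) (fill s))) s<))))) ⟩
    (w * n + w * n) + ((w * n + w * n) + (((suc v * n + v * n) + ((w + w) * (w + w) + (w + w) * (w + w)))
      + ((suc v * n + v * n) + ((w + w) * (w + w) + (w + w) * (w + w))))) ≡⟨ lemma v n ⟩
    6 * w * n + 16 * (w * w) ≤⟨ ℕ.+-monoʳ-≤ (6 * w * n) (subst (16 * (w * w) ≤_) (lemma′ w) (ℕ.*-monoˡ-≤ (w * w) (ℕ.m≤m+n 16 20))) ⟩
    6 * w * n + 6 * w * (6 * w) ∎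
    where
    open ℕ.≤-Reasoning
    lemma : ∀ v n → ((suc v + v) * n + (suc v + v) * n) + (((suc v + v) * n + (suc v + v) * n) +
      (((suc v * n + v * n) + (((suc v + v) + (suc v + v)) * ((suc v + v) + (suc v + v)) + ((suc v + v) + (suc v + v)) * ((suc v + v) + (suc v + v))))
      + ((suc v * n + v * n) + (((suc v + v) + (suc v + v)) * ((suc v + v) + (suc v + v)) + ((suc v + v) + (suc v + v)) * ((suc v + v) + (suc v + v))))))
      ≡ 6 * (suc v + v) * n + 16 * ((suc v + v) * (suc v + v))
    lemma = ℕ-solve-∀
    lemma′ : ∀ w → 36 * (w * w) ≡ 6 * w * (6 * w)
    lemma′ = ℕ-solve-∀

  corners : Configuration (6 * w) (4 * H.K)
  corners = record
    { points = map reflect indices ; unique = points-unique ; on-board = on-board ; size = length-points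
    ; lines = lines ; covers = covers ; cost = cost }
    where
    covers : ∀ τ {p} → p ∈ map reflect indices → Any (Same τ p) (lines τ)
    covers τ p∈ with ∈-map⁻ reflect p∈
    ... | ((b , c) , x , y) , i∈ , refl = cover τ b c x y (index⁻ i∈)

-- Nine queens for m = 10

module Nine (h e : ℕ) (0<h : 0 < h) (e≤1 : e ≤ 1) where

  N : ℕ
  N = h + h + e
  open Placing N

  n : ℕ
  n = suc N

  -- If e = 1, the side N + 1 is even and there is no middle line; the grid then leaves the last row
  -- and column free, at bounded cost.
  ticks : List ℕ
  ticks = 0 ∷ h ∷ h + h ∷ []

  ticks-unique : Unique ticks
  ticks-unique = ((λ e → ℕ.<⇒≢ 0<h e) ∷ (λ e → ℕ.<⇒≢ (ℕ.<-≤-trans 0<h (ℕ.m≤m+n h h)) e) ∷ [])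
    ∷ ((λ e → ℕ.<⇒≢ (ℕ.m<m+n h 0<h) e) ∷ []) ∷ [] ∷ []

  ticks≤ : ∀ {x} → x ∈ ticks → x ≤ N
  ticks≤ (here refl) = z≤n
  ticks≤ (there (here refl)) = ℕ.≤-trans (ℕ.m≤m+n h h) (ℕ.m≤m+n (h + h) e)
  ticks≤ (there (there (here refl))) = ℕ.m≤m+n (h + h) e

  points : List Point
  points = cartesianProduct ticks ticks

  -- In units of n: three rows and three columns, and in each diagonal family one line of full
  -- length, two of half length and two of bounded length, so 3 + 3 + 2 + 2 = 10.
  lines : Direction → List Point
  lines row = map (_, 0) ticks
  lines col = map (0 ,_) ticks
  lines diagonal = (0 , 0) ∷ (0 , h) ∷ (h , 0) ∷ (0 , h + h) ∷ (h + h , 0) ∷ []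
  lines antidiagonal = (0 , 0) ∷ (h , 0) ∷ (h + h , 0) ∷ (h + h , h) ∷ (h + h , h + h) ∷ []

  cover : ∀ τ {x y} → x ∈ ticks → y ∈ ticks → Any (Same τ (x , y)) (lines τ)
  cover row x∈ _ = Any-map⁺ (lose x∈ refl)
  cover col _ y∈ = Any-map⁺ (lose y∈ refl)
  cover diagonal (here refl) (here refl) = here refl
  cover diagonal (here refl) (there (here refl)) = there (here refl)
  cover diagonal (here refl) (there (there (here refl))) = there (there (there (here refl)))
  cover diagonal (there (here refl)) (here refl) = there (there (here refl))
  cover diagonal (there (here refl)) (there (here refl)) = here (ℕ.+-identityʳ h)
  cover diagonal (there (here refl)) (there (there (here refl))) = there (here refl)
  cover diagonal (there (there (here refl))) (here refl) = there (there (there (there (here refl))))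
  cover diagonal (there (there (here refl))) (there (here refl)) = there (there (here (ℕ.+-identityʳ (h + h))))
  cover diagonal (there (there (here refl))) (there (there (here refl))) = here (ℕ.+-identityʳ (h + h))
  cover antidiagonal (here refl) (here refl) = here refl
  cover antidiagonal (here refl) (there (here refl)) = there (here (sym (ℕ.+-identityʳ h)))
  cover antidiagonal (here refl) (there (there (here refl))) = there (there (here (sym (ℕ.+-identityʳ (h + h)))))
  cover antidiagonal (there (here refl)) (here refl) = there (here refl)
  cover antidiagonal (there (here refl)) (there (here refl)) = there (there (here (sym (ℕ.+-identityʳ (h + h)))))
  cover antidiagonal (there (here refl)) (there (there (here refl))) = there (there (there (here (ℕ.+-comm h (h + h)))))
  cover antidiagonal (there (there (here refl))) (here refl) = there (there (here refl))
  cover antidiagonal (there (there (here refl))) (there (here refl)) = there (there (there (here refl)))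
  cover antidiagonal (there (there (here refl))) (there (there (here refl))) = there (there (there (there (here refl))))

  cost : ∑ (lines row) (len row) + (∑ (lines col) (len col) + (∑ (lines diagonal) (len diagonal)
        + ∑ (lines antidiagonal) (len antidiagonal))) ≤ 10 * n + 100
  cost = begin
    _ ≤⟨ ℕ.+-mono-≤ (∑-bound (lines row) (λ {p} _ → len≤n row p)) (ℕ.+-mono-≤ (∑-bound (lines col) (λ {p} _ → len≤n col p))
      (ℕ.+-mono-≤
        (ℕ.+-mono-≤ (len≤n diagonal (0 , 0))
        (ℕ.+-mono-≤ (short-topRight 0 h (h + e) (linarith 2 (λ h e → ⊢ (h ⊕ h ⊕ e) ⊕ nat 0 ≼ h ⊕ (h ⊕ e)) h e))
        (ℕ.+-mono-≤ (short-bottomLeft h 0 (h + e) (linarith 2 (λ h e → ⊢ (h ⊕ h ⊕ e) ⊕ nat 0 ≼ h ⊕ (h ⊕ e)) h e))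
        (ℕ.+-mono-≤ (short-topRight 0 (h + h) e (linarith 2 (λ h e → ⊢ (h ⊕ h ⊕ e) ⊕ nat 0 ≼ h ⊕ h ⊕ e) h e))
        (ℕ.+-mono-≤ (short-bottomLeft (h + h) 0 e (linarith 2 (λ h e → ⊢ (h ⊕ h ⊕ e) ⊕ nat 0 ≼ h ⊕ h ⊕ e) h e)) (z≤n {0}))))))
        (ℕ.+-mono-≤ (short-topLeft 0 0)
        (ℕ.+-mono-≤ (short-topLeft h 0)
        (ℕ.+-mono-≤ (len≤n antidiagonal (h + h , 0))
        (ℕ.+-mono-≤ (short-bottomRight (h + h) h (h + (e + e)) (linarith 2 (λ h e → ⊢ (h ⊕ h ⊕ e) ⊕ (h ⊕ h ⊕ e) ≼ h ⊕ h ⊕ h ⊕ (h ⊕ (e ⊕ e))) h e))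
        (ℕ.+-mono-≤ (short-bottomRight (h + h) (h + h) (e + e) (linarith 2 (λ h e → ⊢ (h ⊕ h ⊕ e) ⊕ (h ⊕ h ⊕ e) ≼ h ⊕ h ⊕ (h ⊕ h) ⊕ (e ⊕ e)) h e)) (z≤n {0})))))))) ⟩
    3 * n + (3 * n + ((n + (suc (h + e) + (suc (h + e) + (suc e + (suc e + 0)))))
      + (1 + (suc (h + 0) + (n + (suc (h + (e + e)) + (suc (e + e) + 0)))))))
      ≤⟨ linarith 2 (λ h e → e ≼ nat 1 ⇒ ⊢
          3 ⊙ N′ h e ⊕ (3 ⊙ N′ h e ⊕ ((N′ h e ⊕ (nat 1 ⊕ (h ⊕ e) ⊕ (nat 1 ⊕ (h ⊕ e) ⊕ (nat 1 ⊕ e ⊕ (nat 1 ⊕ e ⊕ nat 0)))))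
          ⊕ (nat 1 ⊕ (nat 1 ⊕ (h ⊕ nat 0) ⊕ (N′ h e ⊕ (nat 1 ⊕ (h ⊕ (e ⊕ e)) ⊕ (nat 1 ⊕ (e ⊕ e) ⊕ nat 0)))))))
          ≼ 10 ⊙ N′ h e ⊕ nat 100) h e e≤1 ⟩
    10 * n + 100 ∎
    where
    open ℕ.≤-Reasoning
    N′ : Exp → Exp → Exp
    N′ h e = nat 1 ⊕ (h ⊕ h ⊕ e)

  nine : Configuration 10 9
  nine = record
    { points = points
    ; unique = Unique.cartesianProduct⁺ ticks-unique ticks-unique
    ; on-board = λ p∈ → let x∈ , y∈ = ∈-cartesianProduct⁻ ticks ticks p∈ in ticks≤ x∈ , ticks≤ y∈
    ; size = refl
    ; lines = lines
    ; covers = λ τ p∈ → let x∈ , y∈ = ∈-cartesianProduct⁻ ticks ticks p∈ in cover τ x∈ y∈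
    ; cost = cost }

-- Matching the sizes of the constructions with G

G≤-bonus : ∀ m K t → 12 * K ≡ m * m + suc t → G m ≤ K
G≤-bonus m K t eq = ℕ.≤-trans (ℕ.+-monoʳ-≤ ((m * m) / 12) (if≤1 (bonus m))) (subst (_≤ K) (ℕ.+-comm 1 ((m * m) / 12))
  (m<n*o⇒m/o<n (subst (m * m <_) (trans (sym eq) (ℕ.*-comm 12 K)) (ℕ.m<m+n (m * m) (s≤s z≤n)))))
  where
  if≤1 : ∀ b → (if b then 1 else 0) ≤ 1
  if≤1 true = ℕ.≤-refl
  if≤1 false = z≤n

G≤-plain : ∀ m K t → bonus m ≡ false → 12 * suc K ≡ m * m + suc t → G m ≤ K
G≤-plain m K t b eq rewrite b = subst (_≤ K) (sym (ℕ.+-identityʳ _)) (ℕ.≤-pred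
  (m<n*o⇒m/o<n (subst (m * m <_) (trans (sym eq) (ℕ.*-comm 12 (suc K))) (ℕ.m<m+n (m * m) (s≤s z≤n)))))

bonus-table : ℕ → Bool → Bool
bonus-table r b = (r ≡ᵇ 3) ∨ (r ≡ᵇ 6) ∨ (r ≡ᵇ 9) ∨ b

no-bonus : ∀ r q → bonus-table (r % 12) false ≡ false → r + q * 12 ≢ 10 → bonus (r + q * 12) ≡ false
no-bonus r q p ne = trans (cong₂ bonus-table ([m+kn]%n≡m%n r q 12) (go _ refl)) p
  where
  go : ∀ b → ((r + q * 12) ≡ᵇ 10) ≡ b → ((r + q * 12) ≡ᵇ 10) ≡ false
  go false eq = eq
  go true eq = contradiction (ℕ.≡ᵇ⇒≡ (r + q * 12) 10 (subst T (sym eq) tt)) ne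

residue≢10 : ∀ r q → r % 12 ≢ 10 → r + q * 12 ≢ 10
residue≢10 r q ne eq = ne (trans (sym ([m+kn]%n≡m%n r q 12)) (cong (_% 12) eq))

Placed : ℕ → ℕ → ℕ → Set
Placed N m k = Σ (List (Square (suc N))) λ qs → length qs ≡ k × Unique qs × attackedCount qs ≤ m * suc N + m * m

module Constructions (N m k : ℕ) (m≤N : m ≤ N) (k≤G : k ≤ G m) where

  hexagon : ∀ r ℓ q e (r≡ : r ≡ q + e) (e≤1 : e ≤ 1) →
    m ≡ r + q + (ℓ + r + (ℓ + r)) → G m ≤ q * (2 * ℓ + r) + e * (ℓ + r) → Placed N m k
  hexagon r ℓ q e r≡ e≤1 m≡ G≤ = subst (λ m → Placed N m k) (sym m≡)
    (Placing.place N (Hexagon.corner r ℓ q e r≡ e≤1 N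
      (ℕ.≤-trans (ℕ.m≤m+n (r + q) _) m≤′) (ℕ.≤-trans (ℕ.≤-trans (ℕ.m≤m+n (ℓ + r) _) (ℕ.m≤n+m _ (r + q))) m≤′)) (ℕ.≤-trans k≤G G≤))
    where
    m≤′ : r + q + (ℓ + r + (ℓ + r)) ≤ N
    m≤′ = subst (_≤ N) m≡ m≤N

  four : ∀ v → m ≡ 6 * (suc v + v) → G m ≤ 4 * (v * (2 * v + suc v) + 1 * (v + suc v)) → Placed N m k
  four v m≡ G≤ = subst (λ m → Placed N m k) (sym m≡)
    (Placing.place N (FourCorners.corners v N (ℕ.≤-trans (subst (suc v + v + (suc v + v) ≤_) (lemma (suc v + v)) (ℕ.m≤m+n _ _)) (subst (_≤ N) m≡ m≤N)))
      (ℕ.≤-trans k≤G G≤))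
    where
    lemma : ∀ w → w + w + 4 * w ≡ 6 * w
    lemma = ℕ-solve-∀

  by-hexagon : ∀ M r ℓ q e t → m ≡ M → bonus m ≡ false → r ≡ q + e → e ≤ 1 →
    M ≡ r + q + (ℓ + r + (ℓ + r)) → 12 * suc (q * (2 * ℓ + r) + e * (ℓ + r)) ≡ M * M + suc t → Placed N m k
  by-hexagon M r ℓ q e t refl b r≡ e≤1 shape area = hexagon r ℓ q e r≡ e≤1 shape (G≤-plain M _ t b area)

  -- In all hexagon cases r, q and ℓ are close to m/6, so that rows, columns and diagonals each
  -- number about m/3. Where no bonus is present, t is 11 minus the remainder of m² modulo 12.
  case₀ : ∀ u → m ≡ 0 + u * 6 → bonus m ≡ false → Placed N m k
  case₀ u eq b = by-hexagon (0 + u * 6) u u u 0 11 eq b (sym (ℕ.+-identityʳ _)) z≤n (shape u) (area u)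
    where
    shape : ∀ u → 0 + u * 6 ≡ u + u + (u + u + (u + u))
    shape = ℕ-solve-∀
    area : ∀ u → 12 * suc (u * (2 * u + u) + 0 * (u + u)) ≡ (0 + u * 6) * (0 + u * 6) + suc 11
    area = ℕ-solve-∀

  case₁ : ∀ u → m ≡ 1 + suc u * 6 → bonus m ≡ false → Placed N m k
  case₁ u eq b = by-hexagon (1 + suc u * 6) (suc (suc u)) u (suc u) 1 10 eq b (ℕ.+-comm 1 _) ℕ.≤-refl (shape u) (area u)
    where
    shape : ∀ u → 1 + suc u * 6 ≡ (suc (suc u)) + (suc u) + (u + (suc (suc u)) + (u + (suc (suc u))))
    shape = ℕ-solve-∀
    area : ∀ u → 12 * suc ((suc u) * (2 * u + (suc (suc u))) + 1 * (u + (suc (suc u)))) ≡ (1 + suc u * 6) * (1 + suc u * 6) + suc 10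
    area = ℕ-solve-∀

  case₂ : ∀ u → m ≡ 2 + u * 6 → bonus m ≡ false → Placed N m k
  case₂ u eq b = by-hexagon (2 + u * 6) u (suc u) u 0 7 eq b (sym (ℕ.+-identityʳ _)) z≤n (shape u) (area u)
    where
    shape : ∀ u → 2 + u * 6 ≡ u + u + ((suc u) + u + ((suc u) + u))
    shape = ℕ-solve-∀
    area : ∀ u → 12 * suc (u * (2 * (suc u) + u) + 0 * ((suc u) + u)) ≡ (2 + u * 6) * (2 + u * 6) + suc 7
    area = ℕ-solve-∀

  case₃ : ∀ u → m ≡ 3 + u * 6 → Placed N m k
  case₃ u eq = hexagon (suc u) u u 1 (ℕ.+-comm 1 _) ℕ.≤-refl (trans eq (shape u))
    (G≤-bonus m _ 2 (subst (λ m → 12 * (u * (2 * u + (suc u)) + 1 * (u + (suc u))) ≡ m * m + suc 2) (sym eq) (area u)))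
    where
    shape : ∀ u → 3 + u * 6 ≡ (suc u) + u + (u + (suc u) + (u + (suc u)))
    shape = ℕ-solve-∀
    area : ∀ u → 12 * (u * (2 * u + (suc u)) + 1 * (u + (suc u))) ≡ (3 + u * 6) * (3 + u * 6) + suc 2
    area = ℕ-solve-∀

  case₄ : ∀ u → m ≡ 4 + u * 6 → bonus m ≡ false → Placed N m k
  case₄ u eq b = by-hexagon (4 + u * 6) (suc u) u (suc u) 0 7 eq b (sym (ℕ.+-identityʳ _)) z≤n (shape u) (area u)
    where
    shape : ∀ u → 4 + u * 6 ≡ (suc u) + (suc u) + (u + (suc u) + (u + (suc u)))
    shape = ℕ-solve-∀
    area : ∀ u → 12 * suc ((suc u) * (2 * u + (suc u)) + 0 * (u + (suc u))) ≡ (4 + u * 6) * (4 + u * 6) + suc 7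
    area = ℕ-solve-∀

  case₅ : ∀ u → m ≡ 5 + u * 6 → bonus m ≡ false → Placed N m k
  case₅ u eq b = by-hexagon (5 + u * 6) (suc u) (suc u) u 1 10 eq b (ℕ.+-comm 1 _) ℕ.≤-refl (shape u) (area u)
    where
    shape : ∀ u → 5 + u * 6 ≡ (suc u) + u + ((suc u) + (suc u) + ((suc u) + (suc u)))
    shape = ℕ-solve-∀
    area : ∀ u → 12 * suc (u * (2 * (suc u) + (suc u)) + 1 * ((suc u) + (suc u))) ≡ (5 + u * 6) * (5 + u * 6) + suc 10
    area = ℕ-solve-∀

  -- A single hexagon with parameters 2q + 1 has 3(2q + 1)² = m²/12 points. Four hexagons of 3q² +
  -- 3q + 1 points each have one more, and this is the bonus.
  case₆ : ∀ q → m ≡ 6 + q * 12 → Placed N m k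
  case₆ q eq = four q (trans eq (shape q))
    (G≤-bonus m _ 11 (subst (λ m → 12 * (4 * (q * (2 * q + suc q) + 1 * (q + suc q))) ≡ m * m + 12) (sym eq) (area q)))
    where
    shape : ∀ q → 6 + q * 12 ≡ 6 * (suc q + q)
    shape = ℕ-solve-∀
    area : ∀ q → 12 * (4 * (q * (2 * q + suc q) + 1 * (q + suc q))) ≡ (6 + q * 12) * (6 + q * 12) + 12
    area = ℕ-solve-∀

  halve : ∀ h e → e ≤ 1 → N ≡ e + h * 2 → m ≡ 10 → Placed N m k
  halve h e e≤1 eq refl = subst (λ N → Placed N 10 k) (sym N≡) (Placing.place (h + h + e) (Nine.nine h e 0<h e≤1) k≤G)
    where
    N≡ : N ≡ h + h + e
    N≡ = trans eq (lemma h e)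
      where
      lemma : ∀ h e → e + h * 2 ≡ h + h + e
      lemma = ℕ-solve-∀
    0<h : 0 < h
    0<h = linarith 3 (λ h e N → N ≐ h ⊕ h ⊕ e ⇒ e ≼ nat 1 ⇒ nat 10 ≼ N ⇒ ⊢ nat 0 ≺ h) h e N N≡ e≤1 m≤N

  ten : m ≡ 10 → Placed N m k
  ten m≡ with N divMod 2
  ... | result h zero eq = halve h 0 z≤n eq m≡
  ... | result h (suc zero) eq = halve h 1 ℕ.≤-refl eq m≡

  even-sixths : ∀ r q → m ≡ r + q * 12 → m ≡ r + 2 * q * 6
  even-sixths r q eq = trans eq (lemma r q)
    where
    lemma : ∀ r q → r + q * 12 ≡ r + 2 * q * 6
    lemma = ℕ-solve-∀

  odd-sixths : ∀ r q → m ≡ 6 + r + q * 12 → m ≡ r + suc (2 * q) * 6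
  odd-sixths r q eq = trans eq (lemma r q)
    where
    lemma : ∀ r q → 6 + r + q * 12 ≡ r + suc (2 * q) * 6
    lemma = ℕ-solve-∀

  no-bonus′ : ∀ r q → m ≡ r + q * 12 → bonus-table (r % 12) false ≡ false → r + q * 12 ≢ 10 → bonus m ≡ false
  no-bonus′ r q eq p ne = subst (λ m → bonus m ≡ false) (sym eq) (no-bonus r q p ne)

  construct : 0 < k → Placed N m k
  construct 0<k with m divMod 12
  ... | result q zero eq = case₀ (2 * q) (even-sixths 0 q eq) (no-bonus′ 0 q eq refl (residue≢10 0 q λ ()))
  -- m = 1 cannot occur, since `G 1` is 0 and k is positive.
  ... | result zero (suc zero) eq = contradiction (ℕ.<-≤-trans 0<k (subst (λ m → k ≤ G m) eq k≤G)) λ ()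
  ... | result (suc q) (suc zero) eq = case₁ (2 * q + 1) (trans (even-sixths 1 (suc q) eq) (lemma q)) (no-bonus′ 1 (suc q) eq refl (residue≢10 1 (suc q) λ ()))
    where
    lemma : ∀ q → 1 + 2 * suc q * 6 ≡ 1 + suc (2 * q + 1) * 6
    lemma = ℕ-solve-∀
  ... | result q (suc (suc zero)) eq = case₂ (2 * q) (even-sixths 2 q eq) (no-bonus′ 2 q eq refl (residue≢10 2 q λ ()))
  ... | result q (suc (suc (suc zero))) eq = case₃ (2 * q) (even-sixths 3 q eq)
  ... | result q (suc (suc (suc (suc zero)))) eq = case₄ (2 * q) (even-sixths 4 q eq) (no-bonus′ 4 q eq refl (residue≢10 4 q λ ()))
  ... | result q (suc (suc (suc (suc (suc zero))))) eq = case₅ (2 * q) (even-sixths 5 q eq) (no-bonus′ 5 q eq refl (residue≢10 5 q λ ()))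
  ... | result q (suc (suc (suc (suc (suc (suc zero)))))) eq = case₆ q eq
  ... | result q (suc (suc (suc (suc (suc (suc (suc zero))))))) eq = case₁ (2 * q) (odd-sixths 1 q eq) (no-bonus′ 7 q eq refl (residue≢10 7 q λ ()))
  ... | result q (suc (suc (suc (suc (suc (suc (suc (suc zero)))))))) eq = case₂ (suc (2 * q)) (odd-sixths 2 q eq) (no-bonus′ 8 q eq refl (residue≢10 8 q λ ()))
  ... | result q (suc (suc (suc (suc (suc (suc (suc (suc (suc zero))))))))) eq = case₃ (suc (2 * q)) (odd-sixths 3 q eq)
  -- In this residue class only m = 10 itself has a bonus; the larger members are served by one
  -- hexagon.
  ... | result zero (suc (suc (suc (suc (suc (suc (suc (suc (suc (suc zero)))))))))) eq = ten eq
  ... | result (suc q) (suc (suc (suc (suc (suc (suc (suc (suc (suc (suc zero)))))))))) eq = case₄ (suc (2 * suc q)) (odd-sixths 4 (suc q) eq) (no-bonus′ 10 (suc q) eq refl λ ())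
  ... | result q (suc (suc (suc (suc (suc (suc (suc (suc (suc (suc (suc zero))))))))))) eq = case₅ (suc (2 * q)) (odd-sixths 5 q eq) (no-bonus′ 11 q eq refl (residue≢10 11 q λ ()))

-- Minimality of m gives G (m − 1) < k, hence (m − 1)² < 12 k.
m²≤37k : ∀ m k → 0 < m → 0 < k → ((m′ : ℕ) → 0 < m′ → m′ < m → G m′ < k) → m * m ≤ 37 * k
m²≤37k (suc zero) k _ 0<k _ = ℕ.≤-trans 0<k (ℕ.m≤m+n k (36 * k))
-- In this clause `m` is the predecessor. Being at least 1 it satisfies (m + 1)² ≤ 3m² + 1, and m² <
-- 12k.
m²≤37k (suc m@(suc m′)) k _ 0<k min = linarith 6 (λ m mm Q k r sq → sq ≐ mm ⊕ 2 ⊙ m ⊕ nat 1 ⇒ m ≼ mm ⇒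
    mm ≐ r ⊕ Q ⇒ r ≺ nat 12 ⇒ Q ⊕ nat 12 ≼ 12 ⊙ k ⇒ nat 1 ≼ k ⇒ ⊢ sq ≼ 37 ⊙ k)
  m (m * m) ((m * m) / 12 * 12) k ((m * m) % 12) (suc m * suc m) (lemma m) (ℕ.m≤m*n m m)
  (m≡m%n+[m/n]*n (m * m) 12) (m%n<n (m * m) 12)
  (subst (λ j → j + 12 ≤ 12 * k) (ℕ.*-comm 12 ((m * m) / 12)) (linarith 2 (λ d k → d ≺ k ⇒ ⊢ 12 ⊙ d ⊕ nat 12 ≼ 12 ⊙ k)
    ((m * m) / 12) k (ℕ.≤-<-trans (ℕ.m≤m+n ((m * m) / 12) _) (min m (s≤s z≤n) ℕ.≤-refl))))
  0<k
  where
  lemma : ∀ m → suc m * suc m ≡ m * m + 2 * m + 1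
  lemma = ℕ-solve-∀

theorem1 : Σ ℕ λ C → (k n m : ℕ) → 0 < k → 0 < n → k ≤ n * n
    → 0 < m → G m ≥ k → ((m′ : ℕ) → 0 < m′ → m′ < m → G m′ < k)
    → (((qs : List (Square n)) → length qs ≡ k → Unique qs
    → m * n ≤ attackedCount qs + C * k)
    × (Σ (List (Square n)) λ qs → length qs ≡ k × Unique qs
    × attackedCount qs ≤ m * n + C * k))
theorem1 = 592 , bounds
  where
  bounds : (k n m : ℕ) → 0 < k → 0 < n → k ≤ n * n
    → 0 < m → G m ≥ k → ((m′ : ℕ) → 0 < m′ → m′ < m → G m′ < k)
    → (((qs : List (Square n)) → length qs ≡ k → Unique qs
    → m * n ≤ attackedCount qs + 592 * k)
    × (Σ (List (Square n)) λ qs → length qs ≡ k × Unique qs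
    × attackedCount qs ≤ m * n + 592 * k))
  bounds k (suc N) m 0<k _ k≤n² 0<m k≤G min = lower , upper (ℕ.≤-<-connex m N)
    where
    n = suc N
    m² : m * m ≤ 37 * k
    m² = m²≤37k m k 0<m 0<k min
    lower : (qs : List (Square n)) → length qs ≡ k → Unique qs → m * n ≤ attackedCount qs + 592 * k
    lower qs refl u = ℕ.≤-trans (Covering.attacked≥ N m qs u 0<k min)
      (linarith 3 (λ a mm k → mm ≼ 37 ⊙ k ⇒ ⊢ a ⊕ 16 ⊙ mm ≼ a ⊕ 592 ⊙ k) (attackedCount qs) (m * m) k m²)
    upper : m ≤ N ⊎ N < m → Σ (List (Square n)) λ qs → length qs ≡ k × Unique qs × attackedCount qs ≤ m * n + 592 * k
    upper (inj₁ m≤N) with Constructions.construct N m k m≤N k≤G 0<k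
    ... | qs , l , u , a = qs , l , u , linarith 4 (λ a mn mm k → a ≼ mn ⊕ mm ⇒ mm ≼ 37 ⊙ k ⇒ ⊢ a ≼ mn ⊕ 592 ⊙ k)
            (attackedCount qs) (m * n) (m * m) k a m²
    -- For m ≥ n the whole board has only n² ≤ mn squares, so any k squares will do.
    upper (inj₂ N<m) = take k (allSquares n)
      , trans (length-take k (allSquares n)) (ℕ.m≤n⇒m⊓n≡m (subst (k ≤_) (sym area) k≤n²))
      , Unique.take⁺ k (allSquares-unique n)
      , ℕ.≤-trans (subst (_≤ n * n) (sym (attackedCount≡ (take k (allSquares n))))
          (subst (# (attacked? (take k (allSquares n))) (allSquares n) ≤_) area (length-filter (attacked? (take k (allSquares n))) (allSquares n))))
        (ℕ.≤-trans (ℕ.*-monoˡ-≤ n N<m) (ℕ.m≤m+n (m * n) (592 * k)))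
      where
      area : length (allSquares n) ≡ n * n
      area = trans (length-cartesian (allFin n)) (cong₂ _*_ length-allFin length-allFin)
        where
        length-allFin : length (allFin n) ≡ n
        length-allFin = length-tabulate {n = n} id
        length-cartesian : ∀ {A : Set} (xs : List A) → length (cartesianProduct xs (allFin n)) ≡ length xs * length (allFin n)
        length-cartesian [] = refl
        length-cartesian (x ∷ xs) = trans (length-++ (map (x ,_) (allFin n))) (cong₂ _+_ (length-map (x ,_) (allFin n)) (length-cartesian xs))
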